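{- For all integers $k\geq 2$ and $n\geq 2k$, \[ rb(n,kK_2)= \begin{cases} 4, & n=4 \text{ and } k=2;\\ ext(n,(k-1)K_2)+3, & n=2k \text{ and } k\geq 7;\\ ext(n,(k-1)K_2)+2, & \text{otherwise.} \end{cases} \]
   Context: All graphs are finite, simple and undirected. $kK_2$ denotes a matching with $k$ edges (the disjoint union of $k$ copies of $K_2$). In an edge-colored graph, a subgraph is rainbow (totally multicolored) if no two of its edges have the same color; the number of colors of an edge-coloring is the number of distinct colors used. For a graph $H$, $f(n,H)$ is the maximum number of colors in an edge-coloring of the complete graph $K_n$ containing no rainbow copy of $H$, and the rainbow number is $rb(n,H)=f(n,H)+1$; equivalently, $rb(n,H)$ is the least number such that every edge-coloring of $K_n$ using at least $rb(n,H)$ colors contains a rainbow subgraph isomorphic to $H$. For a graph $H$, $ext(n,H)$ denotes the maximum number of edges of a graph on $n$ vertices containing no subgraph isomorphic to $H$. -}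

module Defs where

open import Data.Nat using (ℕ; _≤_)
open import Data.Bool using (Bool; true)
open import Data.Fin using (Fin)
import Data.Fin as F
import Data.Fin.Properties as FP
import Data.Nat.Properties as NP
open import Data.List using (List; length; map; filter; filterᵇ; allFin; cartesianProduct; deduplicate)
open import Data.Product using (_×_; _,_; proj₁; proj₂; Σ; ∃-syntax)
open import Relation.Binary.PropositionalEquality using (_≡_; _≢_)

edgesK : (n : ℕ) → List (Fin n × Fin n)
edgesK n = filter (λ p → proj₁ p FP.<? proj₂ p) (cartesianProduct (allFin n) (allFin n))

-- An edge-coloring of K_n (colors are natural numbers): a symmetric function
-- on pairs of vertices; only its values on pairs i ≠ j (edges) matter.
record EdgeColoring (n : ℕ) : Set where
  field
    col : Fin n → Fin n → ℕ
    col-sym : ∀ i j → col i j ≡ col j i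
open EdgeColoring public

numColors : {n : ℕ} → EdgeColoring n → ℕ
numColors {n} c = length (deduplicate NP._≟_ (map (λ p → col c (proj₁ p) (proj₂ p)) (edgesK n)))

Disjoint : {n : ℕ} → Fin n × Fin n → Fin n × Fin n → Set
Disjoint (a , b) (c , d) = (a ≢ c) × (a ≢ d) × (b ≢ c) × (b ≢ d)

record MatchingIn (n k : ℕ) : Set where
  field
    edge : Fin k → Fin n × Fin n
    edge-ok : ∀ t → proj₁ (edge t) F.< proj₂ (edge t)
    disjoint : ∀ s t → s ≢ t → Disjoint (edge s) (edge t)
open MatchingIn public

HasRainbowMatching : {n : ℕ} → EdgeColoring n → ℕ → Set
HasRainbowMatching {n} c k =
  Σ (MatchingIn n k) λ M → ∀ s t → s ≢ t →
    col c (proj₁ (edge M s)) (proj₂ (edge M s)) ≢ col c (proj₁ (edge M t)) (proj₂ (edge M t))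

ForcesRainbow : ℕ → ℕ → ℕ → Set
ForcesRainbow n k r = (c : EdgeColoring n) → r ≤ numColors c → HasRainbowMatching c k

IsRainbowNumber : ℕ → ℕ → ℕ → Set
IsRainbowNumber n k r = ForcesRainbow n k r × (∀ r' → ForcesRainbow n k r' → r ≤ r')

record SimpleGraph (n : ℕ) : Set where
  field
    adj : Fin n → Fin n → Bool
    adj-sym : ∀ i j → adj i j ≡ adj j i
    adj-irrefl : ∀ i → adj i i ≡ Data.Bool.false
open SimpleGraph public

numEdges : {n : ℕ} → SimpleGraph n → ℕ
numEdges {n} G = length (filterᵇ (λ p → adj G (proj₁ p) (proj₂ p)) (edgesK n))

ContainsMatching : {n : ℕ} → SimpleGraph n → ℕ → Set
ContainsMatching {n} G k = Σ (MatchingIn n k) λ M → ∀ t → adj G (proj₁ (edge M t)) (proj₂ (edge M t)) ≡ true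

IsExtMatching : ℕ → ℕ → ℕ → Set
IsExtMatching n k e =
  (∃[ G ] ((ContainsMatching {n} G k → Data.Empty.⊥) × numEdges G ≡ e))
  × (∀ (G : SimpleGraph n) → (ContainsMatching G k → Data.Empty.⊥) → numEdges G ≤ e)
  where import Data.Empty

{-# OPTIONS --safe #-}
module Submission where

-- Upper bound.  Let G consist of one edge of each colour, and add n - 2k universal vertices, so that a k-matching of G
-- becomes a perfect matching.  If there is none, take two non-adjacent vertices of maximum degree sum in the
-- Bondy–Chvátal closure of G, the smaller degree being i; counting non-edges restricts i.  For small i there are two
-- vertices a, b of small degree: outside them the colours other than that of ab have no (k-1)-matching, and the same count
-- shows that almost all colours occur in a set of 2k - 3 vertices, whose complement then carries at most one further colour
-- (two if n = 2k).  For the two largest values of i almost all edges of G meet a set of k - 1 vertices, or a set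
-- of k - 2 vertices whose complement contains a single triangle of G; some edge avoiding that set (and an edge of the
-- triangle) then extends to a rainbow matching.
--
-- Lower bound.  Colour an extremal graph for (k-1)K₂ injectively and all other edges with one new colour; for n = 2k ≥ 14
-- the extremal graph is complete on 2k - 3 vertices and there is room for two new colours.

open import Defs hiding (Disjoint)
import Defs as D
open import Data.Bool using (Bool; true; false; not; _∧_; _∨_) renaming (T to IsTrue)
import Data.Bool.Properties as BP
open import Data.Empty using (⊥; ⊥-elim)
open import Data.Fin using (Fin; zero; suc)
import Data.Fin as F
import Data.Fin.Properties as FP
open import Data.List using (List; []; _∷_; _++_; length; map; filter; filterᵇ; cartesianProduct; cartesianProductWith; allFin; tabulate; upTo; lookup; take; deduplicate)
open import Data.List.Properties using (length-map; length-++; length-take; length-tabulate; length-upTo; take-map)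
import Data.List.Properties as LP
open import Data.List.Membership.Propositional using (_∈_; _∉_; find; lose)
open import Data.List.Membership.Propositional.Properties using (∈-∃++; ∈-filter⁺; ∈-filter⁻; ∈-++⁺ˡ; ∈-++⁺ʳ; ∈-++⁻; ∈-map⁺; ∈-map⁻; ∈-cartesianProduct⁺; ∈-cartesianProduct⁻; ∈-cartesianProductWith⁺; ∈-allFin; ∈-lookup; ∈-deduplicate⁺; ∈-deduplicate⁻; ∈-upTo⁺; ∈-tabulate⁻)
open import Data.List.Relation.Binary.Permutation.Propositional using (_↭_; ↭-sym; ↭-trans; ↭-reflexive; ↭⇒↭ₛ; prep; swap; refl; trans)
open import Data.List.Relation.Binary.Permutation.Propositional.Properties using (shift; shifts; ↭-length; ∈-resp-↭; map⁺; drop-∷; ++⁺; ++⁺ˡ; ++⁺ʳ; ++-comm)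
import Data.List.Relation.Binary.Permutation.Setoid.Properties as PSP
open import Data.List.Relation.Unary.All as All using (All; []; _∷_)
open import Data.List.Relation.Unary.AllPairs using ([]; _∷_)
open import Data.List.Relation.Unary.Any using (here; there; any?)
open import Data.List.Relation.Unary.Unique.DecPropositional using (unique?)
open import Data.List.Relation.Unary.Unique.DecPropositional.Properties using (deduplicate-!)
open import Data.List.Relation.Unary.Unique.Propositional using (Unique)
import Data.List.Relation.Unary.Unique.Propositional.Properties as UP
open import Data.Nat using (ℕ; zero; suc; _+_; _*_; _∸_; _⊔_; _⊓_; _≤_; _<_; z≤n; s≤s; s≤s⁻¹; _≤?_; _<?_; _≤ᵇ_; _<ᵇ_)
open import Data.Nat.Properties
open import Data.Nat.Tactic.RingSolver using (solve-∀)
open import Data.Product using (_×_; _,_; proj₁; proj₂; ∃-syntax)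
open import Data.Product.Properties using () renaming (≡-dec to ≡-dec×)
open import Data.Sum using (_⊎_; inj₁; inj₂)
open import Data.Sum.Properties using (≡-dec)
open import Data.Unit using (tt)
open import Function using (_∘_; id)
open import Relation.Binary.Definitions using (DecidableEquality; tri<; tri≈; tri>)
open import Relation.Binary.PropositionalEquality as Eq using (_≡_; _≢_; refl; sym; cong; cong₂; subst; subst₂)
open import Relation.Nullary using (¬_; Dec; yes; no; does)
open import Relation.Nullary.Decidable using (_×-dec_; _→-dec_; ¬?; dec-true; dec-false; from-yes)

-- The colours are measured against the extremal number for k - 1 disjoint edges, while a graph
-- without k disjoint edges can have more edges than that. Counting the edges of G therefore cannot
-- give the matching by itself; the missing edge has to come from outside G. An edge outside G
-- repeats the colour of one edge of G, so using it costs that edge (`minus`, `avoid`), and the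
-- matching lemmas are arranged to leave room for one or two lost edges. All counting rests on
-- `numeric`. Its extreme configuration is a complete graph on i vertices joined to i + 1 isolated
-- vertices and to a complete graph on all remaining vertices. The number of missing pairs is
-- concave in i, hence least at the ends of the range. For k - 1 disjoint edges the two ends are the
-- two graphs behind `extremalEdges`; the interior is excluded by arithmetic, and the ends need the
-- structure of the colouring.

private variable
  A B : Set

-- Lists and permutations

Unique-↭ : {xs ys : List A} → xs ↭ ys → Unique xs → Unique ys
Unique-↭ {A} p = PSP.Unique-resp-↭ (Eq.setoid A) (↭⇒↭ₛ p)

pick : {x : A} {xs : List A} → x ∈ xs → ∃[ ys ] xs ↭ x ∷ ys
pick {x = x} x∈ with ∈-∃++ x∈
... | ys , zs , refl = ys ++ zs , shift x ys zs

∉-head : {x : A} {xs : List A} → Unique (x ∷ xs) → x ∉ xs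
∉-head (x≢ ∷ _) x∈ = All.lookup x≢ x∈ refl

∈-tail : {x y : A} {xs : List A} → y ∈ x ∷ xs → y ≢ x → y ∈ xs
∈-tail (here eq) y≢ = ⊥-elim (y≢ eq)
∈-tail (there y∈) _ = y∈

pick₂ : {x y : A} {xs : List A} → x ∈ xs → y ∈ xs → x ≢ y → ∃[ ys ] xs ↭ x ∷ y ∷ ys
pick₂ {x = x} x∈ y∈ x≢y with pick x∈
... | ys , p with pick (∈-tail (∈-resp-↭ p y∈) (x≢y ∘ sym))
... | zs , q = zs , ↭-trans p (prep x q)

nonempty : (xs : List A) → 1 ≤ length xs → ∃[ x ] x ∈ xs
nonempty (x ∷ _) _ = x , here refl

nonempty′ : ∀ {k} (xs : List A) → length xs ≡ suc k → ∃[ x ] x ∈ xs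
nonempty′ xs eq = nonempty xs (≤-trans (s≤s z≤n) (≤-reflexive (sym eq)))

Unique-⊆-length : {xs ys : List A} → Unique xs → (∀ {x} → x ∈ xs → x ∈ ys) → length xs ≤ length ys
Unique-⊆-length {xs = []} _ _ = z≤n
Unique-⊆-length {xs = x ∷ xs} u@(_ ∷ u′) sub with pick (sub (here refl))
... | zs , p = ≤-trans (s≤s (Unique-⊆-length u′ λ {y} y∈ → ∈-tail (∈-resp-↭ p (sub (there y∈))) λ { refl → ∉-head u y∈ }))
                 (≤-reflexive (sym (↭-length p)))

-- Finite sums

∑ : List A → (A → ℕ) → ℕ
∑ [] f = 0
∑ (x ∷ xs) f = f x + ∑ xs f

ind : Bool → ℕ
ind true = 1
ind false = 0

∑-cong : ∀ (xs : List A) {f g} → (∀ {x} → x ∈ xs → f x ≡ g x) → ∑ xs f ≡ ∑ xs g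
∑-cong [] h = refl
∑-cong (x ∷ xs) h = cong₂ _+_ (h (here refl)) (∑-cong xs (h ∘ there))

∑-mono : ∀ (xs : List A) {f g} → (∀ {x} → x ∈ xs → f x ≤ g x) → ∑ xs f ≤ ∑ xs g
∑-mono [] h = z≤n
∑-mono (x ∷ xs) h = +-mono-≤ (h (here refl)) (∑-mono xs (h ∘ there))

∑-mono-< : ∀ (xs : List A) {f g} {y} → (∀ {x} → x ∈ xs → f x ≤ g x) → y ∈ xs → f y < g y → ∑ xs f < ∑ xs g
∑-mono-< (x ∷ xs) h (here refl) lt = +-mono-<-≤ lt (∑-mono xs (h ∘ there))
∑-mono-< (x ∷ xs) h (there y∈) lt = +-mono-≤-< (h (here refl)) (∑-mono-< xs (h ∘ there) y∈ lt)

+-interchange : ∀ a b c d → (a + b) + (c + d) ≡ (a + c) + (b + d)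
+-interchange = solve-∀

∑-+ : ∀ (xs : List A) (f g : A → ℕ) → ∑ xs (λ x → f x + g x) ≡ ∑ xs f + ∑ xs g
∑-+ [] f g = refl
∑-+ (x ∷ xs) f g rewrite ∑-+ xs f g = +-interchange (f x) (g x) (∑ xs f) (∑ xs g)

∑-const : ∀ (xs : List A) c → ∑ xs (λ _ → c) ≡ length xs * c
∑-const [] c = refl
∑-const (x ∷ xs) c = cong (c +_) (∑-const xs c)

∑-* : ∀ (xs : List A) f c → ∑ xs (λ x → f x * c) ≡ ∑ xs f * c
∑-* [] f c = refl
∑-* (x ∷ xs) f c rewrite ∑-* xs f c = sym (*-distribʳ-+ c (f x) (∑ xs f))

∑-++ : ∀ (xs ys : List A) f → ∑ (xs ++ ys) f ≡ ∑ xs f + ∑ ys f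
∑-++ [] ys f = refl
∑-++ (x ∷ xs) ys f rewrite ∑-++ xs ys f = sym (+-assoc (f x) (∑ xs f) (∑ ys f))

∑-↭ : {xs ys : List A} (f : A → ℕ) → xs ↭ ys → ∑ xs f ≡ ∑ ys f
∑-↭ f refl = refl
∑-↭ f (prep x p) = cong (f x +_) (∑-↭ f p)
∑-↭ f (swap x y p) rewrite ∑-↭ f p = comm₃ (f x) (f y) _
  where
  comm₃ : ∀ a b c → a + (b + c) ≡ b + (a + c)
  comm₃ = solve-∀
∑-↭ f (trans p q) = Eq.trans (∑-↭ f p) (∑-↭ f q)

∑-map : ∀ (h : A → B) xs f → ∑ (map h xs) f ≡ ∑ xs (f ∘ h)
∑-map h [] f = refl
∑-map h (x ∷ xs) f = cong (f (h x) +_) (∑-map h xs f)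

∑-swap : ∀ (xs : List A) (ys : List B) (f : A → B → ℕ) → ∑ xs (λ x → ∑ ys (f x)) ≡ ∑ ys (λ y → ∑ xs (λ x → f x y))
∑-swap [] ys f = sym (Eq.trans (∑-const ys 0) (*-zeroʳ (length ys)))
∑-swap (x ∷ xs) ys f rewrite ∑-swap xs ys f = sym (∑-+ ys (f x) (λ y → ∑ xs (λ z → f z y)))

∑-zero : ∀ (xs : List A) {f} → (∀ {x} → x ∈ xs → f x ≡ 0) → ∑ xs f ≡ 0
∑-zero [] h = refl
∑-zero (x ∷ xs) h = cong₂ _+_ (h (here refl)) (∑-zero xs (h ∘ there))

∑-positive : ∀ (xs : List A) f → 1 ≤ ∑ xs f → ∃[ x ] x ∈ xs × 1 ≤ f x
∑-positive (x ∷ xs) f h with f x in eq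
... | suc k = x , here refl , subst (1 ≤_) (sym eq) (s≤s z≤n)
... | zero with ∑-positive xs f h
...   | y , y∈ , py = y , there y∈ , py

∑-≥ : ∀ (xs : List A) f {x} → x ∈ xs → f x ≤ ∑ xs f
∑-≥ (x ∷ xs) f (here refl) = m≤m+n (f x) _
∑-≥ (x ∷ xs) f (there x∈) = ≤-trans (∑-≥ xs f x∈) (m≤n+m _ (f x))

ind≤1 : ∀ p → ind p ≤ 1
ind≤1 true = ≤-refl
ind≤1 false = z≤n

ind-not : ∀ p → ind p + ind (not p) ≡ 1
ind-not true = refl
ind-not false = refl

ind⁻ : ∀ {p} → 1 ≤ ind p → p ≡ true
ind⁻ {true} _ = refl

∑-ind-unique : ∀ (xs : List A) (p : A → Bool) → Unique xs →
  (∀ {x y} → x ∈ xs → y ∈ xs → p x ≡ true → p y ≡ true → x ≡ y) → ∑ xs (ind ∘ p) ≤ 1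
∑-ind-unique [] p u h = z≤n
∑-ind-unique (x ∷ xs) p u@(_ ∷ u′) h with p x in eq
... | false = ∑-ind-unique xs p u′ λ a b → h (there a) (there b)
... | true = s≤s (≤-reflexive (∑-zero xs λ {y} y∈ → rest y∈))
  where
  rest : ∀ {y} → y ∈ xs → ind (p y) ≡ 0
  rest {y} y∈ with p y in eq′
  ... | false = refl
  ... | true = ⊥-elim (∉-head u (subst (_∈ xs) (h (there y∈) (here refl) eq′ eq) y∈))

true≢false : ∀ {p} → p ≡ true → p ≡ false → ⊥
true≢false refl ()

≢true⇒false : ∀ {p} → p ≢ true → p ≡ false
≢true⇒false {true} h = ⊥-elim (h refl)
≢true⇒false {false} h = refl

not-true : ∀ {p} → not p ≡ true → p ≡ false
not-true {false} _ = refl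

filter-∑ : ∀ (xs : List A) (p : A → Bool) → length (filter (λ x → p x BP.≟ true) xs) ≡ ∑ xs (ind ∘ p)
filter-∑ [] p = refl
filter-∑ (x ∷ xs) p with p x
... | true = cong suc (filter-∑ xs p)
... | false = filter-∑ xs p

search₂ : {P : A → A → Set} → (∀ x y → Dec (P x y)) → (W : List A) →
  (∃[ x ] ∃[ y ] x ∈ W × y ∈ W × P x y) ⊎ (∀ {x y} → x ∈ W → y ∈ W → ¬ P x y)
search₂ {P = P} P? W with any? (λ x → any? (P? x) W) W
... | yes a with find a
...   | x , x∈ , a′ with find a′
...     | y , y∈ , pxy = inj₁ (x , y , x∈ , y∈ , pxy)
search₂ P? W | no n = inj₂ λ x∈ y∈ pxy → n (lose x∈ (lose y∈ pxy))

argmax : (xs : List A) (f : A → ℕ) {x : A} → x ∈ xs → ∃[ y ] y ∈ xs × (∀ {z} → z ∈ xs → f z ≤ f y)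
argmax (x ∷ []) f _ = x , here refl , λ { (here refl) → ≤-refl }
argmax (x ∷ x′ ∷ xs) f _ with argmax (x′ ∷ xs) f (here refl)
... | y , y∈ , h with ≤-total (f x) (f y)
...   | inj₁ le = y , there y∈ , λ { (here refl) → le ; (there z∈) → h z∈ }
...   | inj₂ ge = x , here refl , λ { (here refl) → ≤-refl ; (there z∈) → ≤-trans (h z∈) ge }

twice-≤ : ∀ {a b} → a + a ≤ b + b → a ≤ b
twice-≤ {a} {b} h with a ≤? b
... | yes p = p
... | no q = ⊥-elim (<⇒≱ (+-mono-< (≰⇒> q) (≰⇒> q)) h)

-- Perfect matchings

flat : List (A × A) → List A
flat [] = []
flat ((x , y) ∷ ms) = x ∷ y ∷ flat ms

Edges : (A → A → Bool) → List (A × A) → Set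
Edges e = All (λ p → e (proj₁ p) (proj₂ p) ≡ true)

-- Disjointness of the edges is not recorded: it follows from the permutation whenever `W` has no
-- repetitions.
PM : (A → A → Bool) → List A → Set
PM e W = ∃[ ms ] Edges e ms × flat ms ↭ W

pm-perm : {e : A → A → Bool} {W W′ : List A} → W ↭ W′ → PM e W → PM e W′
pm-perm p (ms , es , q) = ms , es , ↭-trans q p

pm-cons : {e : A → A → Bool} {x y : A} {W : List A} → e x y ≡ true → PM e W → PM e (x ∷ y ∷ W)
pm-cons {x = x} {y} h (ms , es , q) = (x , y) ∷ ms , h ∷ es , prep x (prep y q)

pm-mono : {e f : A → A → Bool} {W : List A} → (∀ x y → e x y ≡ true → f x y ≡ true) → PM e W → PM f W
pm-mono h (ms , es , q) = ms , All.map (h _ _) es , q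

rot₄ : ∀ (u v a b : A) {W} → u ∷ a ∷ v ∷ b ∷ W ↭ u ∷ v ∷ a ∷ b ∷ W
rot₄ u v a b = prep u (swap a v refl)

front₂ : ∀ (a b x y : A) {W} → a ∷ b ∷ x ∷ y ∷ W ↭ x ∷ y ∷ a ∷ b ∷ W
front₂ a b x y = ↭-trans (prep a (swap b x refl)) (↭-trans (swap a x refl) (prep x (↭-trans (prep a (swap b y refl)) (swap a y refl))))

-- For a matching edge ab, either u and v can be matched crosswise to a and b, or u and v together
-- send at most two edges to it. In the second case ab is set aside: both sides of the strict
-- inequality lose at most what the length loses, so it survives, and it fails for the empty
-- matching.
augment : {e : A → A → Bool} (u v : A) (ms : List (A × A)) → Edges e ms →
  length (flat ms) < ∑ (flat ms) (λ w → ind (e u w) + ind (e v w)) → PM e (u ∷ v ∷ flat ms)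
augment {e = e} u v ((a , b) ∷ ms) (h ∷ es) lt with e u a in ua | e v a in va | e u b in ub | e v b in vb
... | true | _ | _ | true = pm-perm (rot₄ u v a b) (pm-cons ua (pm-cons vb (ms , es , refl)))
... | _ | true | true | _ = pm-perm (↭-trans (rot₄ u v b a) (prep u (prep v (swap b a refl)))) (pm-cons ub (pm-cons va (ms , es , refl)))
... | true | true | false | false = pm-perm (front₂ a b u v) (pm-cons h (augment u v ms es (s≤s⁻¹ (s≤s⁻¹ lt))))
... | true | false | false | false = pm-perm (front₂ a b u v) (pm-cons h (augment u v ms es (≤-trans (n≤1+n _) (s≤s⁻¹ lt))))
... | true | false | true | false = pm-perm (front₂ a b u v) (pm-cons h (augment u v ms es (s≤s⁻¹ (s≤s⁻¹ lt))))
... | false | true | false | true = pm-perm (front₂ a b u v) (pm-cons h (augment u v ms es (s≤s⁻¹ (s≤s⁻¹ lt))))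
... | false | true | false | false = pm-perm (front₂ a b u v) (pm-cons h (augment u v ms es (≤-trans (n≤1+n _) (s≤s⁻¹ lt))))
... | false | false | true | true = pm-perm (front₂ a b u v) (pm-cons h (augment u v ms es (s≤s⁻¹ (s≤s⁻¹ lt))))
... | false | false | true | false = pm-perm (front₂ a b u v) (pm-cons h (augment u v ms es (≤-trans (n≤1+n _) (s≤s⁻¹ lt))))
... | false | false | false | true = pm-perm (front₂ a b u v) (pm-cons h (augment u v ms es (≤-trans (n≤1+n _) (s≤s⁻¹ lt))))
... | false | false | false | false = pm-perm (front₂ a b u v) (pm-cons h (augment u v ms es (≤-trans (n≤1+n _) (≤-trans (n≤1+n _) lt))))

-- Graphs and the Bondy–Chvátal closure for perfect matchings

record Graph (A : Set) : Set where
  field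
    E : A → A → Bool
    E-sym : ∀ x y → E x y ≡ E y x
    E-irr : ∀ x → E x x ≡ false
open Graph public

-- `mis` also counts x itself, so that degree and `mis` add up to the length exactly, and a vertex
-- is universal when `mis` is 1.
deg mis : Graph A → List A → A → ℕ
deg G W x = ∑ W (λ y → ind (E G x y))
mis G W x = ∑ W (λ y → ind (not (E G x y)))

Mis : Graph A → List A → ℕ
Mis G W = ∑ W (mis G W)

deg+mis : ∀ (G : Graph A) W x → deg G W x + mis G W x ≡ length W
deg+mis G W x = Eq.trans (sym (∑-+ W _ _)) (Eq.trans (∑-cong W λ {y} _ → ind-not (E G x y)) (Eq.trans (∑-const W 1) (*-identityʳ _)))

_⊑_ : Graph A → Graph A → Set
G ⊑ H = ∀ x y → E G x y ≡ true → E H x y ≡ true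

ind-mono : ∀ {p q} → (p ≡ true → q ≡ true) → ind p ≤ ind q
ind-mono {true} {q} h rewrite h refl = ≤-refl
ind-mono {false} h = z≤n

ind-anti : ∀ {p q} → (p ≡ true → q ≡ true) → ind (not q) ≤ ind (not p)
ind-anti {p} {true} h = z≤n
ind-anti {true} {false} h with h refl
... | ()
ind-anti {false} {false} h = ≤-refl

mis-anti : ∀ {G H : Graph A} → G ⊑ H → ∀ W x → mis H W x ≤ mis G W x
mis-anti G⊑H W x = ∑-mono W λ {y} _ → ind-anti (G⊑H x y)

deg-mono : ∀ {G H : Graph A} → G ⊑ H → ∀ W x → deg G W x ≤ deg H W x
deg-mono G⊑H W x = ∑-mono W λ {y} _ → ind-mono (G⊑H x y)

deg-↭ : ∀ (G : Graph A) {W W′} x → W ↭ W′ → deg G W x ≡ deg G W′ x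
deg-↭ G x p = ∑-↭ _ p

Mis-↭ : ∀ (G : Graph A) {W W′} → W ↭ W′ → Mis G W ≡ Mis G W′
Mis-↭ G {W} p = Eq.trans (∑-cong W λ _ → ∑-↭ _ p) (∑-↭ _ p)

E-≢ : ∀ (G : Graph A) {x y} → E G x y ≡ true → x ≢ y
E-≢ G {x} h refl = true≢false h (E-irr G x)

complete⇒PM : (G : Graph A) (m : ℕ) (W : List A) → length W ≡ m + m → Unique W →
  (∀ {x y} → x ∈ W → y ∈ W → x ≢ y → E G x y ≡ true) → PM (E G) W
complete⇒PM G zero [] _ _ _ = [] , [] , refl
complete⇒PM G (suc m) (x ∷ []) len u h with () ← Eq.trans len (cong suc (+-suc m m))
complete⇒PM G (suc m) (x ∷ y ∷ W) len u@(_ ∷ _ ∷ u′) h =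
  pm-cons (h (here refl) (there (here refl)) λ { refl → ∉-head u (here refl) })
    (complete⇒PM G m W (suc-injective (suc-injective (Eq.trans len (cong suc (+-suc m m))))) u′ λ a b → h (there (there a)) (there (there b)))

module _ (_≟_ : DecidableEquality A) where

  isEdge : A → A → A → A → Bool
  isEdge u v x y = (does (x ≟ u) ∧ does (y ≟ v)) ∨ (does (x ≟ v) ∧ does (y ≟ u))

  isEdge-sym : ∀ u v x y → isEdge u v x y ≡ isEdge u v y x
  isEdge-sym u v x y rewrite BP.∧-comm (does (y ≟ u)) (does (x ≟ v)) | BP.∧-comm (does (y ≟ v)) (does (x ≟ u)) = BP.∨-comm _ (does (x ≟ v) ∧ does (y ≟ u))

  isEdge-irr : ∀ {u v} → u ≢ v → ∀ x → isEdge u v x x ≡ false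
  isEdge-irr {u} {v} u≢v x with x ≟ u | x ≟ v
  ... | yes refl | yes refl = ⊥-elim (u≢v refl)
  ... | yes _ | no _ = refl
  ... | no _ | yes _ = refl
  ... | no _ | no _ = refl

  isEdge-refl : ∀ u v → isEdge u v u v ≡ true
  isEdge-refl u v rewrite dec-true (u ≟ u) refl | dec-true (v ≟ v) refl = refl

  isEdge⁻ : ∀ {u v x y} → isEdge u v x y ≡ true → (x ≡ u × y ≡ v) ⊎ (x ≡ v × y ≡ u)
  isEdge⁻ {u} {v} {x} {y} h with x ≟ u | y ≟ v | x ≟ v | y ≟ u
  ... | yes p | yes q | _ | _ = inj₁ (p , q)
  ... | yes p | no q | yes r | yes s = inj₂ (r , s)
  ... | no p | _ | yes r | yes s = inj₂ (r , s)
  isEdge⁻ () | yes p | no q | yes r | no s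
  isEdge⁻ () | yes p | no q | no r | _
  isEdge⁻ () | no p | _ | yes r | no s
  isEdge⁻ () | no p | _ | no r | _

  addEdge : (G : Graph A) {u v : A} → u ≢ v → Graph A
  addEdge G {u} {v} u≢v = record
    { E = λ x y → E G x y ∨ isEdge u v x y
    ; E-sym = λ x y → cong₂ _∨_ (E-sym G x y) (isEdge-sym u v x y)
    ; E-irr = λ x → cong₂ _∨_ (E-irr G x) (isEdge-irr u≢v x) }

  addEdge⁻ : ∀ (G : Graph A) {u v} (u≢v : u ≢ v) {x y} → E (addEdge G u≢v) x y ≡ true → E G x y ≡ true ⊎ (x ≡ u × y ≡ v) ⊎ (x ≡ v × y ≡ u)
  addEdge⁻ G u≢v {x} {y} h with E G x y
  ... | true = inj₁ refl
  ... | false = inj₂ (isEdge⁻ h)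

  ⊑-addEdge : ∀ (G : Graph A) {u v} (u≢v : u ≢ v) → G ⊑ addEdge G u≢v
  ⊑-addEdge G u≢v x y h rewrite h = refl

  without : ∀ (G : Graph A) {u v} (u≢v : u ≢ v) ms → u ∉ flat ms → Edges (E (addEdge G u≢v)) ms → Edges (E G) ms
  without G u≢v [] _ [] = []
  without G u≢v ((x , y) ∷ ms) u∉ (h ∷ hs) with addEdge⁻ G u≢v h
  ... | inj₁ e = e ∷ without G u≢v ms (λ z → u∉ (there (there z))) hs
  ... | inj₂ (inj₁ (refl , _)) = ⊥-elim (u∉ (here refl))
  ... | inj₂ (inj₂ (_ , refl)) = ⊥-elim (u∉ (there (here refl)))

  splitEdge : ∀ (G : Graph A) {u v} (u≢v : u ≢ v) ms → Unique (flat ms) → Edges (E (addEdge G u≢v)) ms →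
    Edges (E G) ms ⊎ (∃[ ms′ ] Edges (E G) ms′ × flat ms ↭ u ∷ v ∷ flat ms′)
  splitEdge G u≢v [] _ [] = inj₁ []
  splitEdge G {u} {v} u≢v ((x , y) ∷ ms) un@(_ ∷ un′@(_ ∷ un″)) (h ∷ hs) with addEdge⁻ G u≢v h
  ... | inj₁ e with splitEdge G u≢v ms un″ hs
  ...   | inj₁ es = inj₁ (e ∷ es)
  ...   | inj₂ (ms′ , es , p) = inj₂ ((x , y) ∷ ms′ , e ∷ es , ↭-trans (prep x (prep y p)) (front₂ x y u v))
  splitEdge G u≢v ((x , y) ∷ ms) un@(_ ∷ un′@(_ ∷ un″)) (h ∷ hs) | inj₂ (inj₁ (refl , refl)) =
    inj₂ (ms , without G u≢v ms (∉-head un ∘ there) hs , refl)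
  splitEdge G u≢v ((x , y) ∷ ms) un@(_ ∷ un′@(_ ∷ un″)) (h ∷ hs) | inj₂ (inj₂ (refl , refl)) =
    inj₂ (ms , without G u≢v ms (∉-head un′) hs , swap x y refl)

  -- If the perfect matching uses uv, the other edges match the remaining length W - 2 vertices. A
  -- degree sum of at least length W - 1 exceeds that number, which is what `augment` asks for; this
  -- is the Bondy-Chvátal threshold for perfect matchings.
  removeEdge : ∀ (G : Graph A) {u v} (u≢v : u ≢ v) {W} → Unique W → E G u v ≡ false →
    length W ≤ suc (deg G W u + deg G W v) → PM (E (addEdge G u≢v)) W → PM (E G) W
  removeEdge G {u} {v} u≢v {W} un nuv le (ms , es , p) with splitEdge G u≢v ms (Unique-↭ (↭-sym p) un) es
  ... | inj₁ es′ = ms , es′ , p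
  ... | inj₂ (ms′ , es′ , q) = pm-perm r (augment u v ms′ es′ lt)
    where
    r : u ∷ v ∷ flat ms′ ↭ W
    r = ↭-trans (↭-sym q) p
    degs : ∀ w → E G w u ≡ false → E G w v ≡ false → deg G W w ≡ deg G (flat ms′) w
    degs w wu wv rewrite deg-↭ G w (↭-sym r) | wu | wv = refl
    du = degs u (E-irr G u) nuv
    dv = degs v (Eq.trans (E-sym G v u) nuv) (E-irr G v)
    lt : length (flat ms′) < ∑ (flat ms′) (λ w → ind (E G u w) + ind (E G v w))
    lt rewrite ∑-+ (flat ms′) (λ w → ind (E G u w)) (λ w → ind (E G v w)) | sym du | sym dv | sym (↭-length r) = s≤s⁻¹ le

  record Closure (G : Graph A) (W : List A) : Set where
    field
      H : Graph A
      G⊑H : G ⊑ H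
      back : PM (E H) W → PM (E G) W
      closed : ∀ {x y} → x ∈ W → y ∈ W → x ≢ y → E H x y ≡ false → 2 + (deg H W x + deg H W y) ≤ length W

  -- Each added edge lowers `Mis`, which therefore bounds the number of rounds.
  closure : ∀ {W} → Unique W → ∀ fuel (G : Graph A) → Mis G W < fuel → Closure G W
  closure {W} un (suc fuel) G lt
    with search₂ (λ x y → ¬? (x ≟ y) ×-dec ((E G x y BP.≟ false) ×-dec (length W ≤? suc (deg G W x + deg G W y)))) W
  ... | inj₂ none = record
    { H = G ; G⊑H = λ _ _ h → h ; back = id
    ; closed = λ x∈ y∈ x≢y nxy → ≰⇒> λ le → none x∈ y∈ (x≢y , nxy , le) }
  ... | inj₁ (u , v , u∈ , v∈ , u≢v , nuv , le) = record
    { H = Closure.H rec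
    ; G⊑H = λ x y h → Closure.G⊑H rec x y (sub x y h)
    ; back = removeEdge G u≢v un nuv le ∘ Closure.back rec
    ; closed = Closure.closed rec }
    where
    sub = ⊑-addEdge G u≢v
    smaller : mis (addEdge G u≢v) W u < mis G W u
    smaller = ∑-mono-< W (λ {y} _ → ind-anti (sub u y)) v∈ strict
      where
      strict : ind (not (E (addEdge G u≢v) u v)) < ind (not (E G u v))
      strict rewrite nuv | isEdge-refl u v = s≤s z≤n
    rec = closure un fuel (addEdge G u≢v) (<-≤-trans (∑-mono-< W (λ {x} _ → mis-anti {G = G} {addEdge G u≢v} sub W x) u∈ smaller) (s≤s⁻¹ lt))

  record Barrier (G : Graph A) (W : List A) : Set where
    field
      closureOf : Closure G W
    open Closure closureOf public
    field
      u v : A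
      u∈ : u ∈ W
      v∈ : v ∈ W
      u≢v : u ≢ v
      nuv : E H u v ≡ false
      du≤dv : deg H W u ≤ deg H W v
      maximal : ∀ {x y} → x ∈ W → y ∈ W → x ≢ y → E H x y ≡ false → deg H W x + deg H W y ≤ deg H W u + deg H W v

  PM⊎Barrier : (G : Graph A) (m : ℕ) {W : List A} → Unique W → length W ≡ m + m → PM (E G) W ⊎ Barrier G W
  PM⊎Barrier G m {W} un len = choose
    where
    cl = closure un (suc (Mis G W)) G ≤-refl
    open Closure cl
    Non : A × A → Set
    Non (x , y) = x ≢ y × E H x y ≡ false
    non? : ∀ p → Dec (Non p)
    non? (x , y) = ¬? (x ≟ y) ×-dec (E H x y BP.≟ false)
    pairs = filter non? (cartesianProduct W W)
    val : A × A → ℕ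
    val (x , y) = deg H W x + deg H W y
    choose : PM (E G) W ⊎ Barrier G W
    choose with search₂ (λ x y → non? (x , y)) W
    ... | inj₂ none = inj₁ (back (complete⇒PM H m W len un λ {x} {y} x∈ y∈ x≢y → adjacent x∈ y∈ x≢y))
      where
      adjacent : ∀ {x y} → x ∈ W → y ∈ W → x ≢ y → E H x y ≡ true
      adjacent {x} {y} x∈ y∈ x≢y with E H x y in eq
      ... | true = refl
      ... | false = ⊥-elim (none x∈ y∈ (x≢y , eq))
    ... | inj₁ (x , y , x∈ , y∈ , nxy) with argmax pairs val (∈-filter⁺ non? (∈-cartesianProduct⁺ x∈ y∈) nxy)
    ...   | (u , v) , uv∈ , max with ∈-filter⁻ non? {xs = cartesianProduct W W} uv∈
    ...     | uv∈′ , u≢v , nuv with ∈-cartesianProduct⁻ W W uv∈′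
    ...       | u∈ , v∈ with ≤-total (deg H W u) (deg H W v)
    ...         | inj₁ le = inj₂ (record
      { closureOf = cl ; u = u ; v = v ; u∈ = u∈ ; v∈ = v∈ ; u≢v = u≢v ; nuv = nuv ; du≤dv = le
      ; maximal = λ a b c d → max (∈-filter⁺ non? (∈-cartesianProduct⁺ a b) (c , d)) })
    ...         | inj₂ ge = inj₂ (record
      { closureOf = cl ; u = v ; v = u ; u∈ = v∈ ; v∈ = u∈ ; u≢v = u≢v ∘ sym ; nuv = Eq.trans (E-sym H v u) nuv ; du≤dv = ge
      ; maximal = λ a b c d → ≤-trans (max (∈-filter⁺ non? (∈-cartesianProduct⁺ a b) (c , d))) (≤-reflexive (+-comm (deg H W u) _)) })

  module BarrierProperties (G : Graph A) {W : List A} (un : Unique W) (bar : Barrier G W) where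
    open Barrier bar public

    bound : 2 + (deg H W u + deg H W v) ≤ length W
    bound = closed u∈ v∈ u≢v nuv

    -- The subtractions are exact: c counts the non-neighbours of v other than v itself.
    c t : ℕ
    c = length W ∸ suc (deg H W v)
    t = deg H W v ∸ deg H W u

    c-eq : suc (deg H W v) + c ≡ length W
    c-eq = m+[n∸m]≡n (≤-trans (≤-trans (n≤1+n _) (s≤s (s≤s (m≤n+m _ (deg H W u))))) bound)

    t-eq : deg H W u + t ≡ deg H W v
    t-eq = m+[n∸m]≡n du≤dv

    -- `inB` contains u itself, whose degree is at most that of v; `inA` leaves v out, because the
    -- degree of v need not be bounded by that of u.
    inB inA : A → Bool
    inB x = not (E H u x)
    inA x = not (E H v x) ∧ not (does (x ≟ v))

    inB-deg : ∀ {x} → x ∈ W → inB x ≡ true → deg H W x ≤ deg H W v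
    inB-deg {x} x∈ h with x ≟ u
    ... | yes refl = du≤dv
    ... | no x≢u with E H u x in eq
    ...   | false = +-cancelˡ-≤ (deg H W u) _ _ (maximal u∈ x∈ (x≢u ∘ sym) eq)

    inA-deg : ∀ {x} → x ∈ W → inA x ≡ true → deg H W x ≤ deg H W u
    inA-deg {x} x∈ h with E H v x in eq | x ≟ v
    ... | false | no x≢v = +-cancelʳ-≤ (deg H W v) _ _ (maximal x∈ v∈ x≢v (Eq.trans (E-sym H x v) eq))

    mis≥ : ∀ {x} d r → deg H W x ≤ d → d + r ≡ length W → r ≤ mis H W x
    mis≥ {x} d r le eq = +-cancelˡ-≤ d _ _ (≤-trans (≤-reflexive (Eq.trans eq (sym (deg+mis H W x)))) (+-monoˡ-≤ _ le))

    -- A lower bound for `mis` read off from maximality of the degree sum: every vertex misses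
    -- itself, one in B misses at least c + 1 vertices, one in A at least c + t + 1.
    excess : A → ℕ
    excess x = 1 + (ind (inB x) * c + ind (inA x) * t)

    i+ : deg H W u + (suc c + t) ≡ length W
    i+ = Eq.trans (rearr (deg H W u) c t) (Eq.trans (cong (λ d → suc d + c) t-eq) c-eq)
      where
      rearr : ∀ i c t → i + (suc c + t) ≡ suc (i + t) + c
      rearr = solve-∀

    d+ : deg H W v + suc c ≡ length W
    d+ = Eq.trans (+-suc _ c) c-eq

    mis-pos : ∀ {x} → x ∈ W → 1 ≤ mis H W x
    mis-pos {x} x∈ = ≤-trans (≤-reflexive (sym (cong (ind ∘ not) (E-irr H x)))) (∑-≥ W (λ y → ind (not (E H x y))) x∈)

    excess≤mis : ∀ {x} → x ∈ W → excess x ≤ mis H W x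
    excess≤mis {x} x∈ with inB x in eB | inA x in eA
    ... | w | true = ≤-trans (s≤s (+-mono-≤ (≤-trans (*-monoˡ-≤ c (ind≤1 w)) (≤-reflexive (*-identityˡ c))) (≤-reflexive (*-identityˡ t))))
                       (mis≥ _ _ (inA-deg x∈ eA) i+)
    ... | true | false = ≤-trans (≤-reflexive (simp c)) (mis≥ _ _ (inB-deg x∈ eB) d+)
      where
      simp : ∀ c → 1 + (1 * c + 0) ≡ suc c
      simp = solve-∀
    ... | false | false = mis-pos x∈

    countB : ∑ W (ind ∘ inB) ≡ suc c + t
    countB = +-cancelˡ-≡ (deg H W u) _ _ (Eq.trans (deg+mis H W u) (sym i+))

    misv : mis H W v ≡ suc c
    misv = +-cancelˡ-≡ (deg H W v) _ _ (Eq.trans (deg+mis H W v) (sym d+))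

    countA : c ≤ ∑ W (ind ∘ inA)
    countA = s≤s⁻¹ (≤-trans (≤-reflexive (sym misv)) (≤-trans (∑-mono W λ {x} _ → bit x) (≤-trans (≤-reflexive (∑-+ W _ _))
               (≤-trans (+-monoˡ-≤ _ (∑-ind-unique W (λ x → does (x ≟ v)) un λ _ _ p q → Eq.trans (is p) (sym (is q)))) ≤-refl))))
      where
      is : ∀ {x} → does (x ≟ v) ≡ true → x ≡ v
      is {x} h with x ≟ v
      ... | yes p = p
      bit : ∀ x → ind (not (E H v x)) ≤ ind (does (x ≟ v)) + ind (inA x)
      bit x with E H v x | x ≟ v
      ... | true | _ = z≤n
      ... | false | yes _ = s≤s z≤n
      ... | false | no _ = s≤s z≤n

    ∑excess : length W + (∑ W (ind ∘ inB) * c + ∑ W (ind ∘ inA) * t) ≡ ∑ W excess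
    ∑excess = sym (Eq.trans (∑-+ W (λ _ → 1) _) (cong₂ _+_ (Eq.trans (∑-const W 1) (*-identityʳ (length W)))
                (Eq.trans (∑-+ W _ _) (cong₂ _+_ (∑-* W (ind ∘ inB) c) (∑-* W (ind ∘ inA) t)))))

    low : List A
    low = filter (λ x → inA x BP.≟ true) W

    low-unique : Unique low
    low-unique = UP.filter⁺ (λ x → inA x BP.≟ true) un

    low-deg : ∀ {x} → x ∈ low → x ∈ W × deg H W x ≤ deg H W u
    low-deg x∈ with ∈-filter⁻ (λ x → inA x BP.≟ true) {xs = W} x∈
    ... | x∈W , h = x∈W , inA-deg x∈W h

    c> : suc (deg H W u) ≤ c
    c> = +-cancelˡ-≤ (suc (deg H W v)) _ _ (≤-trans (≤-reflexive (rearr (deg H W u) (deg H W v))) (≤-trans bound (≤-reflexive (sym c-eq))))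
      where
      rearr : ∀ i d → suc d + suc i ≡ 2 + (i + d)
      rearr = solve-∀

    low-length : suc (deg H W u) ≤ length low
    low-length = ≤-trans c> (≤-trans countA (≤-reflexive (sym (filter-∑ W inA))))

    Mis-lower : length W + c * (suc c + t + t) ≤ Mis H W
    Mis-lower = ≤-trans (+-monoʳ-≤ (length W) (≤-trans (≤-reflexive (rearr c t)) (+-mono-≤ (≤-reflexive (cong (_* c) (sym countB))) (*-monoˡ-≤ t countA))))
                  (≤-trans (≤-reflexive ∑excess) (∑-mono W excess≤mis))
      where
      rearr : ∀ c t → c * (suc c + t + t) ≡ (suc c + t) * c + c * t
      rearr = solve-∀

    half : ∀ {m} → length W ≡ m + m → ∃[ p ] suc (deg H W u + p) ≡ m
    half {m} len = m ∸ suc (deg H W u) , m+[n∸m]≡n {suc (deg H W u)} {m} (twice-≤ {suc (deg H W u)} {m} (≤-trans (≤-reflexive (rearr (deg H W u))) (≤-trans (s≤s (s≤s (+-monoʳ-≤ (deg H W u) du≤dv))) (≤-trans bound (≤-reflexive len)))))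
      where
      rearr : ∀ i → suc i + suc i ≡ 2 + (i + i)
      rearr = solve-∀

    -- Write c = i + 1 + s with i the degree of u; then s + t = 2p, and c(c + 1 + 2t) equals (i +
    -- 1)(i + 2 + 4p) plus a nonnegative multiple of s. For s = 0 the bound is attained by a
    -- complete graph on i vertices joined to i + 1 isolated vertices and a complete graph on 2p + 1
    -- vertices.
    numeric : ∀ {m p} → length W ≡ m + m → suc (deg H W u + p) ≡ m →
      m + m + suc (deg H W u) * (m + 1 + 3 * p) ≤ Mis H W
    numeric {m} {p} len refl = ≤-trans (+-mono-≤ (≤-reflexive (sym len)) ineq) Mis-lower
      where
      i = deg H W u
      s = c ∸ suc i
      s-eq : suc i + s ≡ c
      s-eq = m+[n∸m]≡n c>
      sum-eq : s + t ≡ p + p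
      sum-eq = +-cancelˡ-≡ (2 + (i + i)) _ _ (Eq.trans (r₁ i s t) (Eq.trans (cong (λ c → i + (suc c + t)) s-eq) (Eq.trans i+ (Eq.trans len (r₂ i p)))))
        where
        r₁ : ∀ i s t → 2 + (i + i) + (s + t) ≡ i + (suc (suc i + s) + t)
        r₁ = solve-∀
        r₂ : ∀ i p → suc (i + p) + suc (i + p) ≡ 2 + (i + i) + (p + p)
        r₂ = solve-∀
      ineq : suc i * (suc (i + p) + 1 + 3 * p) ≤ c * (suc c + t + t)
      ineq = ≤-trans (≤-reflexive (Eq.trans (r₁ i p) (Eq.trans (cong (λ q → suc i * (i + 2 + (q + q))) (sym sum-eq)) refl)))
               (≤-trans (m≤m+n _ (s * (1 + s + (t + t)))) (≤-reflexive (Eq.trans (r₂ i s t) (cong (λ c → c * (suc c + t + t)) s-eq))))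
        where
        r₁ : ∀ i p → suc i * (suc (i + p) + 1 + 3 * p) ≡ suc i * (i + 2 + (p + p + (p + p)))
        r₁ = solve-∀
        r₂ : ∀ i s t → suc i * (i + 2 + (s + t + (s + t))) + s * (1 + s + (t + t)) ≡ (suc i + s) * (suc (suc i + s) + t + t)
        r₂ = solve-∀

-- Matchings of prescribed size: adding j universal vertices turns a graph on
-- 2κ + j vertices with a κ-matching into one with a perfect matching.

Match : (A → A → Bool) → List A → ℕ → Set
Match e W κ = ∃[ ms ] Edges e ms × (∃[ rest ] flat ms ++ rest ↭ W) × κ ≤ length ms

length-flat : ∀ (ms : List (A × A)) → length (flat ms) ≡ length ms + length ms
length-flat [] = refl
length-flat (_ ∷ ms) = cong suc (Eq.trans (cong suc (length-flat ms)) (sym (+-suc _ _)))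

module _ {j : ℕ} where

  dummy : A ⊎ Fin j → ℕ
  dummy (inj₁ _) = 0
  dummy (inj₂ _) = 1

  reals : List (A ⊎ Fin j) → List A
  reals [] = []
  reals (inj₁ x ∷ xs) = x ∷ reals xs
  reals (inj₂ _ ∷ xs) = reals xs

  reals-↭ : {xs ys : List (A ⊎ Fin j)} → xs ↭ ys → reals xs ↭ reals ys
  reals-↭ refl = refl
  reals-↭ (prep (inj₁ x) p) = prep x (reals-↭ p)
  reals-↭ (prep (inj₂ _) p) = reals-↭ p
  reals-↭ (swap (inj₁ x) (inj₁ y) p) = swap x y (reals-↭ p)
  reals-↭ (swap (inj₁ x) (inj₂ _) p) = prep x (reals-↭ p)
  reals-↭ (swap (inj₂ _) (inj₁ y) p) = prep y (reals-↭ p)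
  reals-↭ (swap (inj₂ _) (inj₂ _) p) = reals-↭ p
  reals-↭ (trans p q) = trans (reals-↭ p) (reals-↭ q)

  reals-length : ∀ (xs : List (A ⊎ Fin j)) → length (reals xs) + ∑ xs dummy ≡ length xs
  reals-length [] = refl
  reals-length (inj₁ _ ∷ xs) = cong suc (reals-length xs)
  reals-length (inj₂ _ ∷ xs) = Eq.trans (+-suc _ _) (cong suc (reals-length xs))

  ∈-reals⁻ : ∀ (xs : List (A ⊎ Fin j)) {x} → x ∈ reals xs → inj₁ x ∈ xs
  ∈-reals⁻ (inj₁ _ ∷ xs) (here refl) = here refl
  ∈-reals⁻ (inj₁ _ ∷ xs) (there x∈) = there (∈-reals⁻ xs x∈)
  ∈-reals⁻ (inj₂ _ ∷ xs) x∈ = there (∈-reals⁻ xs x∈)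

  reals-unique : {xs : List (A ⊎ Fin j)} → Unique xs → Unique (reals xs)
  reals-unique {xs = []} _ = []
  reals-unique {xs = inj₁ x ∷ xs} u@(_ ∷ u′) = All.tabulate (λ { y∈ refl → ∉-head u (∈-reals⁻ xs y∈) }) ∷ reals-unique u′
  reals-unique {xs = inj₂ _ ∷ xs} (_ ∷ u′) = reals-unique u′

  reals-map : ∀ (W : List A) (D : List (Fin j)) → reals (map inj₁ W ++ map inj₂ D) ≡ W
  reals-map (x ∷ W) D = cong (x ∷_) (reals-map W D)
  reals-map [] [] = refl
  reals-map [] (_ ∷ D) = reals-map [] D

  extE : (A → A → Bool) → A ⊎ Fin j → A ⊎ Fin j → Bool
  extE e (inj₁ x) (inj₁ y) = e x y
  extE e (inj₁ _) (inj₂ _) = true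
  extE e (inj₂ _) (inj₁ _) = true
  extE e (inj₂ a) (inj₂ b) = not (does (a FP.≟ b))

  ext : Graph A → Graph (A ⊎ Fin j)
  ext G = record { E = extE (E G) ; E-sym = s ; E-irr = r }
    where
    s : ∀ x y → extE (E G) x y ≡ extE (E G) y x
    s (inj₁ x) (inj₁ y) = E-sym G x y
    s (inj₁ _) (inj₂ _) = refl
    s (inj₂ _) (inj₁ _) = refl
    s (inj₂ a) (inj₂ b) with a FP.≟ b
    ... | yes refl = sym (cong not (dec-true (b FP.≟ b) refl))
    ... | no a≢b = sym (cong not (dec-false (b FP.≟ a) (a≢b ∘ sym)))
    r : ∀ x → extE (E G) x x ≡ false
    r (inj₁ x) = E-irr G x
    r (inj₂ a) = cong not (dec-true (a FP.≟ a) refl)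

  ext-universal : ∀ (G : Graph A) a y → y ≢ inj₂ a → E (ext G) (inj₂ a) y ≡ true
  ext-universal G a (inj₁ _) _ = refl
  ext-universal G a (inj₂ b) h = cong not (dec-false (a FP.≟ b) λ { refl → h refl })

  extW : List A → List (A ⊎ Fin j)
  extW W = map inj₁ W ++ map inj₂ (allFin j)

  extW-length : ∀ (W : List A) → length (extW W) ≡ length W + j
  extW-length W = Eq.trans (length-++ (map inj₁ W)) (cong₂ _+_ (length-map inj₁ W) (Eq.trans (length-map inj₂ (allFin j)) (length-tabulate id)))

  extW-unique : {W : List A} → Unique W → Unique (extW W)
  extW-unique {W = W} u = UP.++⁺ (UP.map⁺ (λ { refl → refl }) u) (UP.map⁺ (λ { refl → refl }) (UP.allFin⁺ j)) disj
    where
    disj : ∀ {x} → ¬ (x ∈ map inj₁ W × x ∈ map inj₂ (allFin j))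
    disj (p , q) with ∈-map⁻ inj₁ p | ∈-map⁻ inj₂ q
    ... | _ , _ , refl | _ , _ , ()

  ∈-extW⁻ : ∀ {W : List A} {x} → inj₁ x ∈ extW W → x ∈ W
  ∈-extW⁻ {W = W} h with ∈-++⁻ (map inj₁ W) h
  ... | inj₁ p with ∈-map⁻ inj₁ p
  ...   | _ , y∈ , refl = y∈
  ∈-extW⁻ {W = W} h | inj₂ q with ∈-map⁻ inj₂ q
  ...   | _ , _ , ()

  ∈-extW⁺ : ∀ {W : List A} {x} → x ∈ W → inj₁ x ∈ extW W
  ∈-extW⁺ h = ∈-++⁺ˡ (∈-map⁺ inj₁ h)

  ∑-extW : ∀ (W : List A) f → ∑ (extW W) f ≡ ∑ W (f ∘ inj₁) + ∑ (allFin j) (f ∘ inj₂)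
  ∑-extW W f = Eq.trans (∑-++ (map inj₁ W) _ f) (cong₂ _+_ (∑-map inj₁ W f) (∑-map inj₂ (allFin j) f))

  ∑-ones : ∀ (xs : List (Fin j)) → ∑ xs (λ _ → 1) ≡ length xs
  ∑-ones xs = Eq.trans (∑-const xs 1) (*-identityʳ _)

  dummies-extW : ∀ (W : List A) → ∑ (extW W) dummy ≡ j
  dummies-extW W = Eq.trans (∑-extW W dummy) (cong₂ _+_ (∑-zero W λ _ → refl) (Eq.trans (∑-ones (allFin j)) (length-tabulate id)))

  ext-deg : ∀ (G : Graph A) W x → deg (ext G) (extW W) (inj₁ x) ≡ deg G W x + j
  ext-deg G W x = Eq.trans (∑-extW W _) (cong (deg G W x +_) (Eq.trans (∑-ones (allFin j)) (length-tabulate id)))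

  ext-Mis : ∀ (G : Graph A) W → Mis (ext G) (extW W) ≤ Mis G W + j
  ext-Mis G W = ≤-trans (≤-reflexive (∑-extW W _)) (+-mono-≤ (≤-reflexive (∑-cong W λ {x} _ → real x))
      (≤-trans (∑-mono (allFin j) λ {a} _ → dum a) (≤-reflexive (Eq.trans (∑-ones (allFin j)) (length-tabulate id)))))
    where
    real : ∀ x → mis (ext G) (extW W) (inj₁ x) ≡ mis G W x
    real x = Eq.trans (∑-extW W _) (Eq.trans (cong (mis G W x +_) (∑-zero (allFin j) λ _ → refl)) (+-identityʳ _))
    dum : ∀ a → mis (ext G) (extW W) (inj₂ a) ≤ 1
    dum a = ≤-trans (≤-reflexive (Eq.trans (∑-extW W _) (cong (_+ ∑ (allFin j) _) (∑-zero W λ _ → refl))))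
      (∑-ind-unique (allFin j) (λ b → not (not (does (a FP.≟ b)))) (UP.allFin⁺ j) λ _ _ p q → Eq.trans (sym (is p)) (is q))
      where
      is : ∀ {b} → not (not (does (a FP.≟ b))) ≡ true → a ≡ b
      is {b} h with a FP.≟ b
      ... | yes p = p

  -- `rest` collects the real vertices matched to dummies, so it is no longer than the list of
  -- dummies.
  splitMatching : ∀ (e : A → A → Bool) ms → Edges (extE e) ms →
    ∃[ ms′ ] ∃[ rest ] Edges e ms′ × flat ms′ ++ rest ↭ reals (flat ms) × length rest ≤ ∑ (flat ms) dummy
  splitMatching e [] [] = [] , [] , [] , refl , z≤n
  splitMatching e (p ∷ ms) (h ∷ hs) with splitMatching e ms hs
  splitMatching e ((inj₁ x , inj₁ y) ∷ ms) (h ∷ hs) | ms′ , rest , es , q , le = (x , y) ∷ ms′ , rest , h ∷ es , prep x (prep y q) , le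
  splitMatching e ((inj₁ x , inj₂ _) ∷ ms) (h ∷ hs) | ms′ , rest , es , q , le = ms′ , x ∷ rest , es , ↭-trans (shift x (flat ms′) rest) (prep x q) , s≤s le
  splitMatching e ((inj₂ _ , inj₁ x) ∷ ms) (h ∷ hs) | ms′ , rest , es , q , le = ms′ , x ∷ rest , es , ↭-trans (shift x (flat ms′) rest) (prep x q) , s≤s le
  splitMatching e ((inj₂ _ , inj₂ _) ∷ ms) (h ∷ hs) | ms′ , rest , es , q , le = ms′ , rest , es , q , ≤-trans le (≤-trans (n≤1+n _) (n≤1+n _))

  -- Deleting the j dummies unmatches at most j real vertices, so at least 2κ of them stay matched
  -- among themselves.
  extractMatch : ∀ (e : A → A → Bool) {W κ V} → V ↭ extW W → length W ≡ κ + κ + j → PM (extE e) V → Match e W κ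
  extractMatch e {W} {κ} perm len (ms , es , p) with splitMatching e ms es
  ... | ms′ , rest , es′ , q , le = ms′ , es′ , (rest , q′) , twice-≤ (+-cancelʳ-≤ j _ _ fin)
    where
    q′ : flat ms′ ++ rest ↭ W
    q′ = ↭-trans q (↭-trans (reals-↭ (↭-trans p perm)) (↭-reflexive (reals-map W (allFin j))))
    le′ : length rest ≤ j
    le′ = ≤-trans le (≤-reflexive (Eq.trans (∑-↭ dummy (↭-trans p perm)) (dummies-extW W)))
    fin : κ + κ + j ≤ length ms′ + length ms′ + j
    fin = ≤-trans (≤-reflexive (Eq.trans (sym len) (Eq.trans (sym (↭-length q′)) (Eq.trans (length-++ (flat ms′)) (cong (_+ length rest) (length-flat ms′))))))
            (+-monoʳ-≤ (length ms′ + length ms′) le′)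

_≟⊎_ : ∀ {n j} → DecidableEquality (Fin n ⊎ Fin j)
_≟⊎_ = ≡-dec FP._≟_ FP._≟_

-- The data of a barrier in the graph with j universal vertices added, translated back: i is the
-- smaller degree minus j, and `low` comes from the non-neighbours of v. The dummies are universal,
-- so all of `low` is real and its vertices lose j from their degree bound.
record Deficient {A : Set} (G : Graph A) (W : List A) (κ j : ℕ) : Set where
  field
    i p : ℕ
    eq : suc (i + p) ≡ κ
    low : List A
    low-unique : Unique low
    low-∈ : ∀ {x} → x ∈ low → x ∈ W
    low-deg : ∀ {x} → x ∈ low → deg G W x ≤ i
    low-length : suc (j + i) ≤ length low
    many : κ + κ + j + suc (j + i) * (κ + j + 1 + 3 * p) ≤ Mis G W

module _ {n : ℕ} (G : Graph (Fin n)) {W : List (Fin n)} (un : Unique W) {κ j : ℕ} (len : length W ≡ κ + κ + j) where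

  private
    W′ : List (Fin n ⊎ Fin j)
    W′ = extW W

  extLen : length (extW {j = j} W) ≡ (κ + j) + (κ + j)
  extLen = Eq.trans (extW-length W) (Eq.trans (cong (_+ j) len) (r κ j))
    where
    r : ∀ κ j → κ + κ + j + j ≡ (κ + j) + (κ + j)
    r = solve-∀

  module Def (bar : Barrier _≟⊎_ (ext {j = j} G) (extW {j = j} W)) where
    open BarrierProperties _≟⊎_ (ext {j = j} G) (extW-unique {j = j} un) bar public renaming (low to low′; low-unique to low′-unique; low-length to low′-length; low-deg to low′-deg)

    universal : ∀ a y → y ≢ inj₂ a → E H (inj₂ a) y ≡ true
    universal a y h = G⊑H _ _ (ext-universal G a y h)

    deg≥j : ∀ x → deg G W x + j ≤ deg H W′ (inj₁ x)
    deg≥j x = ≤-trans (≤-reflexive (sym (ext-deg G W x))) (deg-mono {G = ext G} {H} G⊑H W′ (inj₁ x))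

    nonuniversal : ∀ {x y} → x ≢ y → E H x y ≡ false → ∃[ z ] x ≡ inj₁ z
    nonuniversal {inj₁ z} _ _ = z , refl
    nonuniversal {inj₂ a} {y} x≢y n = ⊥-elim (true≢false (universal a y (x≢y ∘ sym)) n)

    real-deg : ∀ y → (∃[ z ] y ≡ inj₁ z) → ∃[ i ] j + i ≡ deg H W′ y
    real-deg _ (z , refl) = deg H W′ (inj₁ z) ∸ j , m+[n∸m]≡n (≤-trans (m≤n+m j (deg G W z)) (deg≥j z))

    i₀ : ∃[ i ] j + i ≡ deg H W′ u
    i₀ = real-deg u (nonuniversal u≢v nuv)

    inA⁻ : ∀ y → inA y ≡ true → y ≢ v × E H y v ≡ false
    inA⁻ y h with y ≟⊎ v
    inA⁻ y h | yes _ = ⊥-elim (true≢false h (BP.∧-zeroʳ _))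
    inA⁻ y h | no y≢v with E H v y in eq
    ... | false = y≢v , Eq.trans (E-sym H y v) eq

    low-real : ∀ {y} → y ∈ low′ → dummy y ≡ 0
    low-real {y} y∈ = real′ (nonuniversal (proj₁ (inA⁻ y h)) (proj₂ (inA⁻ y h)))
      where
      h : inA y ≡ true
      h = proj₂ (∈-filter⁻ (λ x → inA x BP.≟ true) {xs = W′} y∈)
      real′ : ∀ {y : Fin n ⊎ Fin j} → (∃[ z ] y ≡ inj₁ z) → dummy y ≡ 0
      real′ (_ , refl) = refl

    deficient : Deficient G W κ j
    deficient = record
      { i = proj₁ i₀ ; p = proj₁ hp ; eq = eq₀
      ; low = reals low′ ; low-unique = reals-unique low′-unique
      ; low-∈ = λ x∈ → ∈-extW⁻ (proj₁ (low′-deg (∈-reals⁻ low′ x∈)))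
      ; low-deg = λ {x} x∈ → +-cancelʳ-≤ j _ _ (≤-trans (deg≥j x) (≤-trans (proj₂ (low′-deg (∈-reals⁻ low′ x∈))) (≤-reflexive (Eq.trans (sym (proj₂ i₀)) (+-comm j _)))))
      ; low-length = ≤-trans (≤-reflexive (cong suc (proj₂ i₀))) (≤-trans low′-length (≤-reflexive (Eq.trans (sym (reals-length low′)) (Eq.trans (cong (length (reals low′) +_) (∑-zero low′ low-real)) (+-identityʳ _)))))
      ; many = many′ }
      where
      hp = half {κ + j} extLen
      eq₀ : suc (proj₁ i₀ + proj₁ hp) ≡ κ
      eq₀ = +-cancelʳ-≡ j _ _ (Eq.trans (r _ _ j) (Eq.trans (cong (λ d → suc (d + proj₁ hp)) (proj₂ i₀)) (proj₂ hp)))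
        where
        r : ∀ i p j → suc (i + p) + j ≡ suc (j + i + p)
        r = solve-∀
      many′ : κ + κ + j + suc (j + proj₁ i₀) * (κ + j + 1 + 3 * proj₁ hp) ≤ Mis G W
      many′ = +-cancelʳ-≤ j _ _ (≤-trans (≤-reflexive (Eq.trans (r κ j _) (cong (λ d → κ + j + (κ + j) + suc d * (κ + j + 1 + 3 * proj₁ hp)) (proj₂ i₀))))
          (≤-trans (numeric {κ + j} {proj₁ hp} extLen (proj₂ hp)) (≤-trans (∑-mono W′ λ {x} _ → mis-anti {G = ext G} {H} G⊑H W′ x) (ext-Mis G W))))
        where
        r : ∀ κ j z → κ + κ + j + z + j ≡ κ + j + (κ + j) + z
        r = solve-∀

  match⊎deficient : Match (E G) W κ ⊎ Deficient G W κ j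
  match⊎deficient with PM⊎Barrier _≟⊎_ (ext {j = j} G) (κ + j) (extW-unique {j = j} un) extLen
  ... | inj₁ pm = inj₁ (extractMatch (E G) {W} {κ} refl len pm)
  ... | inj₂ bar = inj₂ (Def.deficient bar)

absurd≤ : ∀ {a b} w → a ≤ b → a ≡ suc (b + w) → ⊥
absurd≤ {b = b} w le refl = <⇒≱ (s≤s (m≤m+n b w)) le

sparse-contra : ∀ m i p → suc (i + p) ≡ m → m + m + suc i * (m + 1 + 3 * p) + 4 ≤ 6 * m → ⊥
sparse-contra m zero p eq h = absurd≤ 1 h (Eq.trans (cong (λ m → m + m + 1 * (m + 1 + 3 * p) + 4) (sym eq)) (Eq.trans (r p) (cong (λ m → suc (6 * m + 1)) eq)))
    where
    r : ∀ p → suc p + suc p + 1 * (suc p + 1 + 3 * p) + 4 ≡ suc (6 * suc p + 1)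
    r = solve-∀
sparse-contra m (suc i) p eq h = absurd≤ w h (Eq.trans (cong (λ m → m + m + suc (suc i) * (m + 1 + 3 * p) + 4) (sym eq)) (Eq.trans (r i p) (cong (λ m → suc (6 * m + w)) eq)))
    where
    w = i * i + i + 4 * p + 4 * i * p + 1
    r : ∀ i p → suc (suc i + p) + suc (suc i + p) + suc (suc i) * (suc (suc i + p) + 1 + 3 * p) + 4 ≡ suc (6 * suc (suc i + p) + (i * i + i + 4 * p + 4 * i * p + 1))
    r = solve-∀

-- `Mis` is 2m plus twice the number of missing edges, so at most 2m - 2 edges are missing. This is
-- sharp: 2m - 1 missing edges can isolate a vertex.
denseMatching : (_≟_ : DecidableEquality A) (G : Graph A) (m : ℕ) {W : List A} → Unique W → length W ≡ m + m →
  Mis G W + 4 ≤ 6 * m → PM (E G) W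
denseMatching _≟_ G m {W} un len le with PM⊎Barrier _≟_ G m un len
... | inj₁ pm = pm
... | inj₂ bar = ⊥-elim (sparse-contra m (deg H W u) (proj₁ hp) (proj₂ hp) (≤-trans (+-monoˡ-≤ 4 (≤-trans (numeric {m} {proj₁ hp} len (proj₂ hp)) (∑-mono W λ {x} _ → mis-anti {G = G} {H} G⊑H W x))) le))
  where
  open BarrierProperties _≟_ G un bar
  hp = half {m} len

-- Counting edges

Deg : Graph A → List A → ℕ
Deg G W = ∑ W (deg G W)

Deg+Mis : ∀ (G : Graph A) W → Deg G W + Mis G W ≡ length W * length W
Deg+Mis G W = Eq.trans (sym (∑-+ W _ _)) (Eq.trans (∑-cong W λ {x} _ → deg+mis G W x) (∑-const W _))

Deg-↭ : ∀ (G : Graph A) {W W′} → W ↭ W′ → Deg G W ≡ Deg G W′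
Deg-↭ G {W} p = Eq.trans (∑-cong W λ _ → ∑-↭ _ p) (∑-↭ _ p)

Deg-cons : ∀ (G : Graph A) x W → Deg G (x ∷ W) ≡ deg G W x + deg G W x + Deg G W
Deg-cons G x W rewrite E-irr G x = Eq.trans (cong (deg G W x +_) (Eq.trans (∑-+ W _ _) (cong (_+ Deg G W) (∑-cong W λ {y} _ → cong ind (E-sym G y x)))))
  (sym (+-assoc (deg G W x) _ _))

Mis-cons : ∀ (G : Graph A) x W → Mis G (x ∷ W) ≡ 1 + mis G W x + mis G W x + Mis G W
Mis-cons G x W rewrite E-irr G x = cong suc (Eq.trans (cong (mis G W x +_) (Eq.trans (∑-+ W _ _) (cong (_+ Mis G W) (∑-cong W λ {y} _ → cong (ind ∘ not) (E-sym G y x)))))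
  (sym (+-assoc (mis G W x) _ _)))

Mis-tail : ∀ (G : Graph A) x W → suc (Mis G W) ≤ Mis G (x ∷ W)
Mis-tail G x W rewrite Mis-cons G x W = s≤s (m≤n+m _ _)

length≤Mis : ∀ (G : Graph A) W → length W ≤ Mis G W
length≤Mis G [] = z≤n
length≤Mis G (x ∷ W) = ≤-trans (s≤s (length≤Mis G W)) (Mis-tail G x W)

∑-cartesian : ∀ (xs : List A) (ys : List B) f → ∑ (cartesianProduct xs ys) f ≡ ∑ xs (λ x → ∑ ys (λ y → f (x , y)))
∑-cartesian [] ys f = refl
∑-cartesian (x ∷ xs) ys f = Eq.trans (∑-++ (map (x ,_) ys) _ f) (cong₂ _+_ (∑-map (x ,_) ys f) (∑-cartesian xs ys f))

Deg-cartesian : ∀ (xs : List A) (e : A → A → Bool) →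
  length (filter (λ p → e (proj₁ p) (proj₂ p) BP.≟ true) (cartesianProduct xs xs)) ≡ ∑ xs (λ x → ∑ xs (λ y → ind (e x y)))
Deg-cartesian xs e = Eq.trans (filter-∑ (cartesianProduct xs xs) (λ p → e (proj₁ p) (proj₂ p))) (∑-cartesian xs xs _)

extend-⊆ : {xs W : List A} → Unique xs → (∀ {x} → x ∈ xs → x ∈ W) → ∃[ rest ] W ↭ xs ++ rest
extend-⊆ {xs = []} {W} _ _ = W , refl
extend-⊆ {xs = x ∷ xs} u@(_ ∷ u′) sub with pick (sub (here refl))
... | W′ , p with extend-⊆ u′ (λ {y} y∈ → ∈-tail (∈-resp-↭ p (sub (there y∈))) λ { refl → ∉-head u y∈ })
...   | rest , q = rest , ↭-trans p (prep x q)

Unique-++ˡ : ∀ (xs : List A) {ys} → Unique (xs ++ ys) → Unique xs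
Unique-++ˡ [] _ = []
Unique-++ˡ (x ∷ xs) u@(_ ∷ u′) = All.tabulate (λ { y∈ refl → ∉-head u (∈-++⁺ˡ y∈) }) ∷ Unique-++ˡ xs u′

Unique-++ʳ : ∀ (xs : List A) {ys} → Unique (xs ++ ys) → Unique ys
Unique-++ʳ [] u = u
Unique-++ʳ (x ∷ xs) (_ ∷ u) = Unique-++ʳ xs u

∉-++ : ∀ (xs : List A) {ys x} → Unique (xs ++ ys) → x ∈ xs → x ∉ ys
∉-++ (_ ∷ xs) u (here refl) x∈ = ∉-head u (∈-++⁺ʳ xs x∈)
∉-++ (_ ∷ xs) (_ ∷ u) (there p) x∈ = ∉-++ xs u p x∈

Deg-isolated : ∀ (G : Graph A) (Z K : List A) → (∀ {z} → z ∈ Z → deg G (Z ++ K) z ≡ 0) → Deg G (Z ++ K) ≡ Deg G K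
Deg-isolated G [] K h = refl
Deg-isolated G (z ∷ Z) K h = Eq.trans (Deg-cons G z (Z ++ K)) (Eq.trans (cong (λ d → d + d + Deg G (Z ++ K)) (drop-head (h (here refl))))
    (Deg-isolated G Z K λ z∈ → drop-head (h (there z∈))))
  where
  drop-head : ∀ {y} → deg G (z ∷ Z ++ K) y ≡ 0 → deg G (Z ++ K) y ≡ 0
  drop-head {y} eq = m+n≡0⇒n≡0 (ind (E G y z)) eq

-- The binomial coefficient n over 2, by recursion to avoid division.
tri : ℕ → ℕ
tri zero = 0
tri (suc n) = n + tri n

tri-eq : ∀ n → tri n + tri n + n ≡ n * n
tri-eq zero = refl
tri-eq (suc n) = Eq.trans (r n (tri n)) (Eq.trans (cong (λ q → suc (n + n) + q) (tri-eq n)) (s n))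
  where
  r : ∀ n t → (n + t) + (n + t) + suc n ≡ suc (n + n) + (t + t + n)
  r = solve-∀
  s : ∀ n → suc (n + n) + n * n ≡ suc n * suc n
  s = solve-∀

pairs : List A → List (A × A)
pairs [] = []
pairs (x ∷ xs) = map (x ,_) xs ++ pairs xs

length-pairs : ∀ (xs : List A) → length (pairs xs) ≡ tri (length xs)
length-pairs [] = refl
length-pairs (x ∷ xs) = Eq.trans (length-++ (map (x ,_) xs)) (cong₂ _+_ (length-map (x ,_) xs) (length-pairs xs))

∈-pairs : ∀ (xs : List A) {x y} → x ∈ xs → y ∈ xs → x ≢ y → (x , y) ∈ pairs xs ⊎ (y , x) ∈ pairs xs
∈-pairs (_ ∷ xs) (here refl) (here refl) x≢y = ⊥-elim (x≢y refl)
∈-pairs (_ ∷ xs) (here refl) (there y∈) _ = inj₁ (∈-++⁺ˡ (∈-map⁺ _ y∈))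
∈-pairs (_ ∷ xs) (there x∈) (here refl) _ = inj₂ (∈-++⁺ˡ (∈-map⁺ _ x∈))
∈-pairs (z ∷ xs) (there x∈) (there y∈) x≢y with ∈-pairs xs x∈ y∈ x≢y
... | inj₁ p = inj₁ (∈-++⁺ʳ (map (z ,_) xs) p)
... | inj₂ p = inj₂ (∈-++⁺ʳ (map (z ,_) xs) p)

transversal : (f : A → ℕ) (xs : List A) → ∃[ ys ] (∀ {y} → y ∈ ys → y ∈ xs) × Unique (map f ys) × (∀ {x} → x ∈ xs → f x ∈ map f ys)
transversal f [] = [] , id , [] , λ ()
transversal f (x ∷ xs) with transversal f xs
... | ys , sub , u , cov with any? (f x ≟_) (map f ys)
...   | yes p = ys , there ∘ sub , u , λ { (here refl) → p ; (there x∈) → cov x∈ }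
...   | no q = x ∷ ys , (λ { (here refl) → here refl ; (there y∈) → there (sub y∈) }) , All.tabulate (λ { y∈ refl → q y∈ }) ∷ u ,
               λ { (here refl) → here refl ; (there x∈) → there (cov x∈) }

Unique-map⁻ : (f : A → ℕ) {xs : List A} → Unique (map f xs) → ∀ {x y} → x ∈ xs → y ∈ xs → f x ≡ f y → x ≡ y
Unique-map⁻ f u (here refl) (here refl) _ = refl
Unique-map⁻ f {_ ∷ xs} u (here refl) (there y∈) eq = ⊥-elim (∉-head u (subst (_∈ map f xs) (sym eq) (∈-map⁺ f y∈)))
Unique-map⁻ f {_ ∷ xs} u (there x∈) (here refl) eq = ⊥-elim (∉-head u (subst (_∈ map f xs) eq (∈-map⁺ f x∈)))
Unique-map⁻ f (_ ∷ u) (there x∈) (there y∈) eq = Unique-map⁻ f u x∈ y∈ eq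

∈-edgesK⁻ : ∀ {n} {x y : Fin n} → (x , y) ∈ edgesK n → x F.< y
∈-edgesK⁻ {n} p = proj₂ (∈-filter⁻ (λ p → proj₁ p FP.<? proj₂ p) {xs = cartesianProduct (allFin n) (allFin n)} p)

∈-edgesK⁺ : ∀ {n} {x y : Fin n} → x F.< y → (x , y) ∈ edgesK n
∈-edgesK⁺ {n} {x} {y} lt = ∈-filter⁺ (λ p → proj₁ p FP.<? proj₂ p) (∈-cartesianProduct⁺ (∈-allFin x) (∈-allFin y)) lt

handshake : ∀ {n} (e : Fin n → Fin n → Bool) → (∀ x y → e x y ≡ e y x) → (L : List (Fin n × Fin n)) → Unique L →
  (∀ {x y} → (x , y) ∈ L → x F.< y × e x y ≡ true) →
  length L + length L ≤ ∑ (allFin n) (λ x → ∑ (allFin n) (λ y → ind (e x y)))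
handshake {n} e e-sym L u h = ≤-trans (≤-reflexive (sym (Eq.trans (length-++ L) (cong (length L +_) (length-map flip L)))))
    (≤-trans (Unique-⊆-length uu sub) (≤-reflexive (Deg-cartesian (allFin n) e)))
  where
  flip : Fin n × Fin n → Fin n × Fin n
  flip (x , y) = y , x
  uu : Unique (L ++ map flip L)
  uu = UP.++⁺ u (UP.map⁺ (λ { {_ , _} {_ , _} refl → refl }) u) disj
    where
    disj : ∀ {p} → ¬ (p ∈ L × p ∈ map flip L)
    disj (p , q) with ∈-map⁻ flip q
    ... | (x , y) , xy∈ , refl = FP.<-asym (proj₁ (h p)) (proj₁ (h xy∈))
  sub : ∀ {p} → p ∈ L ++ map flip L → p ∈ filter (λ p → e (proj₁ p) (proj₂ p) BP.≟ true) (cartesianProduct (allFin n) (allFin n))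
  sub {x , y} p with ∈-++⁻ L p
  ... | inj₁ q = ∈-filter⁺ _ (∈-cartesianProduct⁺ (∈-allFin x) (∈-allFin y)) (proj₂ (h q))
  ... | inj₂ q with ∈-map⁻ flip q
  ...   | (y , x) , q′ , refl = ∈-filter⁺ _ (∈-cartesianProduct⁺ (∈-allFin x) (∈-allFin y)) (Eq.trans (e-sym x y) (proj₂ (h q′)))

handshake⁻ : ∀ {n} (e : Fin n → Fin n → Bool) (L : List (Fin n × Fin n)) →
  (∀ {x y} → e x y ≡ true → (x , y) ∈ L ⊎ (y , x) ∈ L) →
  ∑ (allFin n) (λ x → ∑ (allFin n) (λ y → ind (e x y))) ≤ length L + length L
handshake⁻ {n} e L h = ≤-trans (≤-reflexive (sym (Deg-cartesian (allFin n) e)))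
    (≤-trans (Unique-⊆-length (UP.filter⁺ P? (UP.cartesianProduct⁺ (UP.allFin⁺ n) (UP.allFin⁺ n))) sub) (≤-reflexive (Eq.trans (length-++ L) (cong (length L +_) (length-map flip L)))))
  where
  flip : Fin n × Fin n → Fin n × Fin n
  flip (x , y) = y , x
  P? : (p : Fin n × Fin n) → Dec (e (proj₁ p) (proj₂ p) ≡ true)
  P? p = e (proj₁ p) (proj₂ p) BP.≟ true
  sub : ∀ {p} → p ∈ filter P? (cartesianProduct (allFin n) (allFin n)) → p ∈ L ++ map flip L
  sub {x , y} p with h (proj₂ (∈-filter⁻ P? {xs = cartesianProduct (allFin n) (allFin n)} p))
  ... | inj₁ q = ∈-++⁺ˡ q
  ... | inj₂ q = ∈-++⁺ʳ L (∈-map⁺ flip q)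

-- Matchings as lists

module _ {n : ℕ} where

  flat-lookup : ∀ (ms : List (Fin n × Fin n)) t → proj₁ (lookup ms t) ∈ flat ms × proj₂ (lookup ms t) ∈ flat ms
  flat-lookup (_ ∷ ms) zero = here refl , there (here refl)
  flat-lookup (_ ∷ ms) (suc t) = there (there (proj₁ (flat-lookup ms t))) , there (there (proj₂ (flat-lookup ms t)))

  flat-≢ : ∀ (ms : List (Fin n × Fin n)) → Unique (flat ms) → ∀ t → proj₁ (lookup ms t) ≢ proj₂ (lookup ms t)
  flat-≢ (_ ∷ ms) u zero refl = ∉-head u (here refl)
  flat-≢ (_ ∷ ms) (_ ∷ _ ∷ u) (suc t) = flat-≢ ms u t

  flat-disjoint : ∀ (ms : List (Fin n × Fin n)) → Unique (flat ms) → ∀ s t → s ≢ t → D.Disjoint (lookup ms s) (lookup ms t)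
  flat-disjoint (_ ∷ ms) u zero zero s≢t = ⊥-elim (s≢t refl)
  flat-disjoint (_ ∷ ms) u@(_ ∷ u′) zero (suc t) _ =
    (λ { refl → ∉-head u (there (proj₁ (flat-lookup ms t))) }) , (λ { refl → ∉-head u (there (proj₂ (flat-lookup ms t))) }) ,
    (λ { refl → ∉-head u′ (proj₁ (flat-lookup ms t)) }) , (λ { refl → ∉-head u′ (proj₂ (flat-lookup ms t)) })
  flat-disjoint (_ ∷ ms) u@(_ ∷ u′) (suc s) zero _ =
    (λ { refl → ∉-head u (there (proj₁ (flat-lookup ms s))) }) , (λ { refl → ∉-head u′ (proj₁ (flat-lookup ms s)) }) ,
    (λ { refl → ∉-head u (there (proj₂ (flat-lookup ms s))) }) , (λ { refl → ∉-head u′ (proj₂ (flat-lookup ms s)) })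
  flat-disjoint (_ ∷ ms) (_ ∷ _ ∷ u) (suc s) (suc t) s≢t = flat-disjoint ms u s t (s≢t ∘ cong suc)

  ordered : Fin n × Fin n → Fin n × Fin n
  ordered (x , y) with x FP.<? y
  ... | yes _ = x , y
  ... | no _ = y , x

  ordered-< : ∀ p → proj₁ p ≢ proj₂ p → proj₁ (ordered p) F.< proj₂ (ordered p)
  ordered-< (x , y) x≢y with x FP.<? y
  ... | yes lt = lt
  ... | no ≮ = FP.≤∧≢⇒< (≮⇒≥ ≮) (x≢y ∘ sym)

  ordered-disjoint : ∀ p q → D.Disjoint p q → D.Disjoint (ordered p) (ordered q)
  ordered-disjoint (x , y) (z , w) (xz , xw , yz , yw) with x FP.<? y | z FP.<? w
  ... | yes _ | yes _ = xz , xw , yz , yw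
  ... | yes _ | no _ = xw , xz , yw , yz
  ... | no _ | yes _ = yz , yw , xz , xw
  ... | no _ | no _ = yw , yz , xw , xz

  listMatching : ∀ {k} (ms : List (Fin n × Fin n)) → k ≤ length ms → Unique (flat ms) → MatchingIn n k
  listMatching ms le u = record
    { edge = λ t → ordered (lookup ms (F.inject≤ t le))
    ; edge-ok = λ t → ordered-< _ (flat-≢ ms u _)
    ; disjoint = λ s t s≢t → ordered-disjoint _ _ (flat-disjoint ms u _ _ (λ eq → s≢t (FP.inject≤-injective le le s t eq))) }

module _ {n : ℕ} (c : EdgeColoring n) where

  colp : Fin n × Fin n → ℕ
  colp p = col c (proj₁ p) (proj₂ p)

  numColors-≤ : ∀ ys → (∀ {x y} → x F.< y → col c x y ∈ ys) → numColors c ≤ length ys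
  numColors-≤ ys h = Unique-⊆-length (deduplicate-! _≟_ (map colp (edgesK n))) λ γ∈ → cov (∈-map⁻ colp (∈-deduplicate⁻ _≟_ (map colp (edgesK n)) γ∈))
    where
    cov : ∀ {γ} → ∃[ p ] p ∈ edgesK n × γ ≡ colp p → γ ∈ ys
    cov ((x , y) , p∈ , refl) = h (∈-edgesK⁻ p∈)

  numColors-≥ : ∀ ys → Unique ys → (∀ {γ} → γ ∈ ys → ∃[ x ] ∃[ y ] x F.< y × col c x y ≡ γ) → length ys ≤ numColors c
  numColors-≥ ys u h = Unique-⊆-length u λ γ∈ → cov (h γ∈)
    where
    cov : ∀ {γ} → ∃[ x ] ∃[ y ] x F.< y × col c x y ≡ γ → γ ∈ deduplicate _≟_ (map colp (edgesK n))
    cov (x , y , lt , refl) = ∈-deduplicate⁺ _≟_ (∈-map⁺ colp (∈-edgesK⁺ lt))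

  -- Degree sums count ordered pairs, hence the doubled number of colours. `enough` feeds the lower
  -- bounds on edges, `exact` the averaging of degrees.
  record Representing : Set where
    field
      G : Graph (Fin n)
      distinct : ∀ {x y x′ y′} → E G x y ≡ true → E G x′ y′ ≡ true → col c x y ≡ col c x′ y′ → (x ≡ x′ × y ≡ y′) ⊎ (x ≡ y′ × y ≡ x′)
      enough : numColors c + numColors c ≤ Deg G (allFin n)
      exact : Deg G (allFin n) ≤ numColors c + numColors c

  representing : Representing
  representing with transversal colp (edgesK n)
  ... | L , sub , u , cov = record
    { G = record { E = e ; E-sym = e-sym ; E-irr = e-irr }
    ; distinct = λ p q eq → dist (e⁻ p) (e⁻ q) eq
    ; enough = ≤-trans (+-mono-≤ T≤ T≤) (handshake e e-sym L (UP.map⁻ u) λ {x} {y} p → ∈-edgesK⁻ (sub p) , cong (_∨ does ((y , x) ∈? L)) (dec-true ((x , y) ∈? L) p))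
    ; exact = ≤-trans (handshake⁻ e L e⁻) (+-mono-≤ ≤T ≤T) }
    where
    _∈?_ : (p : Fin n × Fin n) (L : List (Fin n × Fin n)) → Dec (p ∈ L)
    p ∈? L = any? (≡-dec× FP._≟_ FP._≟_ p) L
    e : Fin n → Fin n → Bool
    e x y = does ((x , y) ∈? L) ∨ does ((y , x) ∈? L)
    e-sym : ∀ x y → e x y ≡ e y x
    e-sym x y = BP.∨-comm (does ((x , y) ∈? L)) _
    e-irr : ∀ x → e x x ≡ false
    e-irr x = cong₂ _∨_ no′ no′
      where
      no′ : does ((x , x) ∈? L) ≡ false
      no′ = dec-false (_ ∈? L) λ p → FP.<-irrefl refl (∈-edgesK⁻ (sub p))
    e⁻ : ∀ {x y} → e x y ≡ true → (x , y) ∈ L ⊎ (y , x) ∈ L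
    e⁻ {x} {y} h with (x , y) ∈? L | (y , x) ∈? L
    ... | yes p | _ = inj₁ p
    ... | no _ | yes q = inj₂ q
    inj : ∀ {p q} → p ∈ L → q ∈ L → colp p ≡ colp q → p ≡ q
    inj = Unique-map⁻ colp u
    dist : ∀ {x y x′ y′} → (x , y) ∈ L ⊎ (y , x) ∈ L → (x′ , y′) ∈ L ⊎ (y′ , x′) ∈ L → col c x y ≡ col c x′ y′ → (x ≡ x′ × y ≡ y′) ⊎ (x ≡ y′ × y ≡ x′)
    dist (inj₁ p) (inj₁ q) eq with inj p q eq
    ... | refl = inj₁ (refl , refl)
    dist {x} {y} {x′} {y′} (inj₁ p) (inj₂ q) eq with inj p q (Eq.trans eq (col-sym c x′ y′))
    ... | refl = inj₂ (refl , refl)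
    dist {x} {y} {x′} {y′} (inj₂ p) (inj₁ q) eq with inj p q (Eq.trans (col-sym c y x) eq)
    ... | refl = inj₂ (refl , refl)
    dist {x} {y} {x′} {y′} (inj₂ p) (inj₂ q) eq with inj p q (Eq.trans (col-sym c y x) (Eq.trans eq (col-sym c x′ y′)))
    ... | refl = inj₁ (refl , refl)
    T≤ : numColors c ≤ length L
    T≤ = ≤-trans (numColors-≤ (map colp L) λ lt → cov (∈-edgesK⁺ lt)) (≤-reflexive (length-map colp L))

    ≤T : length L ≤ numColors c
    ≤T = ≤-trans (≤-reflexive (sym (length-map colp L))) (numColors-≥ (map colp L) u λ γ∈ → occurs (∈-map⁻ colp γ∈))
      where
      occurs : ∀ {γ} → ∃[ p ] p ∈ L × γ ≡ colp p → ∃[ x ] ∃[ y ] x F.< y × col c x y ≡ γ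
      occurs ((x , y) , p , refl) = x , y , ∈-edgesK⁻ (sub p) , refl

  RainbowList : ℕ → List (Fin n × Fin n) → Set
  RainbowList k ms = k ≤ length ms × Unique (flat ms) × Unique (map colp ms)

  colp-≢ : ∀ (ms : List (Fin n × Fin n)) → Unique (map colp ms) → ∀ s t → s ≢ t → colp (lookup ms s) ≢ colp (lookup ms t)
  colp-≢ (_ ∷ ms) u zero zero s≢t = ⊥-elim (s≢t refl)
  colp-≢ (_ ∷ ms) u zero (suc t) _ eq = ∉-head u (subst (_∈ map colp ms) (sym eq) (∈-map⁺ colp (∈-lookup {xs = ms} t)))
  colp-≢ (_ ∷ ms) u (suc s) zero _ eq = ∉-head u (subst (_∈ map colp ms) eq (∈-map⁺ colp (∈-lookup {xs = ms} s)))
  colp-≢ (_ ∷ ms) (_ ∷ u) (suc s) (suc t) s≢t = colp-≢ ms u s t (s≢t ∘ cong suc)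

  ordered-colp : ∀ p → colp (ordered p) ≡ colp p
  ordered-colp (x , y) with x FP.<? y
  ... | yes _ = refl
  ... | no _ = col-sym c y x

  fromList : ∀ {k} ms → RainbowList k ms → HasRainbowMatching c k
  fromList ms (le , u , v) = listMatching ms le u ,
    λ s t s≢t eq → colp-≢ ms v _ _ (λ eq → s≢t (FP.inject≤-injective le le s t eq)) (Eq.trans (sym (ordered-colp _)) (Eq.trans eq (ordered-colp _)))

  tuples : ℕ → List (List (Fin n × Fin n))
  tuples zero = [] ∷ []
  tuples (suc k) = cartesianProductWith _∷_ (cartesianProduct (allFin n) (allFin n)) (tuples k)

  ∈-tuples : ∀ ms → ms ∈ tuples (length ms)
  ∈-tuples [] = here refl
  ∈-tuples ((x , y) ∷ ms) = ∈-cartesianProductWith⁺ _∷_ (∈-cartesianProduct⁺ (∈-allFin x) (∈-allFin y)) (∈-tuples ms)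

  take-flat : ∀ k (ms : List (Fin n × Fin n)) → ∃[ rest ] flat ms ≡ flat (take k ms) ++ rest
  take-flat zero ms = flat ms , refl
  take-flat (suc k) [] = [] , refl
  take-flat (suc k) ((x , y) ∷ ms) with take-flat k ms
  ... | rest , eq = rest , cong (λ l → x ∷ y ∷ l) eq

  -- A rainbow list of length at least k can be cut to length exactly k, which leaves the finite
  -- search space `tuples k`.
  rainbowList? : ∀ k → (∃[ ms ] RainbowList k ms) ⊎ (∀ ms → ¬ RainbowList k ms)
  rainbowList? k with any? (λ ms → (k ≤? length ms) ×-dec (unique? FP._≟_ (flat ms) ×-dec unique? _≟_ (map colp ms))) (tuples k)
  ... | yes p with find p
  ...   | ms , _ , r = inj₁ (ms , r)
  rainbowList? k | no q = inj₂ λ ms (le , u , v) → q (lose (mem ms le) (good ms le u v))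
    where
    len : ∀ ms → k ≤ length ms → length (take k ms) ≡ k
    len ms le = Eq.trans (length-take k ms) (m≤n⇒m⊓n≡m le)
    mem : ∀ ms → k ≤ length ms → take k ms ∈ tuples k
    mem ms le = subst (λ l → take k ms ∈ tuples l) (len ms le) (∈-tuples (take k ms))
    good : ∀ ms → k ≤ length ms → Unique (flat ms) → Unique (map colp ms) → RainbowList k (take k ms)
    good ms le u v = ≤-reflexive (sym (len ms le)) , Unique-++ˡ _ (subst Unique (proj₂ (take-flat k ms)) u) ,
      subst Unique (take-map k ms) (UP.take⁺ k v)

does-true : {P : Set} (d : Dec P) → does d ≡ true → P
does-true (yes p) _ = p

does-false : {P : Set} (d : Dec P) → does d ≡ false → ¬ P
does-false (no ¬p) _ = ¬p

∈-flat : ∀ {ms : List (A × A)} {x y} → (x , y) ∈ ms → x ∈ flat ms × y ∈ flat ms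
∈-flat (here refl) = here refl , there (here refl)
∈-flat (there p) = there (there (proj₁ (∈-flat p))) , there (there (proj₂ (∈-flat p)))

length-≥4 : ∀ (xs : List A) → 4 ≤ length xs → ∃[ a ] ∃[ b ] ∃[ c ] ∃[ d ] ∃[ ys ] xs ≡ a ∷ b ∷ c ∷ d ∷ ys
length-≥4 (a ∷ b ∷ c ∷ d ∷ ys) _ = a , b , c , d , ys , refl
length-≥4 (_ ∷ []) (s≤s ())
length-≥4 (_ ∷ _ ∷ []) (s≤s (s≤s ()))
length-≥4 (_ ∷ _ ∷ _ ∷ []) (s≤s (s≤s (s≤s ())))

-- What the absence of a rainbow matching forces (k = b + 2, n = 2k + j)

module NoRainbow {n : ℕ} (c : EdgeColoring n) (b j : ℕ) (n≡ : n ≡ 2 + b + (2 + b) + j)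
  (nr : ∀ ms → ¬ RainbowList c (2 + b) ms) (R : Representing c) where

  open Representing R

  V : List (Fin n)
  V = allFin n

  V-unique : Unique V
  V-unique = UP.allFin⁺ n

  V-length : length V ≡ n
  V-length = length-tabulate id

  T : ℕ
  T = numColors c

  minus : Graph (Fin n) → ℕ → Graph (Fin n)
  minus G′ γ = record
    { E = λ x y → E G′ x y ∧ not (does (col c x y ≟ γ))
    ; E-sym = λ x y → cong₂ (λ p q → p ∧ not (does (q ≟ γ))) (E-sym G′ x y) (col-sym c x y)
    ; E-irr = λ x → cong (_∧ not (does (col c x x ≟ γ))) (E-irr G′ x) }

  minus⁻ : ∀ G′ γ {x y} → E (minus G′ γ) x y ≡ true → E G′ x y ≡ true × col c x y ≢ γ
  minus⁻ G′ γ {x} {y} h with E G′ x y | does (col c x y ≟ γ) in eq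
  ... | true | false = refl , does-false (col c x y ≟ γ) eq

  minus-⊑ : ∀ G′ γ → minus G′ γ ⊑ G′
  minus-⊑ G′ γ x y h = proj₁ (minus⁻ G′ γ h)

  one-edge : ∀ γ W → Unique W → ∑ W (λ x → ∑ W (λ y → ind (E G x y ∧ does (col c x y ≟ γ)))) ≤ 2
  one-edge γ W u = ≤-trans (≤-reflexive (sym (Deg-cartesian W e))) (count Fl refl)
    where
    e : Fin n → Fin n → Bool
    e x y = E G x y ∧ does (col c x y ≟ γ)
    P? : ∀ (p : Fin n × Fin n) → Dec (e (proj₁ p) (proj₂ p) ≡ true)
    P? p = e (proj₁ p) (proj₂ p) BP.≟ true
    Fl = filter P? (cartesianProduct W W)
    e⁻ : ∀ {x y} → e x y ≡ true → E G x y ≡ true × col c x y ≡ γ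
    e⁻ {x} {y} h with E G x y | does (col c x y ≟ γ) in eq
    ... | true | true = refl , does-true (col c x y ≟ γ) eq
    mem : ∀ {x y} → (x , y) ∈ Fl → E G x y ≡ true × col c x y ≡ γ
    mem p = e⁻ (proj₂ (∈-filter⁻ P? {xs = cartesianProduct W W} p))
    count : ∀ L → L ≡ Fl → length L ≤ 2
    count [] _ = z≤n
    count ((x₀ , y₀) ∷ L) eq = Unique-⊆-length {ys = (x₀ , y₀) ∷ (y₀ , x₀) ∷ []} (subst Unique (sym eq) (UP.filter⁺ P? (UP.cartesianProduct⁺ u u))) sub
      where
      m₀ = mem (subst ((x₀ , y₀) ∈_) eq (here refl))
      sub : ∀ {p} → p ∈ (x₀ , y₀) ∷ L → p ∈ (x₀ , y₀) ∷ (y₀ , x₀) ∷ []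
      sub {x , y} p∈ with mem (subst ((x , y) ∈_) eq p∈)
      ... | h , cγ with distinct h (proj₁ m₀) (Eq.trans cγ (sym (proj₂ m₀)))
      ...   | inj₁ (refl , refl) = here refl
      ...   | inj₂ (refl , refl) = there (here refl)

  -- G has at most one edge of colour γ, which makes two ordered pairs.
  minus-Mis : ∀ G′ γ W → Unique W → G′ ⊑ G → Mis (minus G′ γ) W ≤ Mis G′ W + 2
  minus-Mis G′ γ W u sub = ≤-trans (∑-mono W λ {x} _ → ≤-trans (∑-mono W λ {y} _ → bit x y) (≤-reflexive (∑-+ W _ _)))
      (≤-trans (≤-reflexive (∑-+ W _ _)) (+-monoʳ-≤ (Mis G′ W) (one-edge γ W u)))
    where
    bit : ∀ x y → ind (not (E G′ x y ∧ not (does (col c x y ≟ γ)))) ≤ ind (not (E G′ x y)) + ind (E G x y ∧ does (col c x y ≟ γ))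
    bit x y with E G′ x y in eq | does (col c x y ≟ γ)
    ... | false | _ = s≤s z≤n
    ... | true | false = z≤n
    ... | true | true = ≤-reflexive (sym (cong (λ e → ind (e ∧ true)) (sub x y eq)))

  edges-distinct : ∀ ms → Edges (E G) ms → Unique (flat ms) → Unique (map (colp c) ms)
  edges-distinct [] _ _ = []
  edges-distinct ((x , y) ∷ ms) (h ∷ hs) u@(_ ∷ u′@(_ ∷ u″)) = All.tabulate diff ∷ edges-distinct ms hs u″
    where
    diff : ∀ {γ} → γ ∈ map (colp c) ms → col c x y ≢ γ
    diff γ∈ eq with ∈-map⁻ (colp c) γ∈
    ... | (x′ , y′) , p , refl with distinct h (All.lookup hs p) eq
    ...   | inj₁ (refl , _) = ∉-head u (there (proj₁ (∈-flat p)))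
    ...   | inj₂ (refl , _) = ∉-head u (there (proj₂ (∈-flat p)))

  edges-map : ∀ {e f : Fin n → Fin n → Bool} → (∀ x y → e x y ≡ true → f x y ≡ true) → ∀ {ms} → Edges e ms → Edges f ms
  edges-map h = All.map (h _ _)

  fresh : ∀ {γ ms} → Edges (E (minus G γ)) ms → All (γ ≢_) (map (colp c) ms)
  fresh [] = []
  fresh {γ} (h ∷ hs) = (λ eq → proj₂ (minus⁻ G γ h) (sym eq)) ∷ fresh hs

  -- The pair aa′ need not be an edge of G: after the edge of its colour is deleted, it completes
  -- any (k - 1)-matching of G avoiding both ends to a rainbow one.
  no-matching : ∀ {a a′} ms → Edges (E (minus G (col c a a′))) ms → Unique (a ∷ a′ ∷ flat ms) → 1 + b ≤ length ms → ⊥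
  no-matching {a} {a′} ms es u@(_ ∷ _ ∷ u″) le = nr ((a , a′) ∷ ms) (s≤s le , u ,
    fresh es ∷ edges-distinct ms (edges-map (minus-⊑ G _) es) u″)

  half-length : ∀ {m} (ms : List (Fin n × Fin n)) {W} → flat ms ↭ W → length W ≡ m + m → m ≤ length ms
  half-length ms p len = twice-≤ (≤-reflexive (Eq.trans (sym len) (Eq.trans (sym (↭-length p)) (length-flat ms))))

  -- dense says that at most 2k - 8 edges are missing inside K: Mis counts ordered pairs and the diagonal.

  module Clique {K Z : List (Fin n)} (perm : Z ++ K ↭ V) (lenK : length K ≡ suc (b + b)) (dense : Mis G K + 7 ≤ 6 * b) where

    ZK-unique : Unique (Z ++ K)
    ZK-unique = Unique-↭ (↭-sym perm) V-unique

    K-unique : Unique K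
    K-unique = Unique-++ʳ Z ZK-unique

    lenZ : length Z ≡ 3 + j
    lenZ = +-cancelʳ-≡ (suc (b + b)) _ _ (Eq.trans (cong (length Z +_) (sym lenK)) (Eq.trans (sym (length-++ Z)) (Eq.trans (↭-length perm) (Eq.trans V-length (Eq.trans n≡ (r b j))))))
      where
      r : ∀ b j → 2 + b + (2 + b) + j ≡ 3 + j + suc (b + b)
      r = solve-∀

    arrange : ∀ {xs ys K′ Z′} → Z ↭ xs ++ Z′ → K ↭ ys ++ K′ → Unique (xs ++ ys ++ K′)
    arrange {xs} {ys} {K′} {Z′} p q = Unique-++ˡ (xs ++ ys ++ K′) (Unique-↭ (↭-trans (++⁺ p q)
      (↭-trans (↭-reflexive (LP.++-assoc xs Z′ _)) (↭-trans (++⁺ˡ xs (++-comm Z′ (ys ++ K′))) (↭-reflexive (sym (LP.++-assoc xs (ys ++ K′) Z′)))))) ZK-unique)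

    -- If the colours differed, deleting both from G on K without w would still leave a perfect
    -- matching there, and aa′ and dw would make it a rainbow matching of size b + 2. The 7 in
    -- `dense` is the 4 of `denseMatching`, plus 4 for the two deleted edges, minus 1 for the vertex
    -- w.
    cross : ∀ {a a′ d Z′ w} → Z ↭ a ∷ a′ ∷ d ∷ Z′ → w ∈ K → col c a a′ ≡ col c d w
    cross {a} {a′} {d} {Z′} {w} zp w∈ with col c a a′ ≟ col c d w | pick w∈
    ... | yes eq | _ = eq
    ... | no γ≢ | K′ , kp = ⊥-elim (contra (denseMatching FP._≟_ G₂ b (Unique-tail (Unique-↭ kp K-unique)) lenK′ dense′))
      where
      Unique-tail : ∀ {x : Fin n} {xs} → Unique (x ∷ xs) → Unique xs
      Unique-tail (_ ∷ u) = u
      γ₁ = col c a a′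
      γ₂ = col c d w
      G₁ = minus G γ₁
      G₂ = minus G₁ γ₂
      lenK′ : length K′ ≡ b + b
      lenK′ = suc-injective (Eq.trans (sym (↭-length kp)) lenK)
      uK′ : Unique K′
      uK′ = Unique-tail (Unique-↭ kp K-unique)
      dense′ : Mis G₂ K′ + 4 ≤ 6 * b
      dense′ = ≤-trans (+-monoˡ-≤ 4 (≤-trans (minus-Mis G₁ γ₂ K′ uK′ (minus-⊑ G γ₁)) (+-monoˡ-≤ 2 (minus-Mis G γ₁ K′ uK′ λ _ _ h → h))))
        (≤-trans (≤-reflexive (r (Mis G K′))) (≤-trans (+-monoˡ-≤ 7 (≤-trans (Mis-tail G w K′) (≤-reflexive (sym (Mis-↭ G kp))))) dense))
        where
        r : ∀ x → x + 2 + 2 + 4 ≡ suc x + 7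
        r = solve-∀
      contra : PM (E G₂) K′ → ⊥
      contra (ms , es , p) = nr ((a , a′) ∷ (d , w) ∷ ms) (s≤s (s≤s (half-length ms p lenK′)) ,
          Unique-↭ (prep a (prep a′ (prep d (prep w (↭-sym p))))) (arrange {a ∷ a′ ∷ d ∷ []} {w ∷ []} zp kp) ,
          (γ≢ ∷ fresh es₁) ∷ fresh₂ es ∷ edges-distinct ms (edges-map (minus-⊑ G γ₁) es₁) (Unique-↭ (↭-sym p) uK′))
        where
        es₁ = edges-map (minus-⊑ G₁ γ₂) es
        fresh₂ : ∀ {ms} → Edges (E G₂) ms → All (γ₂ ≢_) (map (colp c) ms)
        fresh₂ [] = []
        fresh₂ (h ∷ hs) = (λ eq → proj₂ (minus⁻ G₁ γ₂ h) (sym eq)) ∷ fresh₂ hs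

    inK⊎inZ : ∀ x → x ∈ K ⊎ x ∈ Z
    inK⊎inZ x with ∈-++⁻ Z (∈-resp-↭ (↭-sym perm) (∈-allFin x))
    ... | inj₁ p = inj₂ p
    ... | inj₂ p = inj₁ p

    colK : List ℕ
    colK = map (colp c) (pairs K)

    inside : ∀ {x y} → x ∈ K → y ∈ K → x ≢ y → col c x y ∈ colK
    inside {x} {y} x∈ y∈ x≢y with ∈-pairs K x∈ y∈ x≢y
    ... | inj₁ p = ∈-map⁺ (colp c) p
    ... | inj₂ p = subst (_∈ colK) (col-sym c y x) (∈-map⁺ (colp c) p)

    K≢[] : ∃[ w ] w ∈ K
    K≢[] = nonempty′ K lenK

    many-colours : ∀ ys → (∀ {x y} → x F.< y → col c x y ∈ ys ++ colK) → T ≤ length ys + tri (suc (b + b))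
    many-colours ys h = ≤-trans (numColors-≤ c (ys ++ colK) h) (≤-reflexive (Eq.trans (length-++ ys) (cong (length ys +_) (Eq.trans (length-map (colp c) (pairs K)) (Eq.trans (length-pairs K) (cong tri lenK))))))

    classify : ∀ ys → (∀ {z w} → z ∈ Z → w ∈ K → col c z w ∈ ys) → (∀ {z z′} → z ∈ Z → z′ ∈ Z → z ≢ z′ → col c z z′ ∈ ys) → T ≤ length ys + tri (suc (b + b))
    classify ys hZK hZZ = many-colours ys f
      where
      f : ∀ {x y} → x F.< y → col c x y ∈ ys ++ colK
      f {x} {y} lt with inK⊎inZ x | inK⊎inZ y
      ... | inj₁ p | inj₁ q = ∈-++⁺ʳ ys (inside p q (FP.<⇒≢ lt))
      ... | inj₁ p | inj₂ q = ∈-++⁺ˡ (subst (_∈ ys) (col-sym c y x) (hZK q p))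
      ... | inj₂ p | inj₁ q = ∈-++⁺ˡ (hZK p q)
      ... | inj₂ p | inj₂ q = ∈-++⁺ˡ (hZZ p q (FP.<⇒≢ lt))

    -- With at least four vertices outside K, all edges not inside K have the same colour.
    clique-bound-odd : 1 ≤ j → T ≤ 1 + tri (suc (b + b))
    clique-bound-odd j≥1 = classify (γ ∷ []) (λ z∈ w∈ → here (ZK z∈ w∈)) (λ z∈ z′∈ z≢ → here (ZZ z∈ z′∈ z≢))
      where
      four : 4 ≤ length Z
      four = ≤-trans (+-monoʳ-≤ 3 j≥1) (≤-reflexive (sym lenZ))
      z₀ = proj₁ (length-≥4 Z four)
      z₀∈ : z₀ ∈ Z
      z₀∈ = subst (z₀ ∈_) (sym (proj₂ (proj₂ (proj₂ (proj₂ (proj₂ (length-≥4 Z four))))))) (here refl)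
      w₀ = proj₁ K≢[]
      γ = col c z₀ w₀
      third : ∀ {z z′} → z ∈ Z → z′ ∈ Z → z ≢ z′ → ∃[ a ] ∃[ a′ ] ∃[ Z′ ] Z ↭ z ∷ z′ ∷ a ∷ a′ ∷ Z′
      third z∈ z′∈ z≢ with pick₂ z∈ z′∈ z≢
      ... | (a ∷ a′ ∷ Z′) , p = a , a′ , Z′ , p
      ... | [] , p with () ← s≤s⁻¹ (s≤s⁻¹ (≤-trans four (≤-reflexive (↭-length p))))
      ... | (_ ∷ []) , p with s≤s () ← s≤s⁻¹ (s≤s⁻¹ (≤-trans four (≤-reflexive (↭-length p))))
      ZK≢ : ∀ {z z′ w w′} → z ∈ Z → z′ ∈ Z → z ≢ z′ → w ∈ K → w′ ∈ K → col c z w ≡ col c z′ w′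
      ZK≢ {z} {z′} z∈ z′∈ z≢ w∈ w′∈ with third z∈ z′∈ z≢
      ... | a , a′ , Z′ , p = Eq.trans (sym (cross (↭-trans p (↭-trans (prep z (↭-trans (swap z′ a refl) (prep a (swap z′ a′ refl)))) (↭-trans (swap z a refl) (prep a (swap z a′ refl))))) w∈))
              (cross (↭-trans p (↭-trans (↭-trans (prep z (↭-trans (swap z′ a refl) (prep a (swap z′ a′ refl)))) (↭-trans (swap z a refl) (prep a (swap z a′ refl)))) (prep a (prep a′ (swap z z′ refl))))) w′∈)
      ZK : ∀ {z w} → z ∈ Z → w ∈ K → col c z w ≡ γ
      ZK {z} {w} z∈ w∈ with z FP.≟ z₀
      ... | no z≢ = ZK≢ z∈ z₀∈ z≢ w∈ (proj₂ K≢[])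
      -- `ZK≢` compares two different vertices of Z only; two edges at z₀ are compared through a
      -- second vertex.
      ... | yes refl with length-≥4 Z four
      ...   | z₁ , z₂ , z₃ , z₄ , Z′ , refl = Eq.trans (ZK≢ (here refl) (there (here refl)) z₁≢z₂ w∈ (proj₂ K≢[])) (sym (ZK≢ (here refl) (there (here refl)) z₁≢z₂ (proj₂ K≢[]) (proj₂ K≢[])))
        where
        z₁≢z₂ : z₁ ≢ z₂
        z₁≢z₂ refl = ∉-head ZK-unique (here refl)
      ZZ : ∀ {z z′} → z ∈ Z → z′ ∈ Z → z ≢ z′ → col c z z′ ≡ γ
      ZZ z∈ z′∈ z≢ with third z∈ z′∈ z≢
      ... | a , a′ , Z′ , p = Eq.trans (cross p (proj₂ K≢[])) (ZK (∈-resp-↭ (↭-sym p) (there (there (here refl)))) (proj₂ K≢[]))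

    -- Outside K only the colours of the edges among x, y, z occur; if these were distinct and did not occur inside K,
    -- then xw₁, yw₂, zw₃ would extend to a rainbow matching.
    clique-bound-even : j ≡ 0 → T ≤ 2 + tri (suc (b + b))
    clique-bound-even j≡0 = go Z refl
      where
      go : ∀ Z′ → Z ≡ Z′ → T ≤ 2 + tri (suc (b + b))
      go [] eq with () ← Eq.trans (sym lenZ) (cong length eq)
      go (_ ∷ []) eq with () ← Eq.trans (sym lenZ) (cong length eq)
      go (_ ∷ _ ∷ []) eq with () ← Eq.trans (sym lenZ) (cong length eq)
      go (_ ∷ _ ∷ _ ∷ _ ∷ _) eq with () ← Eq.trans (sym (Eq.trans lenZ (cong (3 +_) j≡0))) (cong length eq)
      go (x ∷ y ∷ z ∷ []) eq = decide
        where
        p₁ : Z ↭ x ∷ y ∷ z ∷ []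
        p₁ = ↭-reflexive eq
        p₂ : Z ↭ y ∷ z ∷ x ∷ []
        p₂ = ↭-trans p₁ (↭-trans (swap x y refl) (prep y (swap x z refl)))
        p₃ : Z ↭ x ∷ z ∷ y ∷ []
        p₃ = ↭-trans p₁ (prep x (swap y z refl))
        γx = col c y z
        γy = col c x z
        γz = col c x y
        -- By `cross`, an edge from a vertex of Z to K has the colour of the edge joining the other
        -- two vertices of Z; so three colours account for everything not inside K.
        only : ∀ ys → γx ∈ ys ++ colK → γy ∈ ys ++ colK → γz ∈ ys ++ colK → T ≤ length ys + tri (suc (b + b))
        only ys hx hy hz = many-colours ys f
          where
          ZK : ∀ {v w} → v ∈ x ∷ y ∷ z ∷ [] → w ∈ K → col c v w ∈ ys ++ colK
          ZK (here refl) w∈ = subst (_∈ ys ++ colK) (cross p₂ w∈) hx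
          ZK (there (here refl)) w∈ = subst (_∈ ys ++ colK) (cross p₃ w∈) hy
          ZK (there (there (here refl))) w∈ = subst (_∈ ys ++ colK) (cross p₁ w∈) hz
          ZZ : ∀ {v w} → v ∈ x ∷ y ∷ z ∷ [] → w ∈ x ∷ y ∷ z ∷ [] → v ≢ w → col c v w ∈ ys ++ colK
          ZZ (here refl) (here refl) v≢w = ⊥-elim (v≢w refl)
          ZZ (here refl) (there (here refl)) _ = hz
          ZZ (here refl) (there (there (here refl))) _ = hy
          ZZ (there (here refl)) (here refl) _ = subst (_∈ ys ++ colK) (col-sym c x y) hz
          ZZ (there (here refl)) (there (here refl)) v≢w = ⊥-elim (v≢w refl)
          ZZ (there (here refl)) (there (there (here refl))) _ = hx
          ZZ (there (there (here refl))) (here refl) _ = subst (_∈ ys ++ colK) (col-sym c x z) hy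
          ZZ (there (there (here refl))) (there (here refl)) _ = subst (_∈ ys ++ colK) (col-sym c y z) hx
          ZZ (there (there (here refl))) (there (there (here refl))) v≢w = ⊥-elim (v≢w refl)
          f : ∀ {v w} → v F.< w → col c v w ∈ ys ++ colK
          f {v} {w} lt with inK⊎inZ v | inK⊎inZ w
          ... | inj₁ p | inj₁ q = ∈-++⁺ʳ ys (inside p q (FP.<⇒≢ lt))
          ... | inj₁ p | inj₂ q = subst (_∈ ys ++ colK) (col-sym c w v) (ZK (subst (w ∈_) eq q) p)
          ... | inj₂ p | inj₁ q = ZK (subst (v ∈_) eq p) q
          ... | inj₂ p | inj₂ q = ZZ (subst (v ∈_) eq p) (subst (w ∈_) eq q) (FP.<⇒≢ lt)

        three : ∃[ w₁ ] ∃[ w₂ ] ∃[ w₃ ] ∃[ K′ ] K ≡ w₁ ∷ w₂ ∷ w₃ ∷ K′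
        three = go′ K b lenK dense
          where
          go′ : ∀ K b → length K ≡ suc (b + b) → Mis G K + 7 ≤ 6 * b → ∃[ w₁ ] ∃[ w₂ ] ∃[ w₃ ] ∃[ K′ ] K ≡ w₁ ∷ w₂ ∷ w₃ ∷ K′
          go′ (w₁ ∷ w₂ ∷ w₃ ∷ K′) b _ _ = w₁ , w₂ , w₃ , K′ , refl
          go′ K zero _ d with () ← ≤-trans (m≤n+m 7 (Mis G K)) d
          go′ (_ ∷ []) (suc b) () _
          go′ (_ ∷ _ ∷ []) (suc b) l _ with () ← Eq.trans l (cong (2 +_) (+-suc b b))

        separate : γx ≢ γy → γx ≢ γz → γy ≢ γz → γx ∉ colK → γy ∉ colK → γz ∉ colK → ⊥
        separate xy xz yz xK yK zK with three
        ... | w₁ , w₂ , w₃ , K′ , refl = finish b refl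
          where
          finish : ∀ b′ → b ≡ b′ → ⊥
          finish zero b≡ with () ← ≤-trans (m≤n+m 7 (Mis G K)) (subst (λ b → Mis G K + 7 ≤ 6 * b) b≡ dense)
          finish (suc b′) b≡ = contra (denseMatching FP._≟_ G b′ uK′ lenK′ dense′)
            where
            uK′ : Unique K′
            uK′ with K-unique
            ... | _ ∷ _ ∷ _ ∷ u = u
            lenK′ : length K′ ≡ b′ + b′
            lenK′ = suc-injective (suc-injective (suc-injective (Eq.trans lenK (Eq.trans (cong (λ b → suc (b + b)) b≡) (cong (2 +_) (+-suc b′ b′))))))
            dense′ : Mis G K′ + 4 ≤ 6 * b′
            -- Three vertices leave K, lowering `Mis` by at least 3, while 6b drops by 6; the margin
            -- 7 becomes exactly the 4 of `denseMatching`.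
            dense′ = +-cancelʳ-≤ 6 _ _ (≤-trans (≤-reflexive (r (Mis G K′))) (≤-trans (+-monoˡ-≤ 7 (≤-trans (s≤s (≤-trans (s≤s (Mis-tail G w₃ K′)) (Mis-tail G w₂ (w₃ ∷ K′)))) (Mis-tail G w₁ (w₂ ∷ w₃ ∷ K′))))
                (≤-trans dense (≤-reflexive (Eq.trans (cong (6 *_) b≡) (s b′))))))
              where
              r : ∀ x → x + 4 + 6 ≡ 3 + x + 7
              r = solve-∀
              s : ∀ b → 6 * suc b ≡ 6 * b + 6
              s = solve-∀
            contra : PM (E G) K′ → ⊥
            contra (ms , es , p) = nr ((x , w₁) ∷ (y , w₂) ∷ (z , w₃) ∷ ms)
                (≤-trans (≤-reflexive (cong (2 +_) b≡)) (s≤s (s≤s (s≤s (half-length ms p lenK′)))) ,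
                 Unique-↭ re (arrange {x ∷ y ∷ z ∷ []} {w₁ ∷ w₂ ∷ w₃ ∷ []} {K′} {[]} p₁ refl) , colours)
              where
              re : x ∷ y ∷ z ∷ w₁ ∷ w₂ ∷ w₃ ∷ K′ ↭ x ∷ w₁ ∷ y ∷ w₂ ∷ z ∷ w₃ ∷ flat ms
              re = prep x (↭-trans (prep y (swap z w₁ refl)) (↭-trans (swap y w₁ refl) (prep w₁ (prep y (↭-trans (swap z w₂ refl) (prep w₂ (prep z (prep w₃ (↭-sym p)))))))))
              ex = cross {w = w₁} p₂ (here refl)
              ey = cross {w = w₂} p₃ (there (here refl))
              ez = cross {w = w₃} p₁ (there (there (here refl)))
              outK : ∀ {γ} → γ ∉ colK → All (γ ≢_) (map (colp c) ms)
              outK {γ} γ∉ = All.tabulate λ γ′∈ → avoid γ′∈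
                where
                avoid : ∀ {γ′} → γ′ ∈ map (colp c) ms → γ ≢ γ′
                avoid γ′∈ refl with ∈-map⁻ (colp c) γ′∈
                ... | (v , w) , vw∈ , refl = γ∉ (inside (there (there (there (∈-resp-↭ p (proj₁ (∈-flat vw∈)))))) (there (there (there (∈-resp-↭ p (proj₂ (∈-flat vw∈)))))) (E-≢ G (All.lookup es vw∈)))
              colours : Unique (map (colp c) ((x , w₁) ∷ (y , w₂) ∷ (z , w₃) ∷ ms))
              colours = subst₃ ex ey ez ((xy ∷ xz ∷ outK xK) ∷ (yz ∷ outK yK) ∷ outK zK ∷ edges-distinct ms es (Unique-↭ (↭-sym p) uK′))
                where
                subst₃ : ∀ {g₁ g₂ g₃ h₁ h₂ h₃ : ℕ} {l} → g₁ ≡ h₁ → g₂ ≡ h₂ → g₃ ≡ h₃ → Unique (g₁ ∷ g₂ ∷ g₃ ∷ l) → Unique (h₁ ∷ h₂ ∷ h₃ ∷ l)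
                subst₃ refl refl refl u = u

        inK? : ∀ γ → Dec (γ ∈ colK)
        inK? γ = any? (γ ≟_) colK

        decide : T ≤ 2 + tri (suc (b + b))
        decide with γx ≟ γy | γx ≟ γz | γy ≟ γz | inK? γx | inK? γy | inK? γz
        ... | yes q | _ | _ | _ | _ | _ = only (γy ∷ γz ∷ []) (here q) (here refl) (there (here refl))
        ... | no _ | yes q | _ | _ | _ | _ = only (γy ∷ γz ∷ []) (there (here q)) (here refl) (there (here refl))
        ... | no _ | no _ | yes q | _ | _ | _ = only (γx ∷ γz ∷ []) (here refl) (there (here q)) (there (here refl))
        ... | no _ | no _ | no _ | yes q | _ | _ = only (γy ∷ γz ∷ []) (there (there q)) (here refl) (there (here refl))
        ... | no _ | no _ | no _ | no _ | yes q | _ = only (γx ∷ γz ∷ []) (here refl) (there (there q)) (there (here refl))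
        ... | no _ | no _ | no _ | no _ | no _ | yes q = only (γx ∷ γy ∷ []) (here refl) (there (here refl)) (there (there q))
        ... | no xy | no xz | no yz | no xK | no yK | no zK = ⊥-elim (separate xy xz yz xK yK zK)

-- Two vertices of small degree

module LowDegree {n : ℕ} (c : EdgeColoring n) (b j : ℕ) (n≡ : n ≡ 2 + b + (2 + b) + j)
  (nr : ∀ ms → ¬ RainbowList c (2 + b) ms) (R : Representing c)
  (C+2≤T : 2 + tri (suc (b + b)) ≤ numColors c) (C+3≤T : j ≡ 0 → 3 + tri (suc (b + b)) ≤ numColors c) where

  open NoRainbow c b j n≡ nr R
  open Representing R

  noClique : ∀ {K Z : List (Fin n)} → Z ++ K ↭ V → length K ≡ suc (b + b) → Mis G K + 7 ≤ 6 * b → ⊥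
  noClique {K} {Z} perm lenK dense with j ≟ 0
  ... | yes j≡0 = <⇒≱ (C+3≤T j≡0) (Clique.clique-bound-even {K} {Z} perm lenK dense j≡0)
  ... | no j≢0 = <⇒≱ C+2≤T (Clique.clique-bound-odd {K} {Z} perm lenK dense (n≢0⇒n>0 j≢0))

  -- Deleting two vertices of small degree leaves either a (k-1)-matching or j + 1 isolated vertices, and hence an almost complete K.
  noLowPair : ∀ {a a′} D e → a ≢ a′ → deg G V a + deg G V a′ ≤ D → suc D + e ≤ T →
    (∀ i q → suc i + q ≡ b → let w = suc b + suc b + j in w * w < w + suc (j + suc i) * (suc b + j + 1 + 3 * q) + (e + e)) →
    tri (suc (b + b)) < e ⊎ tri (suc (b + b)) + 4 ≤ e + (b + b) → ⊥
  noLowPair {a} {a′} D e a≢a′ degs le h₁ h₂ with pick₂ (∈-allFin a) (∈-allFin a′) a≢a′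
  ... | W , perm = main
    where
    γ = col c a a′
    Gγ = minus G γ

    aW-unique : Unique (a ∷ a′ ∷ W)
    aW-unique = Unique-↭ perm V-unique

    W-unique : Unique W
    W-unique with aW-unique
    ... | _ ∷ _ ∷ u = u

    W-length : length W ≡ suc b + suc b + j
    W-length = suc-injective (suc-injective (Eq.trans (sym (↭-length perm)) (Eq.trans V-length (Eq.trans n≡ (r b j)))))
      where
      r : ∀ b j → 2 + b + (2 + b) + j ≡ 2 + (suc b + suc b + j)
      r = solve-∀

    -- At most D edges of G meet a or a′, so at least e + 1 of the T edges lie inside W; deleting
    -- the one with the colour of aa′ leaves e.
    degG : 2 + (e + e) ≤ Deg G W
    degG = ar T D e (deg G (a′ ∷ W) a) (deg G W a′) (Deg G W) (≤-trans enough (≤-reflexive (Eq.trans (Deg-↭ G perm) (Eq.trans (Deg-cons G a (a′ ∷ W)) (cong (deg G (a′ ∷ W) a + deg G (a′ ∷ W) a +_) (Deg-cons G a′ W))))))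
        (≤-trans (+-mono-≤ (≤-trans (m≤n+m (deg G (a′ ∷ W) a) (ind (E G a a))) (≤-reflexive (sym (deg-↭ G a perm)))) (≤-trans (≤-trans (m≤n+m (deg G W a′) (ind (E G a′ a′))) (m≤n+m _ (ind (E G a′ a)))) (≤-reflexive (sym (deg-↭ G a′ perm))))) degs) le
      where
      ar : ∀ T D e x y g → T + T ≤ x + x + (y + y + g) → x + y ≤ D → suc D + e ≤ T → 2 + (e + e) ≤ g
      ar T D e x y g h₁ h₂ h₃ = +-cancelˡ-≤ (D + D) _ _ (≤-trans (≤-reflexive (r₁ D e)) (≤-trans (+-mono-≤ h₃ h₃) (≤-trans h₁ (≤-trans (≤-reflexive (r₂ x y g)) (+-monoˡ-≤ g (+-mono-≤ h₂ h₂))))))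
        where
        r₁ : ∀ D e → D + D + (2 + (e + e)) ≡ suc D + e + (suc D + e)
        r₁ = solve-∀
        r₂ : ∀ x y g → x + x + (y + y + g) ≡ x + y + (x + y) + g
        r₂ = solve-∀

    degGγ : e + e ≤ Deg Gγ W
    degGγ = +-cancelˡ-≤ 2 _ _ (≤-trans degG (ar (Deg G W) (Mis G W) (Deg Gγ W) (Mis Gγ W) (Eq.trans (Deg+Mis G W) (sym (Deg+Mis Gγ W))) (minus-Mis G γ W W-unique λ _ _ h → h)))
      where
      ar : ∀ d m d′ m′ → d + m ≡ d′ + m′ → m′ ≤ m + 2 → d ≤ 2 + d′
      ar d m d′ m′ eq h = +-cancelʳ-≤ m _ _ (≤-trans (≤-reflexive eq) (≤-trans (+-monoʳ-≤ d′ h) (≤-reflexive (r d′ m))))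
        where
        r : ∀ d m → d + (m + 2) ≡ 2 + d + m
        r = solve-∀

    fromMatch : Match (E Gγ) W (suc b) → ⊥
    fromMatch (ms , es , (rest , p) , len) = no-matching ms es (Unique-++ˡ (a ∷ a′ ∷ flat ms) (Unique-↭ (prep a (prep a′ (↭-sym p))) aW-unique)) len

    module _ (def : Deficient Gγ W (suc b) j) where
      open Deficient def

      contra-pos : ∀ i → suc i + p ≡ b → suc b + suc b + j + suc (j + suc i) * (suc b + j + 1 + 3 * p) ≤ Mis Gγ W → ⊥
      -- Degree sum and `Mis` of W add up to the square of its length, which the hypothesis on e
      -- excludes.
      contra-pos i eq h = <⇒≱ (h₁ i p eq) (≤-trans (+-mono-≤ h degGγ) (≤-reflexive (Eq.trans (+-comm (Mis Gγ W) _) (Eq.trans (Deg+Mis Gγ W) (cong₂ _*_ W-length W-length)))))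

      -- The low vertices are isolated in `Gγ` on W; j + 1 of them are removed and all e remaining
      -- edges lie in the 2b + 1 vertices of K. Either e exceeds the number of pairs in K, or at
      -- most 2b - 4 pairs are missing and `noClique` applies, with a, a′ and the isolated vertices
      -- as the complement.
      contra-zero : p ≡ b → (∀ {x} → x ∈ low → deg Gγ W x ≤ 0) → suc (j + 0) ≤ length low → ⊥
      contra-zero p≡b low≤0 len≥ = clique h₂
        where
        Z = take (suc j) low
        Z-length : length Z ≡ suc j
        Z-length = Eq.trans (length-take (suc j) low) (m≤n⇒m⊓n≡m (≤-trans (≤-reflexive (cong suc (sym (+-identityʳ j)))) len≥))
        Z⊆ : ∀ {x} → x ∈ Z → x ∈ low
        Z⊆ x∈ = subst (_ ∈_) (LP.take++drop≡id (suc j) low) (∈-++⁺ˡ x∈)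
        split = extend-⊆ (UP.take⁺ (suc j) low-unique) (low-∈ ∘ Z⊆)
        K = proj₁ split
        K-length : length K ≡ suc (b + b)
        K-length = +-cancelˡ-≡ (suc j) _ _ (Eq.trans (cong (_+ length K) (sym Z-length)) (Eq.trans (sym (length-++ Z)) (Eq.trans (sym (↭-length (proj₂ split))) (Eq.trans W-length (r b j)))))
          where
          r : ∀ b j → suc b + suc b + j ≡ suc j + suc (b + b)
          r = solve-∀
        perm′ : (a ∷ a′ ∷ Z) ++ K ↭ V
        perm′ = ↭-sym (↭-trans perm (prep a (prep a′ (proj₂ split))))
        degK : e + e ≤ Deg G K
        degK = ≤-trans degGγ (≤-trans (≤-reflexive (Eq.trans (Deg-↭ Gγ (proj₂ split)) (Deg-isolated Gγ Z K λ {z} z∈ → Eq.trans (deg-↭ Gγ z (↭-sym (proj₂ split))) (n≤0⇒n≡0 (low≤0 (Z⊆ z∈))))))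
                 (∑-mono K λ {x} _ → deg-mono {G = Gγ} {G} (minus-⊑ G γ) K x))
        C = tri (suc (b + b))
        total : Deg G K + Mis G K ≡ C + C + suc (b + b)
        total = Eq.trans (Deg+Mis G K) (Eq.trans (cong₂ _*_ K-length K-length) (sym (tri-eq (suc (b + b)))))
        clique : C < e ⊎ C + 4 ≤ e + (b + b) → ⊥
        clique (inj₁ lt) = absurd≤ 1 (≤-trans (+-mono-≤ (≤-trans (+-mono-≤ lt lt) degK) (≤-trans (≤-reflexive (sym K-length)) (length≤Mis G K))) (≤-reflexive total)) (r C (suc (b + b)))
          where
          r : ∀ C k → suc C + suc C + k ≡ suc (C + C + k + 1)
          r = solve-∀
        clique (inj₂ h) = noClique {K} {a ∷ a′ ∷ Z} perm′ K-length (ar C e (Deg G K) (Mis G K) total degK h)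
          where
          ar : ∀ C e d m → d + m ≡ C + C + suc (b + b) → e + e ≤ d → C + 4 ≤ e + (b + b) → m + 7 ≤ 6 * b
          ar C e d m eq h₁ h₂ = +-cancelˡ-≤ (C + C + 1) _ _ (≤-trans (≤-reflexive (r₁ C m)) (≤-trans (+-monoʳ-≤ m (+-mono-≤ h₂ h₂)) (≤-trans (≤-reflexive (r₂ m e b)) (≤-trans (+-monoˡ-≤ (4 * b) (+-monoˡ-≤ m h₁)) (≤-reflexive (Eq.trans (cong (_+ 4 * b) eq) (r₃ C b)))))))
            where
            r₁ : ∀ C m → C + C + 1 + (m + 7) ≡ m + (C + 4 + (C + 4))
            r₁ = solve-∀
            r₂ : ∀ m e b → m + (e + (b + b) + (e + (b + b))) ≡ e + e + m + 4 * b
            r₂ = solve-∀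
            r₃ : ∀ C b → C + C + suc (b + b) + 4 * b ≡ C + C + 1 + 6 * b
            r₃ = solve-∀

      contra : ⊥
      contra = cases i refl
        where
        cases : ∀ i′ → i ≡ i′ → ⊥
        cases zero i≡ = contra-zero (suc-injective (subst (λ i → suc (i + p) ≡ suc b) i≡ eq)) (λ {x} x∈ → subst (deg Gγ W x ≤_) i≡ (low-deg x∈)) (subst (λ i → suc (j + i) ≤ length low) i≡ low-length)
        cases (suc i′) i≡ = contra-pos i′ (suc-injective (subst (λ i → suc (i + p) ≡ suc b) i≡ eq)) (subst (λ i → suc b + suc b + j + suc (j + i) * (suc b + j + 1 + 3 * p) ≤ Mis Gγ W) i≡ many)

    main : ⊥
    main with match⊎deficient Gγ W-unique {suc b} {j} W-length
    ... | inj₁ m = fromMatch m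
    ... | inj₂ def = contra def

-- Bipartite matchings

mb : (A → A → Bool) → List A → List A → ℕ
mb e U J = ∑ U (λ u → ∑ J (λ w → ind (not (e u w))))

mb-↭ : ∀ (e : A → A → Bool) {U U′ J J′} → U ↭ U′ → J ↭ J′ → mb e U J ≡ mb e U′ J′
mb-↭ e {U} p q = Eq.trans (∑-cong U λ _ → ∑-↭ _ q) (∑-↭ _ p)

mb-swap : ∀ (e : A → A → Bool) U J → mb e U J ≡ ∑ J (λ w → ∑ U (λ u → ind (not (e u w))))
mb-swap e U J = ∑-swap U J _

mb-dropʳ : ∀ (e : A → A → Bool) U w J → mb e U J ≤ mb e U (w ∷ J)
mb-dropʳ e U w J = ∑-mono U λ {u} _ → m≤n+m _ (ind (not (e u w)))

findNeighbour : ∀ (e : A → A → Bool) u J → ∑ J (λ w → ind (not (e u w))) < length J → ∃[ w ] w ∈ J × e u w ≡ true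
findNeighbour e u (w ∷ J) lt with e u w in eq
... | true = w , here refl , eq
... | false with findNeighbour e u J (s≤s⁻¹ lt)
...   | w′ , w′∈ , h = w′ , there w′∈ , h

++-head₂ : ∀ (u w : A) U J → (u ∷ U) ++ (w ∷ J) ↭ u ∷ w ∷ U ++ J
++-head₂ u w U J = prep u (shift w U J)

bipartite-complete : ∀ (e : A → A → Bool) p U J → length U ≡ p → length J ≡ p → mb e U J ≡ 0 → PM e (U ++ J)
bipartite-complete e zero [] [] _ _ _ = [] , [] , refl
bipartite-complete e (suc p) (u ∷ U) (w ∷ J) lU lJ none = pm-perm (↭-sym (++-head₂ u w U J)) (pm-cons uw (bipartite-complete e p U J (suc-injective lU) (suc-injective lJ) rest))
  where
  not-ind : ∀ {p} → ind (not p) ≡ 0 → p ≡ true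
  not-ind {true} _ = refl
  uw : e u w ≡ true
  uw = not-ind (m+n≡0⇒m≡0 _ (m+n≡0⇒m≡0 _ none))
  rest : mb e U J ≡ 0
  rest = n≤0⇒n≡0 (≤-trans (mb-dropʳ e U w J) (≤-trans (m≤n+m _ (∑ (w ∷ J) (λ w → ind (not (e u w))))) (≤-reflexive none)))

-- Fewer than p missing pairs cannot block a whole row, so a vertex u with a missing pair still has
-- a neighbour. Matching u first disposes of at least one missing pair, which keeps the count below
-- p - 1.
bipartite : ∀ (e : A → A → Bool) p U J → length U ≡ p → length J ≡ p → mb e U J < p → PM e (U ++ J)
bipartite e (suc p) U J lU lJ lt with mb e U J ≟ 0
... | yes eq = bipartite-complete e (suc p) U J lU lJ eq
... | no ≢0 with ∑-positive U _ (n≢0⇒n>0 ≢0)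
...   | u , u∈ , pos with pick u∈
...     | U′ , pU with findNeighbour e u J (≤-trans (s≤s (∑-≥ U (λ u → ∑ J (λ w → ind (not (e u w)))) u∈)) (≤-trans lt (≤-reflexive (sym lJ))))
...       | w , w∈ , h with pick w∈
...         | J′ , pJ = pm-perm (↭-sym (↭-trans (++⁺ pU pJ) (++-head₂ u w U′ J′)))
    (pm-cons h (bipartite e p U′ J′ (suc-injective (Eq.trans (sym (↭-length pU)) lU)) (suc-injective (Eq.trans (sym (↭-length pJ)) lJ)) less))
  where
  less : mb e U′ J′ < p
  less = ≤-trans (s≤s (≤-trans (mb-dropʳ e U′ w J′) (≤-reflexive (mb-↭ e {U′} {U′} refl (↭-sym pJ)))))
           (s≤s⁻¹ (≤-trans (s≤s (≤-trans (+-monoˡ-≤ (mb e U′ J) pos) (≤-reflexive (sym (mb-↭ e {J = J} pU refl))))) lt))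

-- A small set meeting almost all edges

Mis-++ : ∀ (G : Graph A) S I → length S + (mb (E G) S I + mb (E G) S I) + Mis G I ≤ Mis G (S ++ I)
Mis-++ G [] I = ≤-refl
Mis-++ G (s ∷ S) I = ≤-trans (≤-reflexive (r (length S) (mis G I s) (mb (E G) S I) (Mis G I))) (≤-trans (+-mono-≤ (s≤s (+-mono-≤ le le)) (Mis-++ G S I)) (≤-reflexive (sym (Mis-cons G s (S ++ I)))))
  where
  le : mis G I s ≤ mis G (S ++ I) s
  le = ≤-trans (m≤n+m _ _) (≤-reflexive (sym (∑-++ S I _)))
  r : ∀ l x y z → suc l + (x + y + (x + y)) + z ≡ suc (x + x) + (l + (y + y) + z)
  r = solve-∀

∑-⊆ : ∀ {xs W : List A} f → Unique xs → (∀ {x} → x ∈ xs → x ∈ W) → ∑ xs f ≤ ∑ W f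
∑-⊆ {xs = xs} f u sub with extend-⊆ u sub
... | rest , p = ≤-trans (m≤m+n _ _) (≤-reflexive (sym (Eq.trans (∑-↭ f p) (∑-++ xs rest f))))

isolated⇒Mis : ∀ (G : Graph A) I → (∀ {x y} → x ∈ I → y ∈ I → E G x y ≡ false) → Mis G I ≡ length I * length I
isolated⇒Mis G I h = Eq.trans (∑-cong I λ x∈ → Eq.trans (∑-cong I λ y∈ → cong (ind ∘ not) (h x∈ y∈)) (Eq.trans (∑-const I 1) (*-identityʳ _))) (∑-const I _)

-- The budget M + 2 ≤ m² + 5m, with m = s + 1, comes from the join of a complete graph on m - 2
-- vertices with m + 2 isolated ones: its `Mis` is m² + 5m + 2, and two further edges lower it by 4.
star-count : ∀ s X M → s + (X + X) + (2 + s) * (2 + s) ≤ M → M + 2 ≤ suc s * suc s + 5 * suc s → X ≤ s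
star-count s X M h₁ h₂ = twice-≤ (+-cancelˡ-≤ (s * s + 5 * s + 6) _ _ (≤-trans (≤-reflexive (r₁ s X)) (≤-trans (+-monoˡ-≤ 2 h₁) (≤-trans h₂ (≤-reflexive (r₂ s))))))
  where
  r₁ : ∀ s X → s * s + 5 * s + 6 + (X + X) ≡ s + (X + X) + (2 + s) * (2 + s) + 2
  r₁ = solve-∀
  r₂ : ∀ s → suc s * suc s + 5 * suc s ≡ s * s + 5 * s + 6 + (s + s)
  r₂ = solve-∀

-- The same budget with m = u + 2. N is `Mis` on the u + 4 vertices outside the small set, where the
-- triangle saves 6 ordered pairs.
triangle-count : ∀ u X N M → 6 + N ≡ (4 + u) * (4 + u) → u + (X + X) + N ≤ M → M + 2 ≤ (2 + u) * (2 + u) + 5 * (2 + u) → X ≤ 1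
triangle-count u X N M eqN h₁ h₂ = twice-≤ (+-cancelˡ-≤ (u * u + 9 * u + 18) _ _ (≤-trans (≤-reflexive (r₁ u X)) (≤-trans (≤-reflexive (cong (λ k → 2 + u + (X + X) + k) (sym eqN))) (≤-trans (≤-reflexive (r₂ u X N)) (≤-trans (+-monoˡ-≤ 8 h₁) (≤-trans (≤-reflexive (r₃ M)) (≤-trans (+-monoˡ-≤ 6 h₂) (≤-reflexive (r₄ u)))))))))
  where
  r₁ : ∀ u X → u * u + 9 * u + 18 + (X + X) ≡ 2 + u + (X + X) + (4 + u) * (4 + u)
  r₁ = solve-∀
  r₂ : ∀ u X N → 2 + u + (X + X) + (6 + N) ≡ u + (X + X) + N + 8
  r₂ = solve-∀
  r₃ : ∀ M → M + 8 ≡ M + 2 + 6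
  r₃ = solve-∀
  r₄ : ∀ u → (2 + u) * (2 + u) + 5 * (2 + u) + 6 ≡ u * u + 9 * u + 18 + 2
  r₄ = solve-∀

-- hit p q marks the edge of G that has the colour of pq, if there is one.

module Balanced {A : Set} (_≟ᴬ_ : DecidableEquality A) (G : Graph A) (m : ℕ) {W : List A} (un : Unique W) (len : length W ≡ m + m) (m≥3 : 3 ≤ m)
  (few : Mis G W + 2 ≤ m * m + 5 * m) (noPM : ¬ PM (E G) W)
  (hit : A → A → A → A → Bool)
  (hit-unique : ∀ p q {x y x′ y′} → hit p q x y ≡ true → hit p q x′ y′ ≡ true → (x ≡ x′ × y ≡ y′) ⊎ (x ≡ y′ × y ≡ x′))
  (forbidden : ∀ p q {W′} → W ↭ p ∷ q ∷ W′ → E G p q ≡ false → ¬ PM (λ x y → E G x y ∧ not (hit p q x y)) W′)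
  where

  avoid : A → A → A → A → Bool
  avoid p q x y = E G x y ∧ not (hit p q x y)

  -- The marked edge counts once only, because U and J are disjoint and so it crosses them in one
  -- orientation.
  mb-avoid : ∀ p q U J → Unique (U ++ J) → mb (avoid p q) U J ≤ mb (E G) U J + 1
  mb-avoid p q U J u = ≤-trans (∑-mono U λ {x} _ → ≤-trans (∑-mono J λ {y} _ → bit x y) (≤-reflexive (∑-+ J _ _)))
      (≤-trans (≤-reflexive (∑-+ U _ _)) (+-monoʳ-≤ (mb (E G) U J) once))
    where
    bit : ∀ x y → ind (not (avoid p q x y)) ≤ ind (not (E G x y)) + ind (hit p q x y)
    bit x y with E G x y | hit p q x y
    ... | false | _ = s≤s z≤n
    ... | true | false = z≤n
    ... | true | true = ≤-refl
    once : ∑ U (λ x → ∑ J (λ y → ind (hit p q x y))) ≤ 1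
    once = ≤-trans (≤-reflexive (sym (∑-cartesian U J (λ z → ind (hit p q (proj₁ z) (proj₂ z))))))
      (∑-ind-unique (cartesianProduct U J) (λ z → hit p q (proj₁ z) (proj₂ z)) (UP.cartesianProduct⁺ (Unique-++ˡ U u) (Unique-++ʳ U u)) same)
      where
      same : ∀ {z z′} → z ∈ cartesianProduct U J → z′ ∈ cartesianProduct U J → hit p q (proj₁ z) (proj₂ z) ≡ true → hit p q (proj₁ z′) (proj₂ z′) ≡ true → z ≡ z′
      same {x , y} {x′ , y′} z∈ z′∈ h h′ with hit-unique p q h h′
      ... | inj₁ (refl , refl) = refl
      ... | inj₂ (refl , _) = ⊥-elim (∉-++ U u (proj₁ (∈-cartesianProduct⁻ U J z∈)) (proj₂ (∈-cartesianProduct⁻ U J z′∈)))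

  column : List A → A → ℕ
  column U w = ∑ U (λ u → ind (not (E G u w)))

  -- The outside edge joins the two vertices p, q of I with the most missing pairs. If a missing
  -- pair survives their removal, p and q each took at least one with them, so at most m - 3 of the
  -- at most m - 1 survive; if none survives, m ≥ 3 suffices. Either way one more pair may be lost
  -- to the colour of pq before `bipartite` fails between S and the rest of I.
  noIndependent : ∀ S I → W ↭ S ++ I → suc (length S) ≡ m → length I ≡ suc m → (∀ {x y} → x ∈ I → y ∈ I → E G x y ≡ false) → ⊥
  noIndependent S I perm lS lI ind-I = main
    where
    X = mb (E G) S I
    few′ : Mis G W + 2 ≤ suc (length S) * suc (length S) + 5 * suc (length S)
    few′ = subst (λ m → Mis G W + 2 ≤ m * m + 5 * m) (sym lS) few
    block : length S + (X + X) + (2 + length S) * (2 + length S) ≤ Mis G W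
    block = ≤-trans (+-monoʳ-≤ (length S + (X + X)) (≤-reflexive (sym (Eq.trans (isolated⇒Mis G I ind-I) (cong (λ l → l * l) (Eq.trans lI (cong suc (sym lS))))))))
      (≤-trans (Mis-++ G S I) (≤-reflexive (sym (Mis-↭ G perm))))
    X≤ : suc X ≤ m
    X≤ = ≤-trans (s≤s (star-count (length S) X (Mis G W) block few′)) (≤-reflexive lS)
    f = column S
    module Choice (p q : A) (J : List A) (permI : I ↭ p ∷ q ∷ J) (p-max : ∀ {w} → w ∈ J → f w ≤ f p) (q-max : ∀ {w} → w ∈ J → f w ≤ f q) where
      Y = mb (E G) S J
      lJ : length J ≡ length S
      lJ = suc-injective (suc-injective (Eq.trans (sym (↭-length permI)) (Eq.trans lI (cong suc (sym lS)))))
      sumX : f p + (f q + Y) ≡ X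
      sumX = sym (Eq.trans (mb-swap (E G) S I) (Eq.trans (∑-↭ f permI) (cong (λ s → f p + (f q + s)) (sym (mb-swap (E G) S J)))))
      Y+2≤ : 3 + Y ≤ m
      Y+2≤ with Y ≟ 0
      ... | yes Y≡0 = ≤-trans (≤-reflexive (cong (3 +_) Y≡0)) m≥3
      ... | no Y≢0 with ∑-positive J f (≤-trans (n≢0⇒n>0 Y≢0) (≤-reflexive (mb-swap (E G) S J)))
      ...   | w , w∈ , pos = ≤-trans (s≤s (≤-trans (+-mono-≤ (≤-trans pos (p-max w∈)) (+-monoˡ-≤ Y (≤-trans pos (q-max w∈)))) (≤-reflexive sumX))) X≤
      permW : W ↭ p ∷ q ∷ S ++ J
      permW = ↭-trans perm (↭-trans (++⁺ˡ S permI) (↭-trans (shift p S (q ∷ J)) (prep p (shift q S J))))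
      uSJ : Unique (S ++ J)
      uSJ with Unique-↭ permW un
      ... | _ ∷ _ ∷ u = u
      npq : E G p q ≡ false
      npq = ind-I (∈-resp-↭ (↭-sym permI) (here refl)) (∈-resp-↭ (↭-sym permI) (there (here refl)))
      contra : ⊥
      contra = forbidden p q permW npq (bipartite (avoid p q) (length S) S J refl lJ
        (s≤s⁻¹ (≤-trans (s≤s (s≤s (≤-trans (mb-avoid p q S J uSJ) (≤-reflexive (+-comm Y 1))))) (≤-trans Y+2≤ (≤-reflexive (sym lS))))))
    main : ⊥
    main with argmax I f (proj₂ (nonempty′ I lI))
    ... | p , p∈ , p-max with pick p∈
    ...   | I₁ , perm₁ with argmax I₁ f (proj₂ (nonempty′ I₁ (Eq.trans (suc-injective (Eq.trans (sym (↭-length perm₁)) lI)) (sym lS))))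
    ...     | q , q∈ , q-max with pick q∈
    ...       | J , perm₂ = Choice.contra p q J (↭-trans perm₁ (prep p perm₂)) (λ w∈ → p-max (∈-resp-↭ (↭-sym perm₁) (there (∈-resp-↭ (↭-sym perm₂) (there w∈))))) (λ w∈ → q-max (∈-resp-↭ (↭-sym perm₂) (there w∈)))

  -- Removing p and q from R leaves one vertex too few opposite U, so one triangle vertex t fills
  -- the gap and the opposite edge of the triangle is used as it stands. Two things spoil a choice
  -- of t: a missing pair at t, of which there is at most one in all, and the single edge marked by
  -- `hit`. They rule out at most two of the three choices.
  noTriangle : ∀ U x y z R → W ↭ U ++ (x ∷ y ∷ z ∷ R) → 2 + length U ≡ m → E G x y ≡ true → E G y z ≡ true → E G x z ≡ true →
    (∀ {v w} → v ∈ R → w ∈ x ∷ y ∷ z ∷ R → E G v w ≡ false) → ⊥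
  noTriangle U x y z R perm lU xy yz xz none = main
    where
    I′ = x ∷ y ∷ z ∷ R
    uW : Unique (U ++ I′)
    uW = Unique-↭ perm un
    uI : Unique I′
    uI = Unique-++ʳ U uW
    lR : suc (length R) ≡ m
    lR = +-cancelˡ-≡ (length U + 2) _ _ (Eq.trans (r₁ (length U) (length R)) (Eq.trans (sym (length-++ U {I′})) (Eq.trans (sym (↭-length perm)) (Eq.trans len (Eq.trans (cong (_+ m) (sym lU)) (r₂ (length U) m))))))
      where
      r₁ : ∀ u r → u + 2 + suc r ≡ u + (3 + r)
      r₁ = solve-∀
      r₂ : ∀ u m → 2 + u + m ≡ u + 2 + m
      r₂ = solve-∀
    X = mb (E G) U I′
    degR : ∀ v → v ∈ I′ → deg G R v ≡ 0
    degR v v∈ = ∑-zero R λ {w} w∈ → cong ind (Eq.trans (E-sym G v w) (none w∈ v∈))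
    Deg-I′ : Deg G I′ ≡ 6
    Deg-I′ = Eq.trans (Deg-cons G x (y ∷ z ∷ R)) (Eq.trans (cong₂ (λ d e → d + d + e) dx (Eq.trans (Deg-cons G y (z ∷ R)) (cong₂ (λ d e → d + d + e) dy (Eq.trans (Deg-cons G z R) (cong₂ (λ d e → d + d + e) (degR z (there (there (here refl)))) DR))))) refl)
      where
      dx : deg G (y ∷ z ∷ R) x ≡ 2
      dx rewrite xy | xz | degR x (here refl) = refl
      dy : deg G (z ∷ R) y ≡ 1
      dy rewrite yz | degR y (there (here refl)) = refl
      DR : Deg G R ≡ 0
      DR = ∑-zero R λ {v} v∈ → degR v (there (there (there v∈)))
    few′ : Mis G W + 2 ≤ (2 + length U) * (2 + length U) + 5 * (2 + length U)
    few′ = subst (λ m → Mis G W + 2 ≤ m * m + 5 * m) (sym lU) few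
    sizes : 6 + Mis G I′ ≡ (4 + length U) * (4 + length U)
    sizes = Eq.trans (cong (_+ Mis G I′) (sym Deg-I′)) (Eq.trans (Deg+Mis G I′) (cong (λ l → l * l) (cong (2 +_) (Eq.trans lR (sym lU)))))
    X≤1 : X ≤ 1
    X≤1 = triangle-count (length U) X (Mis G I′) (Mis G W) sizes (≤-trans (Mis-++ G U I′) (≤-reflexive (sym (Mis-↭ G perm)))) few′
    f = column U
    X-col : ∑ I′ f ≤ 1
    X-col = ≤-trans (≤-reflexive (sym (mb-swap (E G) U I′))) X≤1
    twoColumns : ∀ {v w} → v ∈ I′ → w ∈ I′ → v ≢ w → 1 ≤ f v → 1 ≤ f w → ⊥
    twoColumns {v} {w} v∈ w∈ v≢w fv fw = 1+n≰n (≤-trans (≤-trans (+-mono-≤ fv (+-mono-≤ fw z≤n)) (∑-⊆ f ((v≢w ∷ []) ∷ [] ∷ []) λ { (here refl) → v∈ ; (there (here refl)) → w∈ })) X-col)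
    U-pos : ∃[ k ] length U ≡ suc k
    U-pos = pos (length U) lU
      where
      pos : ∀ l → 2 + l ≡ m → ∃[ k ] l ≡ suc k
      pos (suc k) _ = k , refl
      pos zero eq with s≤s (s≤s ()) ← ≤-trans m≥3 (≤-reflexive (sym eq))
    inI : ∀ {w} → w ∈ R → w ∈ I′
    inI w∈ = there (there (there w∈))
    uR : Unique R
    uR with uI
    ... | _ ∷ _ ∷ _ ∷ u = u
    U∌ : ∀ {u v} → u ∈ U → v ∈ I′ → u ≢ v
    U∌ u∈ v∈ refl = ∉-++ U uW u∈ v∈

    module Choice (p q : A) (J₀ : List A) (permR : R ↭ p ∷ q ∷ J₀) (p-max : ∀ {w} → w ∈ J₀ → f w ≤ f p) where
      lJ₀ : suc (length J₀) ≡ length U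
      lJ₀ = suc-injective (suc-injective (Eq.trans (cong suc (sym (↭-length permR))) (Eq.trans lR (sym lU))))
      inR : ∀ {w} → w ∈ p ∷ q ∷ J₀ → w ∈ R
      inR = ∈-resp-↭ (↭-sym permR)
      npq : E G p q ≡ false
      npq = none (inR (here refl)) (inI (inR (there (here refl))))
      J₀-full : mb (E G) U J₀ ≡ 0
      J₀-full = Eq.trans (mb-swap (E G) U J₀) (∑-zero J₀ λ {w} w∈ → zero-col w∈)
        where
        zero-col : ∀ {w} → w ∈ J₀ → f w ≡ 0
        zero-col {w} w∈ with f w ≟ 0
        ... | yes eq = eq
        ... | no ≢0 = ⊥-elim (twoColumns (inI (inR (here refl))) (inI (inR (there (there w∈)))) p≢w (≤-trans (n≢0⇒n>0 ≢0) (p-max w∈)) (n≢0⇒n>0 ≢0))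
          where
          p≢w : p ≢ w
          p≢w refl = ∉-head (Unique-↭ permR uR) (there w∈)
      h : A → A → Bool
      h = hit p q

      finish : ∀ t r s → x ∷ y ∷ z ∷ [] ↭ t ∷ r ∷ s ∷ [] → E G r s ≡ true → f t ≡ 0 → h r s ≡ false → (∀ {u} → u ∈ U → h u t ≡ false) → ⊥
      finish t r s tp rs ft hrs hut = forbidden p q permW npq (pm-cons (avoid-true rs hrs) (pm-UJ J₀ refl))
        where
        avoid-true : ∀ {v w} → E G v w ≡ true → h v w ≡ false → avoid p q v w ≡ true
        avoid-true e₁ e₂ rewrite e₁ | e₂ = refl
        permI : I′ ↭ p ∷ q ∷ r ∷ s ∷ t ∷ J₀
        permI = ↭-trans (++⁺ tp permR) (↭-trans (shifts (t ∷ r ∷ s ∷ []) (p ∷ q ∷ []) {J₀}) (prep p (prep q (↭-trans (swap t r refl) (prep r (swap t s refl))))))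
        permW : W ↭ p ∷ q ∷ r ∷ s ∷ U ++ (t ∷ J₀)
        permW = ↭-trans perm (↭-trans (++⁺ˡ U permI) (shifts U (p ∷ q ∷ r ∷ s ∷ []) {t ∷ J₀}))
        uUJ : Unique (U ++ J₀)
        uUJ with Unique-↭ (↭-trans permW (prep p (prep q (prep r (prep s (shift t U J₀)))))) un
        ... | _ ∷ _ ∷ _ ∷ _ ∷ _ ∷ u = u
        col-t : ∑ U (λ u → ind (not (avoid p q u t))) ≡ 0
        col-t = ∑-zero U λ {u} u∈ → zero-at u u∈
          where
          zero-at : ∀ u → u ∈ U → ind (not (avoid p q u t)) ≡ 0
          zero-at u u∈ rewrite hut u∈ with E G u t | ∑-≥ U (λ u → ind (not (E G u t))) u∈
          ... | true | _ = refl
          ... | false | le with () ← ≤-trans le (≤-reflexive ft)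
        mb-t : ∀ J → mb (avoid p q) U (t ∷ J) ≡ mb (avoid p q) U J
        mb-t J = Eq.trans (∑-+ U _ _) (cong (_+ mb (avoid p q) U J) col-t)
        pm-UJ : ∀ J → J ≡ J₀ → PM (avoid p q) (U ++ (t ∷ J₀))
        -- With no other vertex opposite U there is no room for a lost edge, but t itself is
        -- untouched by `hit`. Otherwise U has at least two vertices and one lost edge is harmless.
        pm-UJ [] refl = bipartite-complete (avoid p q) _ U (t ∷ []) refl lJ₀ (Eq.trans (mb-t []) (∑-zero U λ _ → refl))
        pm-UJ (v ∷ J) refl = bipartite (avoid p q) _ U (t ∷ v ∷ J) refl lJ₀ (≤-trans (s≤s (≤-trans (≤-reflexive (mb-t (v ∷ J))) (≤-trans (mb-avoid p q U (v ∷ J) uUJ) (≤-reflexive (cong (_+ 1) J₀-full))))) (≤-trans (s≤s (s≤s z≤n)) (≤-reflexive lJ₀)))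

      Hit : A → A → A → Set
      Hit t r s = h r s ≡ true ⊎ (∃[ u ] u ∈ U × h u t ≡ true)

      test : ∀ t r s → x ∷ y ∷ z ∷ [] ↭ t ∷ r ∷ s ∷ [] → E G r s ≡ true → 1 ≤ f t ⊎ Hit t r s
      test t r s tp rs with f t ≟ 0
      ... | no ≢0 = inj₁ (n≢0⇒n>0 ≢0)
      ... | yes ft with h r s in hrs
      ...   | true = inj₂ (inj₁ refl)
      ...   | false with ∑ U (λ u → ind (h u t)) ≟ 0
      ...     | no ≢0 with ∑-positive U (λ u → ind (h u t)) (n≢0⇒n>0 ≢0)
      ...       | u , u∈ , pos = inj₂ (inj₂ (u , u∈ , ind⁻ pos))
      test t r s tp rs | yes ft | false | yes none-hit = ⊥-elim (finish t r s tp rs ft hrs λ {u} u∈ → out u u∈)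
        where
        out : ∀ u → u ∈ U → h u t ≡ false
        out u u∈ with h u t | ∑-≥ U (λ u → ind (h u t)) u∈
        ... | false | _ = refl
        ... | true | le with () ← ≤-trans le (≤-reflexive none-hit)

      same-hit : ∀ {a b a′ b′ v} → h a b ≡ true → h a′ b′ ≡ true → v ∈ a ∷ b ∷ [] → v ∈ a′ ∷ b′ ∷ []
      same-hit e₁ e₂ v∈ with hit-unique p q e₁ e₂
      same-hit e₁ e₂ v∈ | inj₁ (refl , refl) = v∈
      same-hit e₁ e₂ (here refl) | inj₂ (refl , refl) = there (here refl)
      same-hit e₁ e₂ (there (here refl)) | inj₂ (refl , refl) = here refl

      -- The edge opposite t and the edges from U to t spoil no triangle vertex other than t, so the
      -- one marked edge cannot spoil two.
      twoHits : ∀ {t r s t′ r′ s′ w} → t ∈ I′ → t′ ∈ I′ → w ∈ I′ → t ≢ t′ → w ≢ t′ → w ≢ t →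
        r ∷ s ∷ [] ↭ t′ ∷ w ∷ [] → r′ ∷ s′ ∷ [] ↭ t ∷ w ∷ [] → Hit t r s → Hit t′ r′ s′ → ⊥
      twoHits t∈ t′∈ w∈ tt′ wt′ wt π π′ (inj₁ e₁) (inj₁ e₂) with ∈-resp-↭ π′ (same-hit e₁ e₂ (∈-resp-↭ (↭-sym π) (here refl)))
      ... | here eq = tt′ (sym eq)
      ... | there (here eq) = wt′ (sym eq)
      twoHits t∈ t′∈ w∈ tt′ wt′ wt π π′ (inj₁ e₁) (inj₂ (u , u∈ , e₂)) with same-hit e₁ e₂ (∈-resp-↭ (↭-sym π) (there (here refl)))
      ... | here eq = U∌ u∈ w∈ (sym eq)
      ... | there (here eq) = wt′ eq
      twoHits t∈ t′∈ w∈ tt′ wt′ wt π π′ (inj₂ (u , u∈ , e₁)) (inj₁ e₂) with ∈-resp-↭ π′ (same-hit e₁ e₂ (here refl))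
      ... | here eq = U∌ u∈ t∈ eq
      ... | there (here eq) = U∌ u∈ w∈ eq
      twoHits t∈ t′∈ w∈ tt′ wt′ wt π π′ (inj₂ (u , u∈ , e₁)) (inj₂ (u′ , u′∈ , e₂)) with same-hit e₁ e₂ (there (here refl))
      ... | here eq = U∌ u′∈ t∈ (sym eq)
      ... | there (here eq) = tt′ eq

      contra : ⊥
      contra with test x y z refl yz | test y x z (swap x y refl) xz | test z x y (↭-trans (prep x (swap y z refl)) (swap x z refl)) xy
      ... | inj₁ a | inj₁ b | _ = twoColumns (here refl) (there (here refl)) (E-≢ G xy) a b
      ... | inj₁ a | inj₂ _ | inj₁ b = twoColumns (here refl) (there (there (here refl))) (E-≢ G xz) a b
      ... | inj₂ _ | inj₁ a | inj₁ b = twoColumns (there (here refl)) (there (there (here refl))) (E-≢ G yz) a b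
      ... | inj₂ a | inj₂ b | _ = twoHits (here refl) (there (here refl)) (there (there (here refl))) (E-≢ G xy) (E-≢ G yz ∘ sym) (E-≢ G xz ∘ sym) refl refl a b
      ... | inj₂ a | inj₁ _ | inj₂ b = twoHits (here refl) (there (there (here refl))) (there (here refl)) (E-≢ G xz) (E-≢ G yz) (E-≢ G xy ∘ sym) (swap y z refl) refl a b
      ... | inj₁ _ | inj₂ a | inj₂ b = twoHits (there (here refl)) (there (there (here refl))) (here refl) (E-≢ G yz) (E-≢ G xz) (E-≢ G xy) (swap x z refl) (swap x y refl) a b

    main : ⊥
    main with argmax R f (proj₂ (nonempty′ R (suc-injective (Eq.trans lR (sym lU)))))
    ... | p , p∈ , p-max with pick p∈
    ...   | R₁ , perm₁ with nonempty′ R₁ (Eq.trans (suc-injective (suc-injective (Eq.trans (cong suc (sym (↭-length perm₁))) (Eq.trans lR (sym lU))))) (proj₂ U-pos))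
    ...     | q , q∈ with pick q∈
    ...       | J₀ , perm₂ = Choice.contra p q J₀ (↭-trans perm₁ (prep p perm₂)) λ w∈ → p-max (∈-resp-↭ (↭-sym perm₁) (there (∈-resp-↭ (↭-sym perm₂) (there w∈))))

  module Universal (H : Graph A) (G⊑H : G ⊑ H) (back : PM (E H) W → PM (E G) W) (U I′ : List A) (perm : W ↭ U ++ I′) (lU : 2 + length U ≡ m)
    (universal : ∀ {u y} → u ∈ U → y ∈ W → y ≢ u → E H u y ≡ true) where

    uW : Unique (U ++ I′)
    uW = Unique-↭ perm un

    uI : Unique I′
    uI = Unique-++ʳ U uW

    lI : length I′ ≡ 2 + m
    lI = +-cancelˡ-≡ (length U) _ _ (Eq.trans (sym (length-++ U)) (Eq.trans (sym (↭-length perm)) (Eq.trans len (Eq.trans (cong (_+ m) (sym lU)) (r (length U) m)))))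
      where
      r : ∀ u m → 2 + u + m ≡ u + (2 + m)
      r = solve-∀

    -- Two disjoint edges leave m - 2 vertices of I′, as many as U has, and U is universal in the
    -- closure. Hence any two edges of G inside I′ meet.
    twoEdges : ∀ {x y z w J} → I′ ↭ x ∷ y ∷ z ∷ w ∷ J → E H x y ≡ true → E H z w ≡ true → ⊥
    twoEdges {x} {y} {z} {w} {J} pI xy zw = noPM (back (pm-perm (↭-sym permW) (pm-cons xy (pm-cons zw (bipartite-complete (E H) (length U) U J refl lJ full)))))
      where
      permW : W ↭ x ∷ y ∷ z ∷ w ∷ U ++ J
      permW = ↭-trans perm (↭-trans (++⁺ˡ U pI) (shifts U (x ∷ y ∷ z ∷ w ∷ []) {J}))
      lJ : length J ≡ length U
      lJ = +-cancelˡ-≡ 4 _ _ (Eq.trans (sym (↭-length pI)) (Eq.trans lI (cong (2 +_) (sym lU))))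
      inI : ∀ {v} → v ∈ J → v ∈ I′
      inI v∈ = ∈-resp-↭ (↭-sym pI) (there (there (there (there v∈))))
      full : mb (E H) U J ≡ 0
      full = ∑-zero U λ {u} u∈ → ∑-zero J λ {v} v∈ → cong (ind ∘ not) (universal u∈ (∈-resp-↭ (↭-sym perm) (∈-++⁺ʳ U (inI v∈))) λ { refl → ∉-++ U uW u∈ (inI v∈) })

    meet : ∀ {x y z w} → x ∈ I′ → y ∈ I′ → z ∈ I′ → w ∈ I′ → E G x y ≡ true → E G z w ≡ true → (x ≡ z ⊎ x ≡ w) ⊎ (y ≡ z ⊎ y ≡ w)
    meet {x} {y} {z} {w} x∈ y∈ z∈ w∈ xy zw with x ≟ᴬ z | x ≟ᴬ w | y ≟ᴬ z | y ≟ᴬ w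
    ... | yes p | _ | _ | _ = inj₁ (inj₁ p)
    ... | no _ | yes p | _ | _ = inj₁ (inj₂ p)
    ... | no _ | no _ | yes p | _ = inj₂ (inj₁ p)
    ... | no _ | no _ | no _ | yes p = inj₂ (inj₂ p)
    ... | no xz | no xw | no yz | no yw with pick₂ x∈ y∈ (E-≢ G xy)
    ...   | I₁ , p₁ with pick₂ (out z∈ xz yz) (out w∈ xw yw) (E-≢ G zw)
      where
      out : ∀ {v} → v ∈ I′ → x ≢ v → y ≢ v → v ∈ I₁
      out v∈ xv yv = ∈-tail (∈-tail (∈-resp-↭ p₁ v∈) (xv ∘ sym)) (yv ∘ sym)
    ...     | J , p₂ = ⊥-elim (twoEdges (↭-trans p₁ (prep x (prep y p₂))) (G⊑H x y xy) (G⊑H z w zw))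

    Away : A → A → A → Set
    Away s v w = v ≢ s × w ≢ s × E G v w ≡ true

    away? : ∀ s v w → Dec (Away s v w)
    away? s v w = ¬? (v ≟ᴬ s) ×-dec (¬? (w ≟ᴬ s) ×-dec (E G v w BP.≟ true))

    star : ∀ {s} → s ∈ I′ → (∀ {v w} → v ∈ I′ → w ∈ I′ → ¬ Away s v w) → ⊥
    star {s} s∈ all with pick s∈
    ... | I , p = noIndependent (s ∷ U) I (↭-trans perm (↭-trans (++⁺ˡ U p) (shift s U I))) lU (suc-injective (Eq.trans (sym (↭-length p)) lI)) indep
      where
      s∉ : ∀ {v} → v ∈ I → v ≢ s
      s∉ v∈ refl = ∉-head (Unique-↭ p uI) v∈
      inI : ∀ {v} → v ∈ I → v ∈ I′
      inI v∈ = ∈-resp-↭ (↭-sym p) (there v∈)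
      indep : ∀ {v w} → v ∈ I → w ∈ I → E G v w ≡ false
      indep v∈ w∈ = ≢true⇒false λ e → all (inI v∈) (inI w∈) (s∉ v∈ , s∉ w∈ , e)

    triangle : ∀ {x y z} → x ∈ I′ → y ∈ I′ → z ∈ I′ → E G x y ≡ true → E G y z ≡ true → E G x z ≡ true → ⊥
    triangle {x} {y} {z} x∈ y∈ z∈ xy yz xz with pick₂ x∈ y∈ (E-≢ G xy)
    ... | I₁ , p₁ with pick (∈-tail (∈-tail (∈-resp-↭ p₁ z∈) (E-≢ G xz ∘ sym)) (E-≢ G yz ∘ sym))
    ...   | R , p₂ = noTriangle U x y z R (↭-trans perm (++⁺ˡ U p)) lU xy yz xz none
      where
      p : I′ ↭ x ∷ y ∷ z ∷ R
      p = ↭-trans p₁ (prep x (prep y p₂))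
      none : ∀ {v w} → v ∈ R → w ∈ x ∷ y ∷ z ∷ R → E G v w ≡ false
      none {v} {w} v∈ w∈ = ≢true⇒false λ e → contra e
        where
        v∈I : v ∈ I′
        v∈I = ∈-resp-↭ (↭-sym p) (there (there (there v∈)))
        w∈I : w ∈ I′
        w∈I = ∈-resp-↭ (↭-sym p) w∈
        uT = Unique-↭ p uI
        v≢ : ∀ {t} → t ∈ x ∷ y ∷ z ∷ [] → t ≢ v
        v≢ t∈ refl = ∉-++ (x ∷ y ∷ z ∷ []) uT t∈ v∈
        must : ∀ {a b} → a ∈ x ∷ y ∷ z ∷ [] → b ∈ x ∷ y ∷ z ∷ [] → a ∈ I′ → b ∈ I′ → E G a b ≡ true → E G v w ≡ true → a ≡ w ⊎ b ≡ w
        must a∈ b∈ a∈I b∈I ab e with meet a∈I b∈I v∈I w∈I ab e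
        ... | inj₁ (inj₁ q) = ⊥-elim (v≢ a∈ q)
        ... | inj₁ (inj₂ q) = inj₁ q
        ... | inj₂ (inj₁ q) = ⊥-elim (v≢ b∈ q)
        ... | inj₂ (inj₂ q) = inj₂ q
        contra : E G v w ≡ true → ⊥
        -- An edge from v outside the triangle would have to meet all three sides at its other end
        -- w, but no vertex lies on all three.
        contra e with must (here refl) (there (here refl)) x∈ y∈ xy e | must (there (here refl)) (there (there (here refl))) y∈ z∈ yz e | must (here refl) (there (there (here refl))) x∈ z∈ xz e
        ... | inj₁ refl | inj₁ q | _ = E-≢ G xy (sym q)
        ... | inj₁ refl | inj₂ q | _ = E-≢ G xz (sym q)
        ... | inj₂ refl | _ | inj₁ q = E-≢ G xy q
        ... | inj₂ refl | _ | inj₂ q = E-≢ G yz (sym q)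

    -- Pairwise meeting edges form a star or a triangle: an edge avoiding x must pass through y, and
    -- one avoiding y must then join x to z. The star is excluded by `noIndependent` after its
    -- centre joins U, the triangle by `noTriangle`.
    contradiction : ⊥
    contradiction with nonempty′ I′ lI
    ... | x₀ , x₀∈ with search₂ (away? x₀) I′
    ...   | inj₂ all = star x₀∈ all
    ...   | inj₁ (x , y , x∈ , y∈ , _ , _ , xy) with search₂ (away? x) I′
    ...     | inj₂ all = star x∈ all
    ...     | inj₁ (v , w , v∈ , w∈ , v≢x , w≢x , vw) = second (third v∈ w∈ v≢x w≢x vw)
      where
      third : ∀ {v w} → v ∈ I′ → w ∈ I′ → v ≢ x → w ≢ x → E G v w ≡ true → ∃[ z ] z ∈ I′ × z ≢ x × E G y z ≡ true
      third {v} {w} v∈ w∈ v≢x w≢x vw with meet x∈ y∈ v∈ w∈ xy vw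
      ... | inj₁ (inj₁ q) = ⊥-elim (v≢x (sym q))
      ... | inj₁ (inj₂ q) = ⊥-elim (w≢x (sym q))
      ... | inj₂ (inj₁ refl) = w , w∈ , w≢x , vw
      ... | inj₂ (inj₂ refl) = v , v∈ , v≢x , Eq.trans (E-sym G y v) vw
      second : ∃[ z ] z ∈ I′ × z ≢ x × E G y z ≡ true → ⊥
      second (z , z∈ , z≢x , yz) with search₂ (away? y) I′
      ... | inj₂ all = star y∈ all
      ... | inj₁ (v , w , v∈ , w∈ , v≢y , w≢y , vw) with meet x∈ y∈ v∈ w∈ xy vw | meet y∈ z∈ v∈ w∈ yz vw
      ...   | inj₂ (inj₁ q) | _ = v≢y (sym q)
      ...   | inj₂ (inj₂ q) | _ = w≢y (sym q)
      ...   | inj₁ _ | inj₁ (inj₁ q) = v≢y (sym q)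
      ...   | inj₁ _ | inj₁ (inj₂ q) = w≢y (sym q)
      ...   | inj₁ (inj₁ refl) | inj₂ (inj₁ refl) = z≢x refl
      ...   | inj₁ (inj₁ refl) | inj₂ (inj₂ refl) = triangle x∈ y∈ z∈ xy yz vw
      ...   | inj₁ (inj₂ refl) | inj₂ (inj₁ refl) = triangle x∈ y∈ z∈ xy yz (Eq.trans (E-sym G x z) vw)
      ...   | inj₁ (inj₂ refl) | inj₂ (inj₂ refl) = z≢x refl

  -- In the two extreme cases all but one of the neighbours of u are universal in the closure.
  module Extreme (bar : Barrier _≟ᴬ_ G W) where
    open BarrierProperties _≟ᴬ_ G un bar

    S : List A
    S = filter (λ x → E H u x BP.≟ true) W

    S-length : length S ≡ deg H W u
    S-length = filter-∑ W (E H u)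

    S-unique : Unique S
    S-unique = UP.filter⁺ (λ x → E H u x BP.≟ true) un

    S⁻ : ∀ {x} → x ∈ S → x ∈ W × E H u x ≡ true
    S⁻ = ∈-filter⁻ (λ x → E H u x BP.≟ true) {xs = W}

    -- The non-neighbours not accounted for by the counting bound (`excess≤mis` makes the
    -- subtraction exact). By `∑ex-≤` their total is small, so a configuration needing many of them
    -- is impossible.
    ex : A → ℕ
    ex x = mis H W x ∸ excess x

    ex+ : ∀ {x} → x ∈ W → ex x + excess x ≡ mis H W x
    ex+ x∈ = m∸n+n≡m (excess≤mis x∈)

    ∑ex : ∑ W ex + ∑ W excess ≡ Mis H W
    ∑ex = Eq.trans (sym (∑-+ W ex excess)) (∑-cong W ex+)

    few-H : Mis H W + 2 ≤ m * m + 5 * m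
    few-H = ≤-trans (+-monoˡ-≤ 2 (∑-mono W λ {x} _ → mis-anti {G = G} {H} G⊑H W x)) few

    ∑ex-≤ : ∑ W ex + (m + m + ((suc c + t) * c + c * t)) + 2 ≤ m * m + 5 * m
    ∑ex-≤ = ≤-trans (+-monoˡ-≤ 2 (≤-trans (+-monoʳ-≤ (∑ W ex) (≤-trans (≤-reflexive (cong (_+ ((suc c + t) * c + c * t)) (sym len))) (≤-trans (+-monoʳ-≤ (length W) (+-mono-≤ (≤-reflexive (cong (_* c) (sym countB))) (*-monoˡ-≤ t countA))) (≤-reflexive ∑excess)))) (≤-reflexive ∑ex))) few-H

    mis-sum : ∀ {x y} → x ∈ W → y ∈ W → x ≢ y → E H x y ≡ false → 2 + (m + m) ≤ mis H W x + mis H W y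
    mis-sum {x} {y} x∈ y∈ x≢y n = ar (deg H W x) (deg H W y) (mis H W x) (mis H W y) (length W) (m + m) len (deg+mis H W x) (deg+mis H W y) (closed x∈ y∈ x≢y n)
      where
      ar : ∀ a b a′ b′ L M → L ≡ M → a + a′ ≡ L → b + b′ ≡ L → 2 + (a + b) ≤ L → 2 + M ≤ a′ + b′
      ar a b a′ b′ L M eq ea eb h = +-cancelʳ-≤ L _ _ (≤-trans (≤-reflexive (Eq.trans (cong (λ M → 2 + M + L) (sym eq)) (Eq.trans (cong₂ (λ p q → 2 + p + q) (sym ea) (sym eb)) (r a a′ b b′)))) (+-monoʳ-≤ (a′ + b′) h))
        where
        r : ∀ a a′ b b′ → 2 + (a + a′) + (b + b′) ≡ a′ + b′ + (2 + (a + b))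
        r = solve-∀

    -- In the closure a non-adjacent pair has small degree sum, so the two together miss at least 2m
    -- + 2 vertices; whatever their excess does not cover is slack.
    ex-pair : ∀ {x y} q → x ∈ W → y ∈ W → x ≢ y → E H x y ≡ false → q + (excess x + excess y) ≤ 2 + (m + m) → q ≤ ex x + ex y
    ex-pair {x} {y} q x∈ y∈ x≢y n h = +-cancelʳ-≤ (excess x + excess y) _ _ (≤-trans h (≤-trans (mis-sum x∈ y∈ x≢y n) (≤-reflexive (Eq.trans (cong₂ _+_ (sym (ex+ x∈)) (sym (ex+ y∈))) (+-interchange (ex x) (excess x) (ex y) (excess y))))))

    ∑₂ : ∀ {x y} → x ∈ W → y ∈ W → x ≢ y → ex x + ex y ≤ ∑ W ex
    ∑₂ {x} {y} x∈ y∈ x≢y = ≤-trans (≤-reflexive (cong (ex x +_) (sym (+-identityʳ (ex y))))) (∑-⊆ ex ((x≢y ∷ []) ∷ [] ∷ []) λ { (here refl) → x∈ ; (there (here refl)) → y∈ })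

    ind*≤ : ∀ p k → ind p * k ≤ k
    ind*≤ true k = ≤-reflexive (*-identityˡ k)
    ind*≤ false k = z≤n

    excess≤ : ∀ x → excess x ≤ suc (c + t)
    excess≤ x = s≤s (+-mono-≤ (ind*≤ (inB x) c) (ind*≤ (inA x) t))

    excess-S : ∀ {x} → x ∈ S → excess x ≡ suc (ind (inA x) * t)
    excess-S x∈ = cong (λ p → suc (ind (not p) * c + ind (inA _) * t)) (proj₂ (S⁻ x∈))

    -- Not universal, since the vertex itself contributes 1 to `mis`.
    Bad : A → Set
    Bad x = 2 ≤ mis H W x

    missing : ∀ {x} → x ∈ W → Bad x → ∃[ y ] y ∈ W × x ≢ y × E H x y ≡ false
    missing {x} x∈ bad with pick x∈
    ... | W′ , p with ∑-positive W′ (λ y → ind (not (E H x y))) (s≤s⁻¹ (≤-trans bad (≤-reflexive (Eq.trans (∑-↭ _ p) (cong (λ e → ind (not e) + ∑ W′ (λ y → ind (not (E H x y)))) (E-irr H x))))))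
    ...   | y , y∈ , pos = y , ∈-resp-↭ (↭-sym p) (there y∈) , (λ { refl → ∉-head (Unique-↭ p un) y∈ }) , not-true (ind⁻ pos)

    good : ∀ {x y} → x ∈ W → ¬ Bad x → y ∈ W → y ≢ x → E H x y ≡ true
    good {x} {y} x∈ ¬bad y∈ y≢x with E H x y in eq
    ... | true = refl
    ... | false = ⊥-elim (¬bad (≤-trans (+-mono-≤ (≤-reflexive (sym (cong (ind ∘ not) (E-irr H x)))) (≤-reflexive (sym (Eq.trans (+-identityʳ _) (cong (ind ∘ not) eq)))))
        (∑-⊆ {xs = x ∷ y ∷ []} (λ y → ind (not (E H x y))) (((y≢x ∘ sym) ∷ []) ∷ [] ∷ []) λ { (here refl) → x∈ ; (there (here refl)) → y∈ })))

    conclude : ∀ U → Unique U → (∀ {x} → x ∈ U → x ∈ S) → 2 + length U ≡ m → (∀ {x} → x ∈ U → ¬ Bad x) → ⊥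
    conclude U uU sub lU ¬bad with extend-⊆ uU (λ x∈ → proj₁ (S⁻ (sub x∈)))
    ... | I′ , p = Universal.contradiction H G⊑H back U I′ p lU λ u∈ y∈ y≢u → good (proj₁ (S⁻ (sub u∈))) (¬bad u∈) y∈ y≢u

    bad? : ∀ xs → (∃[ x ] x ∈ xs × Bad x) ⊎ (∀ {x} → x ∈ xs → ¬ Bad x)
    bad? xs with any? (λ x → 2 ≤? mis H W x) xs
    ... | yes p = inj₁ (find p)
    ... | no q = inj₂ λ x∈ b → q (lose x∈ b)

    module CaseOne (i-eq : suc (deg H W u) ≡ m) where

      ct : c + t ≡ m
      ct = +-cancelˡ-≡ m _ _ (Eq.trans (cong (_+ (c + t)) (sym i-eq)) (Eq.trans (r (deg H W u) c t) (Eq.trans i+ len)))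
        where
        r : ∀ i c t → suc i + (c + t) ≡ i + (suc c + t)
        r = solve-∀

      c≡m : c ≡ m
      c≡m = ≤-antisym (≤-trans (m≤m+n c t) (≤-reflexive ct)) (≤-trans (≤-reflexive (sym i-eq)) c>)

      t≡0 : t ≡ 0
      t≡0 = +-cancelˡ-≡ c _ _ (Eq.trans ct (Eq.trans (sym c≡m) (sym (+-identityʳ c))))

      total : ∑ W ex + 2 ≤ m + m
      total = ar (∑ W ex) m (≤-trans (≤-reflexive (cong₂ (λ c t → ∑ W ex + (m + m + ((suc c + t) * c + c * t)) + 2) (sym c≡m) (sym t≡0))) ∑ex-≤)
        where
        ar : ∀ X m → X + (m + m + ((suc m + 0) * m + m * 0)) + 2 ≤ m * m + 5 * m → X + 2 ≤ m + m
        ar X m h = +-cancelʳ-≤ (m * m + 3 * m) _ _ (≤-trans (≤-reflexive (r₁ X m)) (≤-trans h (≤-reflexive (r₂ m))))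
          where
          r₁ : ∀ X m → X + 2 + (m * m + 3 * m) ≡ X + (m + m + ((suc m + 0) * m + m * 0)) + 2
          r₁ = solve-∀
          r₂ : ∀ m → m * m + 5 * m ≡ m + m + (m * m + 3 * m)
          r₂ = solve-∀

      too-much : m + m ≤ ∑ W ex → ⊥
      too-much h = <⇒≱ (≤-trans (s≤s (≤-trans (n≤1+n (∑ W ex)) (≤-reflexive (+-comm 1 (∑ W ex))))) (≤-trans (≤-reflexive (sym (+-suc (∑ W ex) 1))) total)) h

      excess-S₁ : ∀ {x} → x ∈ S → excess x ≡ 1
      excess-S₁ {x} x∈ = Eq.trans (excess-S x∈) (cong suc (Eq.trans (cong (ind (inA x) *_) t≡0) (*-zeroʳ (ind (inA x)))))

      -- Out of 2m + 2 misses, the excess accounts for 1 at s and at most m + 1 at w.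
      pair : ∀ {s w} → s ∈ S → w ∈ W → s ≢ w → E H s w ≡ false → m ≤ ex s + ex w
      pair {s} {w} s∈ w∈ s≢w n = ex-pair m (proj₁ (S⁻ s∈)) w∈ s≢w n (≤-trans (+-monoʳ-≤ m (+-mono-≤ (≤-reflexive (excess-S₁ s∈)) (≤-trans (excess≤ w) (≤-reflexive (cong suc ct))))) (≤-reflexive (r m)))
        where
        r : ∀ m → m + (1 + suc m) ≡ 2 + (m + m)
        r = solve-∀

      not-S : ∀ {s w} → s ∈ S → w ∈ W → s ≢ w → E H s w ≡ false → w ∉ S
      not-S {s} {w} s∈ w∈ s≢w n w∈S = too-much (≤-trans (ex-pair (m + m) (proj₁ (S⁻ s∈)) w∈ s≢w n (≤-trans (+-monoʳ-≤ (m + m) (+-mono-≤ (≤-reflexive (excess-S₁ s∈)) (≤-reflexive (excess-S₁ w∈S)))) (≤-reflexive (+-comm (m + m) 2)))) (∑₂ (proj₁ (S⁻ s∈)) w∈ s≢w))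

      -- Otherwise s, w, s′, w′ are four distinct vertices, and two disjoint non-adjacent pairs need
      -- slack 2m, beyond the total of 2m - 2.
      same-missing : ∀ {s s′ w w′} → s ∈ S → s′ ∈ S → s ≢ s′ → w ∈ W → w′ ∈ W → s ≢ w → s′ ≢ w′ → E H s w ≡ false → E H s′ w′ ≡ false → w ≡ w′
      same-missing {s} {s′} {w} {w′} s∈ s′∈ ss′ w∈ w′∈ sw s′w′ n n′ with w ≟ᴬ w′
      ... | yes eq = eq
      ... | no ww′ = ⊥-elim (too-much (≤-trans (+-mono-≤ (pair s∈ w∈ sw n) (pair s′∈ w′∈ s′w′ n′)) (≤-trans (≤-reflexive (r (ex s) (ex w) (ex s′) (ex w′)))
          (∑-⊆ {xs = s ∷ w ∷ s′ ∷ w′ ∷ []} ex ((sw ∷ ss′ ∷ sw′ ∷ []) ∷ (ws′ ∷ ww′ ∷ []) ∷ (s′w′ ∷ []) ∷ [] ∷ []) sub))))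
        where
        r : ∀ a b c d → a + b + (c + d) ≡ a + (b + (c + (d + 0)))
        r = solve-∀
        sw′ : s ≢ w′
        sw′ refl = not-S s′∈ w′∈ s′w′ n′ s∈
        ws′ : w ≢ s′
        ws′ refl = not-S s∈ w∈ sw n s′∈
        sub : ∀ {x} → x ∈ s ∷ w ∷ s′ ∷ w′ ∷ [] → x ∈ W
        sub (here refl) = proj₁ (S⁻ s∈)
        sub (there (here refl)) = w∈
        sub (there (there (here refl))) = proj₁ (S⁻ s′∈)
        sub (there (there (there (here refl)))) = w′∈

      -- Two non-universal neighbours of u have the same single non-neighbour w apart from
      -- themselves. So s misses only s and w, and the closure condition makes w miss all 2m
      -- vertices.
      isolated-from : ∀ {s s′} → s ∈ S → s′ ∈ S → s ≢ s′ → Bad s → Bad s′ → ∃[ w ] w ∈ W × deg H W w ≡ 0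
      isolated-from {s} {s′} s∈ s′∈ ss′ bad bad′ with missing (proj₁ (S⁻ s∈)) bad | missing (proj₁ (S⁻ s′∈)) bad′
      ... | w , w∈ , sw , n | w′ , w′∈ , s′w′ , n′ = w , w∈ , n≤0⇒n≡0 (+-cancelʳ-≤ (mis H W w) _ _ (≤-trans (≤-reflexive (Eq.trans (deg+mis H W w) len)) mis-w))
        where
        at-most-two : mis H W s ≤ 2
        at-most-two with mis H W s ≤? 2
        ... | yes le = le
        ... | no ≰2 with pick₂ (proj₁ (S⁻ s∈)) w∈ sw
        ...   | W″ , p with ∑-positive W″ (λ y → ind (not (E H s y))) (s≤s⁻¹ (s≤s⁻¹ (≤-trans (≰⇒> ≰2) (≤-reflexive (Eq.trans (∑-↭ _ p) (cong₂ (λ e f → ind (not e) + (ind (not f) + ∑ W″ (λ y → ind (not (E H s y))))) (E-irr H s) n))))))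
        ...     | y , y∈ , pos = ⊥-elim (y≢w (Eq.trans (same-missing s∈ s′∈ ss′ y∈W w′∈ s≢y s′w′ (not-true (ind⁻ pos)) n′) (sym (same-missing s∈ s′∈ ss′ w∈ w′∈ sw s′w′ n n′))))
          where
          uW″ = Unique-↭ p un
          y∈W : y ∈ W
          y∈W = ∈-resp-↭ (↭-sym p) (there (there y∈))
          s≢y : s ≢ y
          s≢y refl = ∉-head uW″ (there y∈)
          y≢w : y ≢ w
          y≢w refl with uW″
          ... | _ ∷ u′ = ∉-head u′ y∈
        mis-w : m + m ≤ mis H W w
        mis-w = +-cancelˡ-≤ 2 _ _ (≤-trans (mis-sum (proj₁ (S⁻ s∈)) w∈ sw n) (+-monoˡ-≤ (mis H W w) at-most-two))

      -- S has m - 1 members, one more than `Universal` needs: with at most one bad member the rest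
      -- serves, and with two bad members there is an isolated vertex.
      result : ∃[ w ] w ∈ W × deg H W w ≡ 0
      result with bad? S
      ... | inj₁ (s , s∈ , bad) with pick s∈
      ...   | U , p with bad? U
      ...     | inj₁ (s′ , s′∈ , bad′) = isolated-from s∈ (∈-resp-↭ (↭-sym p) (there s′∈)) (λ { refl → ∉-head (Unique-↭ p S-unique) s′∈ }) bad bad′
      ...     | inj₂ ¬bad = ⊥-elim (conclude U (Unique-++ʳ (s ∷ []) (Unique-↭ p S-unique)) (λ x∈ → ∈-resp-↭ (↭-sym p) (there x∈)) (Eq.trans (cong suc (Eq.trans (sym (↭-length p)) S-length)) i-eq) ¬bad)
      result | inj₂ ¬bad = ⊥-elim (drop-one S refl)
        where
        drop-one : ∀ S′ → S ≡ S′ → ⊥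
        drop-one [] eq with s≤s () ← ≤-trans m≥3 (≤-reflexive (Eq.trans (sym i-eq) (cong suc (Eq.trans (sym S-length) (cong length eq)))))
        drop-one (s ∷ U) eq = conclude U (Unique-++ʳ (s ∷ []) (subst Unique eq S-unique)) (λ {x} x∈ → subst (x ∈_) (sym eq) (there x∈)) (Eq.trans (cong suc (Eq.trans (sym (cong length eq)) S-length)) i-eq) λ {x} x∈ → ¬bad (subst (x ∈_) (sym eq) (there x∈))

    module CaseTwo (i-eq : 2 + deg H W u ≡ m) (m≥4 : 4 ≤ m) where

      i : ℕ
      i = deg H W u

      ct : c + t ≡ 3 + i
      ct = +-cancelˡ-≡ (suc i) _ _ (Eq.trans (r₁ i c t) (Eq.trans i+ (Eq.trans len (Eq.trans (cong (λ m → m + m) (sym i-eq)) (r₂ i)))))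
        where
        r₁ : ∀ i c t → suc i + (c + t) ≡ i + (suc c + t)
        r₁ = solve-∀
        r₂ : ∀ i → 2 + i + (2 + i) ≡ suc i + (3 + i)
        r₂ = solve-∀

      total : ∑ W ex + (2 + i + (2 + i) + ((suc c + t) * c + c * t)) + 2 ≤ (2 + i) * (2 + i) + 5 * (2 + i)
      total = subst (λ m → ∑ W ex + (m + m + ((suc c + t) * c + c * t)) + 2 ≤ m * m + 5 * m) (sym i-eq) ∑ex-≤

      -- c ≥ i + 1 leaves t at most 2. For t = 0 and t = 1 the counting bound already exceeds the
      -- budget; for t = 2 it leaves slack 2.
      values : ∀ X i c t → suc i ≤ c → c + t ≡ 3 + i → X + (2 + i + (2 + i) + ((suc c + t) * c + c * t)) + 2 ≤ (2 + i) * (2 + i) + 5 * (2 + i) → t ≡ 2 × X ≤ 2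
      values X i c zero _ ct h = ⊥-elim (absurd≤ (3 + X) (subst (λ c → X + (2 + i + (2 + i) + ((suc c + 0) * c + c * 0)) + 2 ≤ (2 + i) * (2 + i) + 5 * (2 + i)) (Eq.trans (sym (+-identityʳ c)) ct) h) (r X i))
        where
        r : ∀ X i → X + (2 + i + (2 + i) + ((suc (3 + i) + 0) * (3 + i) + (3 + i) * 0)) + 2 ≡ suc ((2 + i) * (2 + i) + 5 * (2 + i) + (3 + X))
        r = solve-∀
      values X i c 1 _ ct h = ⊥-elim (absurd≤ (1 + X) (subst (λ c → X + (2 + i + (2 + i) + ((suc c + 1) * c + c * 1)) + 2 ≤ (2 + i) * (2 + i) + 5 * (2 + i)) (suc-injective (Eq.trans (+-comm 1 c) ct)) h) (r X i))
        where
        r : ∀ X i → X + (2 + i + (2 + i) + ((suc (2 + i) + 1) * (2 + i) + (2 + i) * 1)) + 2 ≡ suc ((2 + i) * (2 + i) + 5 * (2 + i) + (1 + X))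
        r = solve-∀
      values X i c 2 _ ct h = refl , +-cancelʳ-≤ (i * i + 9 * i + 12) _ _ (≤-trans (≤-reflexive (r X i)) (≤-trans (subst (λ c → X + (2 + i + (2 + i) + ((suc c + 2) * c + c * 2)) + 2 ≤ (2 + i) * (2 + i) + 5 * (2 + i)) (suc-injective (suc-injective (Eq.trans (+-comm 2 c) ct))) h) (≤-reflexive (r′ i))))
        where
        r : ∀ X i → X + (i * i + 9 * i + 12) ≡ X + (2 + i + (2 + i) + ((suc (1 + i) + 2) * (1 + i) + (1 + i) * 2)) + 2
        r = solve-∀
        r′ : ∀ i → (2 + i) * (2 + i) + 5 * (2 + i) ≡ 2 + (i * i + 9 * i + 12)
        r′ = solve-∀
      values X i c (suc (suc (suc t))) lt ct h = ⊥-elim (absurd≤ t (≤-trans (+-monoˡ-≤ (3 + t) lt) (≤-reflexive ct)) (r i t))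
        where
        r : ∀ i t → suc i + (3 + t) ≡ suc (3 + i + t)
        r = solve-∀

      tv : t ≡ 2 × ∑ W ex ≤ 2
      tv = values (∑ W ex) i c t c> ct total

      i≥2 : 2 ≤ i
      i≥2 = s≤s⁻¹ (s≤s⁻¹ (≤-trans m≥4 (≤-reflexive (sym i-eq))))

      too-much : 1 + i ≤ ∑ W ex → ⊥
      too-much h = <⇒≱ (s≤s i≥2) (≤-trans h (proj₂ tv))

      -- Either kind of bad vertex needs slack i + 1, which is more than 2 because m ≥ 4 gives i ≥
      -- 2.
      ¬bad : ∀ {s} → s ∈ S → ¬ Bad s
      ¬bad {s} s∈ bad with inA s in eqA
      ... | true = too-much (≤-trans (+-cancelʳ-≤ 3 _ _ (≤-trans (≤-reflexive (r i)) (≤-trans big (≤-reflexive (sym (Eq.trans (cong (ex s +_) (sym e₃)) (ex+ (proj₁ (S⁻ s∈))))))))) (∑-≥ W ex (proj₁ (S⁻ s∈))))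
        where
        r : ∀ i → 1 + i + 3 ≡ suc (3 + i)
        r = solve-∀
        big : suc (3 + i) ≤ mis H W s
        big = ≤-trans (≤-reflexive (cong suc (sym ct))) (mis≥ _ _ (inA-deg (proj₁ (S⁻ s∈)) eqA) i+)
        e₃ : excess s ≡ 3
        e₃ = Eq.trans (excess-S s∈) (Eq.trans (cong (λ p → suc (ind p * t)) eqA) (cong (λ t → suc (1 * t)) (proj₁ tv)))
      ... | false with missing (proj₁ (S⁻ s∈)) bad
      ...   | w , w∈ , sw , n = too-much (≤-trans (ex-pair (1 + i) (proj₁ (S⁻ s∈)) w∈ sw n (≤-trans (+-monoʳ-≤ (1 + i) (+-mono-≤ (≤-reflexive e₁) (≤-trans (excess≤ w) (≤-reflexive (cong suc ct))))) (≤-reflexive (Eq.trans (r i) (cong (λ m → 2 + (m + m)) i-eq))))) (∑₂ (proj₁ (S⁻ s∈)) w∈ sw))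
        where
        e₁ : excess s ≡ 1
        e₁ = Eq.trans (excess-S s∈) (cong (λ p → suc (ind p * t)) eqA)
        r : ∀ i → 1 + i + (1 + suc (3 + i)) ≡ 2 + (2 + i + (2 + i))
        r = solve-∀

      result : ⊥
      result = conclude S S-unique id (Eq.trans (cong (2 +_) S-length) i-eq) ¬bad

-- Arithmetic

-- T is the number of colours; bounds on it are doubled because the binomial coefficients are halves.

lowPair-identity₁ : ∀ I q j → let b = I + q ; w = suc b + suc b + j in
  w + suc (j + I) * (suc b + j + 1 + 3 * q) + (4 + b * b + 2 * (b * (b + 4 + j))) + q * q ≡ w * w + 5 * b + 4 + q * (1 + 2 * I + 2 * j)
lowPair-identity₁ = solve-∀

lowPair-identity₂ : ∀ i j ρ → let q = 2 + 2 * suc i + 2 * j + ρ ; b = suc i + q ; w = suc b + suc b + j in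
  w + suc (j + suc i) * (suc b + j + 1 + 3 * q) + (4 * (b * b) + 2 * b + 4) ≡ w * w + 5 + 3 * b + (ρ + i * (16 + 9 * i + 6 * j + 4 * ρ))
lowPair-identity₂ = solve-∀

finish₁ : ∀ ww X e i b T Γ → ww + 5 * b + 4 ≤ X + Γ → Γ ≤ T + T + b → suc (i + i) + e ≡ T → i ≤ b → ww < X + (e + e)
finish₁ ww X e i b T Γ h₁ h₂ eT h₃ = +-cancelʳ-≤ (5 * b + 3) _ _ (≤-trans (≤-reflexive (r₁ ww b)) (≤-trans h₁ (≤-trans (+-monoʳ-≤ X h₂)
    (≤-trans (≤-reflexive (Eq.trans (cong (λ T → X + (T + T + b)) (sym eT)) (r₂ X e i b))) (≤-trans (+-monoʳ-≤ (X + (e + e) + b + 2) (*-monoʳ-≤ 4 h₃)) (≤-trans (n≤1+n _) (≤-reflexive (r₃ (X + (e + e)) b))))))))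
  where
  r₁ : ∀ ww b → suc ww + (5 * b + 3) ≡ ww + 5 * b + 4
  r₁ = solve-∀
  r₂ : ∀ X e i b → X + (suc (i + i) + e + (suc (i + i) + e) + b) ≡ X + (e + e) + b + 2 + 4 * i
  r₂ = solve-∀
  r₃ : ∀ Y b → suc (Y + b + 2 + 4 * b) ≡ Y + (5 * b + 3)
  r₃ = solve-∀

finish₂ : ∀ ww X e i b T Δ → ww + 5 + 3 * b ≤ X + Δ → Δ ≤ T + T → suc (i + i) + e ≡ T → 4 * i ≤ 3 * b + 2 → ww < X + (e + e)
finish₂ ww X e i b T Δ h₁ h₂ eT h₃ = +-cancelʳ-≤ (3 * b + 4) _ _ (≤-trans (≤-reflexive (r₁ ww b)) (≤-trans h₁ (≤-trans (+-monoʳ-≤ X h₂)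
    (≤-trans (≤-reflexive (Eq.trans (cong (λ T → X + (T + T)) (sym eT)) (r₂ X e i))) (≤-trans (+-monoʳ-≤ (X + (e + e) + 2) h₃) (≤-reflexive (r₃ (X + (e + e)) b)))))))
  where
  r₁ : ∀ ww b → suc ww + (3 * b + 4) ≡ ww + 5 + 3 * b
  r₁ = solve-∀
  r₂ : ∀ X e i → X + (suc (i + i) + e + (suc (i + i) + e)) ≡ X + (e + e) + 2 + 4 * i
  r₂ = solve-∀
  r₃ : ∀ Y b → Y + 2 + (3 * b + 2) ≡ Y + (3 * b + 4)
  r₃ = solve-∀

-- The missing pairs are concave in `suc i₂`, so one end of the range decides. The threshold on q is
-- where `lowPair-identity₁` changes sign: up to it the number of colours is compared with the join,
-- beyond it with the clique. The bound on 4i pays for the 2i + 1 edges lost to the deleted pair in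
-- the second comparison.
lowPair-numeric : ∀ b j i p e T → i + p ≡ suc b → 1 ≤ p → 4 * i ≤ 3 * b + 2 →
  4 + b * b + 2 * (b * (b + 4 + j)) ≤ T + T + b → 4 * (b * b) + 2 * b + 4 ≤ T + T → suc (i + i) + e ≡ T →
  ∀ i₂ q → suc i₂ + q ≡ b → let w = suc b + suc b + j in w * w < w + suc (j + suc i₂) * (suc b + j + 1 + 3 * q) + (e + e)
lowPair-numeric b j i p e T ip p≥1 4i≤ gT cT eT i₂ q iq with q ≤? 1 + 2 * suc i₂ + 2 * j
... | yes small = finish₁ _ (w + P) e i b T Γ (+-cancelʳ-≤ (q * q) _ _ (≤-trans (+-monoʳ-≤ (w * w + 5 * b + 4) (*-monoʳ-≤ q small)) (≤-reflexive (sym identity)))) gT eT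
    (+-cancelʳ-≤ 1 _ _ (≤-trans (+-monoʳ-≤ i p≥1) (≤-reflexive (Eq.trans ip (+-comm 1 b)))))
  where
  w = suc b + suc b + j
  P = suc (j + suc i₂) * (suc b + j + 1 + 3 * q)
  Γ = 4 + b * b + 2 * (b * (b + 4 + j))
  identity : w + P + Γ + q * q ≡ w * w + 5 * b + 4 + q * (1 + 2 * suc i₂ + 2 * j)
  identity = subst (λ b → let w = suc b + suc b + j in w + suc (j + suc i₂) * (suc b + j + 1 + 3 * q) + (4 + b * b + 2 * (b * (b + 4 + j))) + q * q ≡ w * w + 5 * b + 4 + q * (1 + 2 * suc i₂ + 2 * j)) iq (lowPair-identity₁ (suc i₂) q j)
... | no big = finish₂ _ (w + P) e i b T Δ (≤-trans (m≤m+n _ _) (≤-reflexive (sym identity))) cT eT 4i≤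
  where
  w = suc b + suc b + j
  P = suc (j + suc i₂) * (suc b + j + 1 + 3 * q)
  Δ = 4 * (b * b) + 2 * b + 4
  ρ = q ∸ (2 + 2 * suc i₂ + 2 * j)
  q-eq : 2 + 2 * suc i₂ + 2 * j + ρ ≡ q
  q-eq = m+[n∸m]≡n (≰⇒> big)
  identity : w + P + Δ ≡ w * w + 5 + 3 * b + (ρ + i₂ * (16 + 9 * i₂ + 6 * j + 4 * ρ))
  identity = subst (λ b → let w = suc b + suc b + j in w + suc (j + suc i₂) * (suc b + j + 1 + 3 * q) + (4 * (b * b) + 2 * b + 4) ≡ w * w + 5 + 3 * b + (ρ + i₂ * (16 + 9 * i₂ + 6 * j + 4 * ρ))) iq
    (subst (λ q → let b = suc i₂ + q ; w = suc b + suc b + j in w + suc (j + suc i₂) * (suc b + j + 1 + 3 * q) + (4 * (b * b) + 2 * b + 4) ≡ w * w + 5 + 3 * b + (ρ + i₂ * (16 + 9 * i₂ + 6 * j + 4 * ρ))) q-eq (lowPair-identity₂ i₂ j ρ))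

twice-≡ : ∀ {a b} → a + a ≡ b + b → a ≡ b
twice-≡ eq = ≤-antisym (twice-≤ (≤-reflexive eq)) (twice-≤ (≤-reflexive (sym eq)))

tri-odd : ∀ b → tri (suc (b + b)) ≡ b * suc (b + b)
tri-odd b = twice-≡ (+-cancelʳ-≡ (suc (b + b)) _ _ (Eq.trans (tri-eq (suc (b + b))) (r b)))
  where
  r : ∀ b → suc (b + b) * suc (b + b) ≡ b * suc (b + b) + b * suc (b + b) + suc (b + b)
  r = solve-∀

isolated-identity₁ : ∀ i q → let b = suc i + q ; w = suc b + suc b + 0 in
  w + suc (suc i) * (suc b + 0 + 1 + 3 * q) + (b * suc (b + b) + b * suc (b + b) + 2) ≡ suc (w * w) + (i * i + i + 1 + 4 * (suc i * q))
isolated-identity₁ = solve-∀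

isolated-identity₂ : ∀ i q → let b = suc i + q ; w = suc b + suc b + 0 in
  w + suc (suc i) * (suc b + 0 + 1 + 3 * q) + (b * suc (b + b) + b * suc (b + b) + 8) + 3 * i ≡ suc (w * w) + 4 * b + (i * i + 3 + 4 * (q * i))
isolated-identity₂ = solve-∀

3i≤i²+3 : ∀ i → 3 * i ≤ i * i + 3
3i≤i²+3 0 = z≤n
3i≤i²+3 1 = s≤s (s≤s (s≤s z≤n))
3i≤i²+3 2 = s≤s (s≤s (s≤s (s≤s (s≤s (s≤s z≤n)))))
3i≤i²+3 i@(suc (suc (suc _))) = ≤-trans (*-monoˡ-≤ i {3} {i} (s≤s (s≤s (s≤s z≤n)))) (m≤m+n _ 3)

-- The analogue of `lowPair-numeric` for j = 0, with e bounded from below by the clique alone; that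
-- one comparison then covers the whole range.
isolated-numeric : ∀ b e → let C = b * suc (b + b) in C < e ⊎ C + 4 ≤ e + (b + b) →
  ∀ i q → suc i + q ≡ b → let w = suc b + suc b + 0 in w * w < w + suc (0 + suc i) * (suc b + 0 + 1 + 3 * q) + (e + e)
isolated-numeric b e (inj₁ h) i q iq = ≤-trans (m≤m+n _ (i * i + i + 1 + 4 * (suc i * q))) (≤-trans (≤-reflexive (sym identity)) (+-monoʳ-≤ X (≤-trans (≤-reflexive (r C)) (+-mono-≤ h h))))
  where
  C = b * suc (b + b)
  w = suc b + suc b + 0
  X = w + suc (suc i) * (suc b + 0 + 1 + 3 * q)
  r : ∀ C → C + C + 2 ≡ suc C + suc C
  r = solve-∀
  identity : X + (C + C + 2) ≡ suc (w * w) + (i * i + i + 1 + 4 * (suc i * q))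
  identity = subst (λ b → let w = suc b + suc b + 0 in w + suc (suc i) * (suc b + 0 + 1 + 3 * q) + (b * suc (b + b) + b * suc (b + b) + 2) ≡ suc (w * w) + (i * i + i + 1 + 4 * (suc i * q))) iq (isolated-identity₁ i q)
isolated-numeric b e (inj₂ h) i q iq = +-cancelʳ-≤ (4 * b) _ _ (+-cancelʳ-≤ (3 * i) _ _ (≤-trans (+-monoʳ-≤ (suc (w * w) + 4 * b) (≤-trans (3i≤i²+3 i) (m≤m+n _ (4 * (q * i))))) (≤-trans (≤-reflexive (sym identity))
    (+-monoˡ-≤ (3 * i) (≤-trans (+-monoʳ-≤ X (≤-trans (≤-reflexive (r C)) (≤-trans (+-mono-≤ h h) (≤-reflexive (r′ e b))))) (≤-reflexive (sym (+-assoc X (e + e) (4 * b)))))))))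
  where
  C = b * suc (b + b)
  w = suc b + suc b + 0
  X = w + suc (suc i) * (suc b + 0 + 1 + 3 * q)
  r : ∀ C → C + C + 8 ≡ C + 4 + (C + 4)
  r = solve-∀
  r′ : ∀ e b → e + (b + b) + (e + (b + b)) ≡ e + e + 4 * b
  r′ = solve-∀
  identity : X + (C + C + 8) + 3 * i ≡ suc (w * w) + 4 * b + (i * i + 3 + 4 * (q * i))
  identity = subst (λ b → let w = suc b + suc b + 0 in w + suc (suc i) * (suc b + 0 + 1 + 3 * q) + (b * suc (b + b) + b * suc (b + b) + 8) + 3 * i ≡ suc (w * w) + 4 * b + (i * i + 3 + 4 * (q * i))) iq (isolated-identity₂ i q)

-- Here D is a minimum degree over 2 + μ vertices. Substituting T ≤ K + D into (2 + μ)D ≤ 2T bounds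
-- μT by (2 + μ)K, so a large enough lower bound T₀ is contradictory.
average : ∀ μ K T D T₀ → (2 + μ) * D ≤ T + T → T ≤ K + D → T₀ ≤ T → (2 + μ) * K < μ * T₀ → ⊥
average μ K T D T₀ h₁ h₂ h₃ h₄ = <⇒≱ h₄ (≤-trans (*-monoʳ-≤ μ h₃) (+-cancelʳ-≤ (T + T) _ _ (≤-trans (≤-reflexive (r₁ μ T)) (≤-trans (*-monoʳ-≤ (2 + μ) h₂) (≤-trans (≤-reflexive (*-distribˡ-+ (2 + μ) K D)) (+-monoʳ-≤ ((2 + μ) * K) h₁))))))
  where
  r₁ : ∀ μ T → μ * T + (T + T) ≡ (2 + μ) * T
  r₁ = solve-∀

numeral≤ : ∀ a b → {IsTrue (a ≤ᵇ b)} → a ≤ b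
numeral≤ a b {p} = ≤ᵇ⇒≤ a b p

-- 3 + 2b is n - 1 for j = 0. The lower bounds 7, 15, 26, 40 on T come from the join; from b = 5 on
-- the clique with three further colours is the stronger one, and one computation covers all b.
min-degree-numeric : ∀ b T D → 1 ≤ b → b * suc (b + b) + 3 ≤ T → 4 + b * b + 2 * (b * (b + 4 + 0)) ≤ T + T + b → (3 + (b + b)) * D ≤ T + T →
  b * suc (b + b) + (2 + D) ≤ T ⊎ b * suc (b + b) + (5 + D) ≤ T + (b + b)
min-degree-numeric 1 T D _ _ gT h with 5 + D ≤? T
... | yes p = inj₁ p
... | no q = ⊥-elim (average 3 4 T D 7 h (s≤s⁻¹ (≰⇒> q)) (twice-≤ (+-cancelʳ-≤ 1 14 _ gT)) (numeral≤ 21 21))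
min-degree-numeric 2 T D _ _ gT h with 15 + D ≤? T + 4
... | yes p = inj₂ p
... | no q = ⊥-elim (average 5 10 T D 15 h (+-cancelʳ-≤ 4 _ _ (≤-trans (s≤s⁻¹ (≰⇒> q)) (≤-reflexive (+-comm 4 (10 + D))))) (twice-≤ (+-cancelʳ-≤ 2 30 _ gT)) (numeral≤ 71 75))
min-degree-numeric 3 T D _ _ gT h with 26 + D ≤? T + 6
... | yes p = inj₂ p
... | no q = ⊥-elim (average 7 19 T D 26 h (+-cancelʳ-≤ 6 _ _ (≤-trans (s≤s⁻¹ (≰⇒> q)) (≤-reflexive (+-comm 6 (19 + D))))) (twice-≤ (+-cancelʳ-≤ 3 52 _ gT)) (numeral≤ 172 182))
min-degree-numeric 4 T D _ _ gT h with 41 + D ≤? T + 8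
... | yes p = inj₂ p
... | no q = ⊥-elim (average 9 32 T D 40 h (+-cancelʳ-≤ 8 _ _ (≤-trans (s≤s⁻¹ (≰⇒> q)) (≤-reflexive (+-comm 8 (32 + D))))) (twice-≤ (+-cancelʳ-≤ 4 80 _ gT)) (numeral≤ 353 360))
min-degree-numeric (suc (suc (suc (suc (suc b))))) T D _ cT _ h = large (5 + b) refl cT h
  where
  large : ∀ b′ → b′ ≡ 5 + b → b′ * suc (b′ + b′) + 3 ≤ T → (3 + (b′ + b′)) * D ≤ T + T → b′ * suc (b′ + b′) + (2 + D) ≤ T ⊎ b′ * suc (b′ + b′) + (5 + D) ≤ T + (b′ + b′)
  large b′ eq cT h with b′ * suc (b′ + b′) + (5 + D) ≤? T + (b′ + b′)
  ... | yes p = inj₂ p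
  ... | no q = ⊥-elim (average (1 + (b′ + b′)) K T D T₀ h T≤ (≤-trans (≤-reflexive T₀-eq) cT) (≤-trans (m≤m+n _ (2 * b)) (≤-reflexive (r₃′ b′ eq))))
    where
    K = 49 + 19 * b + 2 * (b * b)
    T₀ = 58 + 21 * b + 2 * (b * b)
    T₀-eq : T₀ ≡ b′ * suc (b′ + b′) + 3
    T₀-eq = Eq.trans (r b) (cong (λ x → x * suc (x + x) + 3) (sym eq))
      where
      r : ∀ b → 58 + 21 * b + 2 * (b * b) ≡ (5 + b) * suc (5 + b + (5 + b)) + 3
      r = solve-∀
    T≤ : T ≤ K + D
    T≤ = +-cancelʳ-≤ (b′ + b′) _ _ (s≤s⁻¹ (≤-trans (≰⇒> q) (≤-reflexive (Eq.trans (cong (λ x → x * suc (x + x) + (5 + D)) eq) (Eq.trans (r b D) (cong (λ x → suc (K + D + (x + x))) (sym eq)))))))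
      where
      r : ∀ b D → (5 + b) * suc (5 + b + (5 + b)) + (5 + D) ≡ suc (49 + 19 * b + 2 * (b * b) + D + (5 + b + (5 + b)))
      r = solve-∀
    r₃′ : ∀ b′ → b′ ≡ 5 + b → suc ((2 + (1 + (b′ + b′))) * K) + 2 * b ≡ (1 + (b′ + b′)) * T₀
    r₃′ b′ eq = subst (λ x → suc ((2 + (1 + (x + x))) * K) + 2 * b ≡ (1 + (x + x)) * T₀) {5 + b} {b′} (sym eq) (r₃ b)
      where
      r₃ : ∀ b → suc ((2 + (1 + (5 + b + (5 + b)))) * (49 + 19 * b + 2 * (b * b))) + 2 * b ≡ (1 + (5 + b + (5 + b))) * (58 + 21 * b + 2 * (b * b))
      r₃ = solve-∀

-- Two colours beyond the join give the budget of `star-count` for m = b + 2 + j; the summand j on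
-- the left is the diagonal of the j universal vertices.
few-numeric : ∀ b j M T → M + (T + T) ≤ (2 + b + (2 + b) + j) * (2 + b + (2 + b) + j) → 4 + b * b + 2 * (b * (b + 4 + j)) ≤ T + T + b →
  M + j + 2 ≤ (2 + b + j) * (2 + b + j) + 5 * (2 + b + j)
few-numeric b j M T h₁ h₂ = +-cancelʳ-≤ (Γ + (T + T)) _ _ (≤-trans (≤-reflexive (r₁ M j Γ T)) (≤-trans (+-monoˡ-≤ (Γ + j + 2) h₁) (≤-trans (≤-reflexive (r₂ N Γ j)) (≤-trans (+-monoʳ-≤ (N + j + 2) h₂) (≤-reflexive (r₃ b j (T + T)))))))
  where
  Γ = 4 + b * b + 2 * (b * (b + 4 + j))
  N = (2 + b + (2 + b) + j) * (2 + b + (2 + b) + j)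
  r₁ : ∀ M j Γ T → M + j + 2 + (Γ + (T + T)) ≡ M + (T + T) + (Γ + j + 2)
  r₁ = solve-∀
  r₂ : ∀ N Γ j → N + (Γ + j + 2) ≡ N + j + 2 + Γ
  r₂ = solve-∀
  r₃ : ∀ b j S → (2 + b + (2 + b) + j) * (2 + b + (2 + b) + j) + j + 2 + (S + b) ≡ (2 + b + j) * (2 + b + j) + 5 * (2 + b + j) + (4 + b * b + 2 * (b * (b + 4 + j)) + S)
  r₃ = solve-∀

-- The range p = P + 2 between the extreme cases p = 0, 1 and i = 0. Comparing the counting bound
-- with the budget keeps i small relative to p, which `middle-bound` and `middle-4i` turn into the
-- hypothesis of `lowPair-numeric`.
middle-numeric : ∀ b j i P M → suc (i + (2 + P)) ≡ 2 + b → 2 + b + (2 + b) + j + suc (j + i) * (2 + b + j + 1 + 3 * (2 + P)) ≤ M →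
  M + j + 2 ≤ (2 + b + j) * (2 + b + j) + 5 * (2 + b + j) → 2 * (suc (j + i) * (1 + P)) ≤ P * P + 7 * P + 8
middle-numeric b j i P M eq h₁ h₂ = +-cancelˡ-≤ (r * r + 9 * r + 2 * (r * P) + 2 * P + 6) _ _ (≤-trans (≤-reflexive (r₁ r P)) (≤-trans (≤-reflexive (Eq.trans (cong (λ m → m + m + r * (m + 1 + 3 * (2 + P)) + 2) m-eq) (r₂ b j (r * (2 + b + j + 1 + 3 * (2 + P)))))) (≤-trans (+-monoˡ-≤ 2 (+-monoˡ-≤ j h₁)) (≤-trans h₂ (≤-reflexive (Eq.trans (cong (λ m → m * m + 5 * m) (sym m-eq)) (r₃ r P)))))))
  where
  r = suc (j + i)
  m-eq : r + (2 + P) ≡ 2 + b + j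
  m-eq = Eq.trans (s₁ j i P) (Eq.trans (cong (_+ j) eq) refl)
    where
    s₁ : ∀ j i P → suc (j + i) + (2 + P) ≡ suc (i + (2 + P)) + j
    s₁ = solve-∀
  r₁ : ∀ r P → r * r + 9 * r + 2 * (r * P) + 2 * P + 6 + 2 * (r * (1 + P)) ≡ r + (2 + P) + (r + (2 + P)) + r * (r + (2 + P) + 1 + 3 * (2 + P)) + 2
  r₁ = solve-∀
  r₂ : ∀ b j Y → 2 + b + j + (2 + b + j) + Y + 2 ≡ 2 + b + (2 + b) + j + Y + j + 2
  r₂ = solve-∀
  r₃ : ∀ r P → (r + (2 + P)) * (r + (2 + P)) + 5 * (r + (2 + P)) ≡ r * r + 9 * r + 2 * (r * P) + 2 * P + 6 + (P * P + 7 * P + 8)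
  r₃ = solve-∀

middle-bound : ∀ r P → 2 * (r * (1 + P)) ≤ P * P + 7 * P + 8 → r ≤ 6 + 3 * P
middle-bound r P h with r ≤? 6 + 3 * P
... | yes p = p
... | no q = ⊥-elim (absurd≤ (5 * (P * P) + 13 * P + 5) (≤-trans (*-monoʳ-≤ 2 (*-monoˡ-≤ (1 + P) (≰⇒> q))) h) (s P))
  where
  s : ∀ P → 2 * (suc (6 + 3 * P) * (1 + P)) ≡ suc (P * P + 7 * P + 8 + (5 * (P * P) + 13 * P + 5))
  s = solve-∀

middle-4i : ∀ b i P → suc (i + (2 + P)) ≡ 2 + b → suc i ≤ 6 + 3 * P → 4 * i ≤ 3 * b + 2
middle-4i b i P eq h = +-cancelʳ-≤ 4 _ _ (≤-trans (≤-reflexive (s₁ i)) (≤-trans (+-monoʳ-≤ (3 * i + 3) h) (≤-reflexive (Eq.trans (s₂ i P) (Eq.trans (cong (3 *_) eq) (s₃ b))))))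
  where
  s₁ : ∀ i → 4 * i + 4 ≡ 3 * i + 3 + suc i
  s₁ = solve-∀
  s₂ : ∀ i P → 3 * i + 3 + (6 + 3 * P) ≡ 3 * suc (i + (2 + P))
  s₂ = solve-∀
  s₃ : ∀ b → 3 * (2 + b) ≡ 3 * b + 2 + 4
  s₃ = solve-∀

-- Upper bound; k = b + 2 and n = 2k + j.

module Forcing {n : ℕ} (c : EdgeColoring n) (b j : ℕ) (n≡ : n ≡ 2 + b + (2 + b) + j) (1≤b+j : 1 ≤ b + j)
  (nr : ∀ ms → ¬ RainbowList c (2 + b) ms)
  (C+2≤T : 2 + tri (suc (b + b)) ≤ numColors c) (C+3≤T : j ≡ 0 → 3 + tri (suc (b + b)) ≤ numColors c)
  (g+2≤T : 2 + (tri b + b * (b + 4 + j)) ≤ numColors c) where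

  R : Representing c
  R = representing c

  open NoRainbow c b j n≡ nr R
  open LowDegree c b j n≡ nr R C+2≤T C+3≤T
  open Representing R

  C : ℕ
  C = tri (suc (b + b))

  C≡ : C ≡ b * suc (b + b)
  C≡ = tri-odd b

  lenV : length V ≡ 2 + b + (2 + b) + j
  lenV = Eq.trans V-length n≡

  gT : 4 + b * b + 2 * (b * (b + 4 + j)) ≤ T + T + b
  gT = ≤-trans (≤-reflexive (Eq.trans (cong (λ s → 4 + s + 2 * (b * (b + 4 + j))) (sym (tri-eq b))) (r (tri b) b (b * (b + 4 + j))))) (+-monoˡ-≤ b (+-mono-≤ g+2≤T g+2≤T))
    where
    r : ∀ t b X → 4 + (t + t + b) + 2 * X ≡ 2 + (t + X) + (2 + (t + X)) + b
    r = solve-∀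

  cT : 4 * (b * b) + 2 * b + 4 ≤ T + T
  cT = ≤-trans (≤-reflexive (Eq.trans (r b) (cong (λ C → 2 + C + (2 + C)) (sym C≡)))) (+-mono-≤ C+2≤T C+2≤T)
    where
    r : ∀ b → 4 * (b * b) + 2 * b + 4 ≡ 2 + b * suc (b + b) + (2 + b * suc (b + b))
    r = solve-∀

  fewG : Mis G V + j + 2 ≤ (2 + b + j) * (2 + b + j) + 5 * (2 + b + j)
  fewG = few-numeric b j (Mis G V) T (≤-trans (+-monoʳ-≤ (Mis G V) enough) (≤-reflexive (Eq.trans (+-comm (Mis G V) _) (Eq.trans (Deg+Mis G V) (cong (λ l → l * l) lenV))))) gT

  -- For n = 2k only one low vertex may be available, so its partner a′ is a vertex of least degree
  -- among the other n - 1; averaging the degree sum 2T bounds the loss.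
  noIsolated : j ≡ 0 → ∀ a → deg G V a ≡ 0 → ⊥
  noIsolated j≡0 a da = main (pick (∈-allFin a))
    where
    b≥1 : 1 ≤ b
    b≥1 = ≤-trans 1≤b+j (≤-reflexive (Eq.trans (cong (b +_) j≡0) (+-identityʳ b)))
    remainder : ∀ D → b * suc (b + b) + (2 + D) ≤ T ⊎ b * suc (b + b) + (5 + D) ≤ T + (b + b) → ∃[ e ] suc D + e ≡ T × (b * suc (b + b) < e ⊎ b * suc (b + b) + 4 ≤ e + (b + b))
    remainder D (inj₁ h) = T ∸ suc D , m+[n∸m]≡n (≤-trans (n≤1+n _) (≤-trans (m≤n+m _ _) h)) ,
      inj₁ (+-cancelˡ-≤ (suc D) _ _ (≤-trans (≤-reflexive (r D (b * suc (b + b)))) (≤-trans h (≤-reflexive (sym (m+[n∸m]≡n (≤-trans (n≤1+n _) (≤-trans (m≤n+m _ _) h))))))))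
      where
      r : ∀ D C → suc D + suc C ≡ C + (2 + D)
      r = solve-∀
    remainder D (inj₂ h) = T ∸ suc D , m+[n∸m]≡n le ,
      inj₂ (+-cancelˡ-≤ (suc D) _ _ (≤-trans (≤-reflexive (r D (b * suc (b + b)))) (≤-trans h (≤-reflexive (Eq.trans (cong (_+ (b + b)) (sym (m+[n∸m]≡n le))) (+-assoc (suc D) (T ∸ suc D) (b + b)))))))
      where
      r : ∀ D C → suc D + (C + 4) ≡ C + (5 + D)
      r = solve-∀
      le : suc D ≤ T
      le = +-cancelˡ-≤ (b + b) _ _ (≤-trans (+-mono-≤ {b + b} {b * suc (b + b)} big (s≤s (m≤n+m D 4))) (≤-trans h (≤-reflexive (+-comm T (b + b)))))
        where
        big : b + b ≤ b * suc (b + b)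
        big = ≤-trans (n≤1+n _) (≤-trans (≤-reflexive (sym (*-identityˡ (suc (b + b))))) (*-monoˡ-≤ (suc (b + b)) b≥1))
    main : (∃[ V₁ ] V ↭ a ∷ V₁) → ⊥
    main (V₁ , p) = step (argmax V₁ (mis G V) (proj₂ (nonempty′ V₁ lenV₁)))
      where
      lenV₁ : length V₁ ≡ 3 + (b + b)
      lenV₁ = suc-injective (Eq.trans (sym (↭-length p)) (Eq.trans lenV (Eq.trans (cong (2 + b + (2 + b) +_) j≡0) (r b))))
        where
        r : ∀ b → 2 + b + (2 + b) + 0 ≡ suc (3 + (b + b))
        r = solve-∀
      step : (∃[ a′ ] a′ ∈ V₁ × (∀ {z} → z ∈ V₁ → mis G V z ≤ mis G V a′)) → ⊥
      step (a′ , a′∈ , max) = finish (remainder D (min-degree-numeric b T D b≥1 c₃ g₀ avg))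
        where
        D = deg G V a′
        c₃ : b * suc (b + b) + 3 ≤ T
        c₃ = ≤-trans (≤-reflexive (Eq.trans (+-comm _ 3) (cong (3 +_) (sym C≡)))) (C+3≤T j≡0)
        g₀ : 4 + b * b + 2 * (b * (b + 4 + 0)) ≤ T + T + b
        g₀ = subst (λ j → 4 + b * b + 2 * (b * (b + 4 + j)) ≤ T + T + b) j≡0 gT
        min : ∀ {z} → z ∈ V₁ → D ≤ deg G V z
        min {z} z∈ = +-cancelʳ-≤ (mis G V z) _ _ (≤-trans (+-monoʳ-≤ D (max z∈)) (≤-reflexive (Eq.trans (deg+mis G V a′) (sym (deg+mis G V z)))))
        avg : (3 + (b + b)) * D ≤ T + T
        avg = ≤-trans (≤-reflexive (Eq.trans (cong (_* D) (sym lenV₁)) (sym (∑-const V₁ D)))) (≤-trans (∑-mono V₁ min) (≤-trans (m≤n+m _ (deg G V a)) (≤-trans (≤-reflexive (sym (∑-↭ (deg G V) p))) exact)))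
        finish : (∃[ e ] suc D + e ≡ T × (b * suc (b + b) < e ⊎ b * suc (b + b) + 4 ≤ e + (b + b))) → ⊥
        finish (e , eT , alt) = noLowPair {a} {a′} D e (λ { refl → ∉-head (Unique-↭ p V-unique) a′∈ }) (≤-reflexive (cong (_+ D) da)) (≤-reflexive eT)
          (λ i q iq → subst (λ j → let w = suc b + suc b + j in w * w < w + suc (j + suc i) * (suc b + j + 1 + 3 * q) + (e + e)) (sym j≡0) (isolated-numeric b e alt i q iq))
          (subst (λ C → C < e ⊎ C + 4 ≤ e + (b + b)) (sym C≡) alt)

  noLowDegree : ∀ {i} p → i + p ≡ suc b → 1 ≤ p → 4 * i ≤ 3 * b + 2 → (low : List (Fin n)) → Unique low → 2 ≤ length low → (∀ {x} → x ∈ low → deg G V x ≤ i) →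
    (∃[ e ] suc (i + i) + e ≡ T × (C < e ⊎ C + 4 ≤ e + (b + b))) → ⊥
  noLowDegree {i} p ip p≥1 4i≤ (a ∷ a′ ∷ _) u _ low (e , eT , alt) = noLowPair {a} {a′} (i + i) e (λ { refl → ∉-head u (here refl) })
    (+-mono-≤ (low (here refl)) (low (there (here refl)))) (≤-reflexive eT) (lowPair-numeric b j i p e T ip p≥1 4i≤ gT cT eT) alt
  noLowDegree p ip p≥1 4i≤ (_ ∷ []) u (s≤s ()) low _

  noG-PM : PM (E (ext {j = j} G)) (extW V) → ⊥
  noG-PM pm with extractMatch (E G) {V} {2 + b} refl lenV pm
  ... | ms , es , (rest , p) , le = nr ms (le , u , edges-distinct ms es u)
    where
    u : Unique (flat ms)
    u = Unique-++ˡ (flat ms) (Unique-↭ (↭-sym p) V-unique)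

  m : ℕ
  m = 2 + b + j

  V′ : List (Fin n ⊎ Fin j)
  V′ = extW V

  hit : (p q x y : Fin n ⊎ Fin j) → Bool
  hit (inj₁ p) (inj₁ q) (inj₁ x) (inj₁ y) = E G x y ∧ does (col c x y ≟ col c p q)
  hit _ _ _ _ = false

  hit-unique : ∀ p q {x y x′ y′} → hit p q x y ≡ true → hit p q x′ y′ ≡ true → (x ≡ x′ × y ≡ y′) ⊎ (x ≡ y′ × y ≡ x′)
  hit-unique (inj₁ p) (inj₁ q) {inj₁ x} {inj₁ y} {inj₁ x′} {inj₁ y′} h h′ with distinct (proj₁ (∧⁻ h)) (proj₁ (∧⁻ h′)) (Eq.trans (does-true (_ ≟ _) (proj₂ (∧⁻ h))) (sym (does-true (_ ≟ _) (proj₂ (∧⁻ h′)))))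
    where
    ∧⁻ : ∀ {p q} → p ∧ q ≡ true → p ≡ true × q ≡ true
    ∧⁻ {true} {true} _ = refl , refl
  ... | inj₁ (refl , refl) = inj₁ (refl , refl)
  ... | inj₂ (refl , refl) = inj₂ (refl , refl)

  -- Non-adjacent vertices of the extension are both real, and what remains after removing them is
  -- again an extension, now of a list suited to k - 1 edges; `no-matching` applies there.
  forbidden : ∀ p q {W′} → V′ ↭ p ∷ q ∷ W′ → E (ext G) p q ≡ false → ¬ PM (λ x y → E (ext G) x y ∧ not (hit p q x y)) W′
  forbidden (inj₁ p) (inj₁ q) {W′} perm _ pm = main (pick₂ (∈-allFin p) (∈-allFin q) λ { refl → ∉-head uW (here refl) })
    where
    uW : Unique (inj₁ p ∷ inj₁ q ∷ W′)
    uW = Unique-↭ perm (extW-unique V-unique)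
    main : (∃[ V₀ ] V ↭ p ∷ q ∷ V₀) → ⊥
    main (V₀ , π) with extractMatch (E (minus G (col c p q))) {V₀} {suc b} π′ len₀ (pm-mono sub pm)
      where
      π′ : W′ ↭ extW V₀
      π′ = drop-∷ (drop-∷ (↭-trans (↭-sym perm) (++⁺ʳ (map inj₂ (allFin j)) (map⁺ inj₁ π))))
      len₀ : length V₀ ≡ suc b + suc b + j
      len₀ = suc-injective (suc-injective (Eq.trans (sym (↭-length π)) (Eq.trans lenV (r b j))))
        where
        r : ∀ b j → 2 + b + (2 + b) + j ≡ 2 + (suc b + suc b + j)
        r = solve-∀
      sub : ∀ x y → extE (E G) x y ∧ not (hit (inj₁ p) (inj₁ q) x y) ≡ true → extE (E (minus G (col c p q))) x y ≡ true
      sub (inj₁ x) (inj₁ y) h with E G x y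
      ... | true = h
      sub (inj₁ _) (inj₂ _) h = refl
      sub (inj₂ _) (inj₁ _) h = refl
      sub (inj₂ x) (inj₂ y) h with does (x FP.≟ y)
      ... | false = refl
    ... | ms , es , (rest , π″) , le = no-matching ms es (Unique-++ˡ (p ∷ q ∷ flat ms) (Unique-↭ (↭-trans π (prep p (prep q (↭-sym π″)))) V-unique)) le
  forbidden (inj₁ _) (inj₂ _) _ ()
  forbidden (inj₂ _) (inj₁ _) _ ()
  forbidden (inj₂ p) (inj₂ q) perm n _ = true≢false (ext-universal G p (inj₂ q) λ { refl → ∉-head (Unique-↭ perm (extW-unique V-unique)) (here refl) }) n

  module B = Balanced _≟⊎_ (ext {j = j} G) m (extW-unique V-unique) (extLen G V-unique {2 + b} {j} lenV) (s≤s (s≤s 1≤b+j))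
    (≤-trans (+-monoˡ-≤ 2 (ext-Mis G V)) fewG) noG-PM hit hit-unique forbidden

  module WithBarrier (bar : Barrier _≟⊎_ (ext {j = j} G) V′) where
    module D′ = Def G V-unique {2 + b} {j} lenV bar
    open D′ using (H; u; deg≥j; universal)
    open Deficient D′.deficient

    deg-u : j + i ≡ deg H V′ u
    deg-u = proj₂ D′.i₀

    noIsolatedH : (∃[ w ] w ∈ V′ × deg H V′ w ≡ 0) → ⊥
    noIsolatedH (inj₁ x , _ , d) = noIsolated (m+n≡0⇒n≡0 (deg G V x) z) x (m+n≡0⇒m≡0 (deg G V x) z)
      where
      z : deg G V x + j ≡ 0
      z = n≤0⇒n≡0 (≤-trans (deg≥j x) (≤-reflexive d))
    noIsolatedH (inj₂ a , _ , d) with nonempty′ V lenV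
    ... | x , x∈ with () ← ≤-trans (≤-trans (≤-reflexive (sym (cong ind (universal a (inj₁ x) λ ())))) (∑-≥ V′ (λ y → ind (E H (inj₂ a) y)) (∈-extW⁺ x∈))) (≤-reflexive d)

    caseOne : p ≡ 0 → ⊥
    caseOne p≡0 = noIsolatedH (B.Extreme.CaseOne.result bar (Eq.trans (cong suc (sym deg-u)) (Eq.trans (r j i) (cong (_+ j) (Eq.trans (cong (λ p → suc (i + p)) (sym p≡0)) eq)))))
      where
      r : ∀ j i → suc (j + i) ≡ suc (i + 0) + j
      r = solve-∀

    caseTwo : p ≡ 1 → 4 ≤ m → ⊥
    caseTwo p≡1 m≥4 = B.Extreme.CaseTwo.result bar (Eq.trans (cong (2 +_) (sym deg-u)) (Eq.trans (r j i) (cong (_+ j) (Eq.trans (cong (λ p → suc (i + p)) (sym p≡1)) eq)))) m≥4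
      where
      r : ∀ j i → 2 + (j + i) ≡ suc (i + 1) + j
      r = solve-∀

    contradiction : ⊥
    contradiction = cases i p refl refl
      where
      low-i : ∀ {i′} → i ≡ i′ → ∀ {x} → x ∈ low → deg G V x ≤ i′
      low-i eq {x} x∈ = subst (deg G V x ≤_) eq (low-deg x∈)
      len-i : ∀ {i′} → i ≡ i′ → suc (j + i′) ≤ length low
      len-i eq = ≤-trans (≤-reflexive (cong (λ i → suc (j + i)) (sym eq))) low-length
      eq-ip : ∀ {i′ p′} → i ≡ i′ → p ≡ p′ → i′ + p′ ≡ suc b
      eq-ip refl refl = suc-injective eq
      remainder : ∀ D → suc D ≤ T → suc (C + suc D) ≤ T ⊎ C + 4 + suc D ≤ T + (b + b) → ∃[ e ] suc D + e ≡ T × (C < e ⊎ C + 4 ≤ e + (b + b))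
      remainder D le alt = T ∸ suc D , m+[n∸m]≡n le , alt′ alt
        where
        alt′ : suc (C + suc D) ≤ T ⊎ C + 4 + suc D ≤ T + (b + b) → C < T ∸ suc D ⊎ C + 4 ≤ T ∸ suc D + (b + b)
        alt′ (inj₁ h) = inj₁ (+-cancelʳ-≤ (suc D) _ _ (≤-trans h (≤-reflexive (sym (m∸n+n≡m le)))))
        alt′ (inj₂ h) = inj₂ (+-cancelʳ-≤ (suc D) _ _ (≤-trans h (≤-reflexive (Eq.trans (cong (_+ (b + b)) (sym (m∸n+n≡m le))) (r (T ∸ suc D) (suc D) (b + b))))))
          where
          r : ∀ x y z → x + y + z ≡ x + z + y
          r = solve-∀
      1≤T : 1 ≤ T
      1≤T = ≤-trans (s≤s z≤n) C+2≤T
      cases : ∀ i′ p′ → i ≡ i′ → p ≡ p′ → ⊥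
      cases zero p′ i≡ p≡ = zeroCase j refl
        where
        zeroCase : ∀ j′ → j ≡ j′ → ⊥
        -- `low` is only known to have j + 1 members: a single vertex for j = 0, but two isolated
        -- vertices for j ≥ 1.
        zeroCase zero j≡ with nonempty low (≤-trans (s≤s z≤n) (len-i i≡))
        ... | a , a∈ = noIsolated j≡ a (n≤0⇒n≡0 (low-i i≡ a∈))
        zeroCase (suc j′) j≡ = noLowDegree p′ (eq-ip i≡ p≡) (≤-trans (s≤s z≤n) (≤-reflexive (sym (eq-ip i≡ p≡)))) z≤n low low-unique
          (≤-trans (s≤s (≤-trans (s≤s z≤n) (≤-trans (≤-reflexive (sym j≡)) (m≤m+n j 0)))) (len-i i≡)) (low-i i≡)
          (remainder 0 1≤T (inj₁ (≤-trans (≤-reflexive (cong suc (+-comm C 1))) C+2≤T)))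
      cases (suc i′) 0 i≡ p≡ = caseOne p≡
      cases (suc i′) 1 i≡ p≡ with 4 ≤? m
      ... | yes m≥4 = caseTwo p≡ m≥4
      -- Only k = 3 and n = 6 is left. There T is at least 7, and deleting two vertices of degree at
      -- most 1 leaves e above the 3 edges of the clique.
      ... | no m≱4 = small b j refl refl
        where
        b≡ : suc i′ ≡ b
        b≡ = suc-injective (Eq.trans (+-comm 1 (suc i′)) (eq-ip i≡ p≡))
        b+j≤1 : b + j ≤ 1
        b+j≤1 = s≤s⁻¹ (s≤s⁻¹ (s≤s⁻¹ (≰⇒> m≱4)))
        small : ∀ b′ j′ → b ≡ b′ → j ≡ j′ → ⊥
        small zero _ eqb _ with () ← Eq.trans b≡ eqb
        small (suc zero) zero eqb eqj = noLowDegree 1 (eq-ip i≡ p≡) ≤-refl (subst (λ x → 4 * x ≤ 3 * b + 2) (sym (Eq.trans b≡ eqb)) (subst (λ b → 4 ≤ 3 * b + 2) (sym eqb) (s≤s (s≤s (s≤s (s≤s z≤n)))))) low low-unique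
          (≤-trans (s≤s (≤-trans (s≤s z≤n) (m≤n+m (suc i′) j))) (len-i i≡)) (low-i i≡)
          (remainder (suc i′ + suc i′) (subst (λ x → suc (x + x) ≤ T) (sym (Eq.trans b≡ eqb)) (≤-trans (s≤s (s≤s (s≤s z≤n))) T≥7))
            (inj₁ (subst (λ x → suc (C + suc (x + x)) ≤ T) (sym (Eq.trans b≡ eqb)) (subst (λ b → suc (tri (suc (b + b)) + 3) ≤ T) (sym eqb) T≥7))))
          where
          T≥7 : 7 ≤ T
          T≥7 = subst₂ (λ b j → 2 + (tri b + b * (b + 4 + j)) ≤ T) eqb eqj g+2≤T
        small (suc zero) (suc _) eqb eqj with s≤s () ← ≤-trans (≤-reflexive (cong₂ _+_ (sym eqb) (sym eqj))) b+j≤1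
        small (suc (suc _)) _ eqb _ with s≤s () ← ≤-trans (≤-reflexive (sym eqb)) (≤-trans (m≤m+n b j) b+j≤1)
      cases (suc i′) (suc (suc P)) i≡ p≡ = noLowDegree (2 + P) ip (s≤s z≤n) 4i≤ low low-unique (≤-trans (s≤s (≤-trans (s≤s z≤n) (m≤n+m (suc i′) j))) (len-i i≡)) (low-i i≡)
          (remainder (suc i′ + suc i′) D≤T (inj₂ h₂))
        where
        ip : suc i′ + (2 + P) ≡ suc b
        ip = eq-ip i≡ p≡
        mid : 2 * (suc (j + suc i′) * (1 + P)) ≤ P * P + 7 * P + 8
        mid = middle-numeric b j (suc i′) P (Mis G V) (cong suc ip) (≤-trans (≤-reflexive (cong₂ (λ i p → 2 + b + (2 + b) + j + suc (j + i) * (2 + b + j + 1 + 3 * p)) (sym i≡) (sym p≡))) many) fewG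
        r≤ : suc (j + suc i′) ≤ 6 + 3 * P
        r≤ = middle-bound (suc (j + suc i′)) P mid
        4i≤ : 4 * suc i′ ≤ 3 * b + 2
        4i≤ = middle-4i b (suc i′) P (cong suc ip) (≤-trans (s≤s (m≤n+m (suc i′) j)) r≤)
        b≡ : suc i′ + suc P ≡ b
        b≡ = suc-injective (Eq.trans (sym (+-suc (suc i′) (suc P))) ip)
        D≤T : suc (suc i′ + suc i′) ≤ T
        D≤T = ≤-trans (s≤s (+-mono-≤ i≤b i≤b)) (≤-trans (≤-trans (≤-reflexive (sym (*-identityˡ (suc (b + b))))) (*-monoˡ-≤ (suc (b + b)) (≤-trans (s≤s z≤n) i≤b))) (≤-trans (≤-reflexive (sym C≡)) (≤-trans (≤-trans (n≤1+n C) (n≤1+n (suc C))) C+2≤T)))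
          where
          i≤b : suc i′ ≤ b
          i≤b = ≤-trans (m≤m+n (suc i′) (suc P)) (≤-reflexive b≡)
        h₂ : C + 4 + suc (suc i′ + suc i′) ≤ T + (b + b)
        h₂ = reduce P refl
          where
          reduce : ∀ P′ → P ≡ P′ → C + 4 + suc (suc i′ + suc i′) ≤ T + (b + b)
          -- With 2b = 2i + 2 + 2P the claim reads C + 3 ≤ T + 2P, so two colours beyond the clique
          -- suffice unless P = 0.
          reduce (suc P′) P≡ = ≤-trans (≤-trans (m≤m+n _ (2 * P′ + 1)) (≤-reflexive (Eq.trans (r C i′ P′) (cong (λ b → 2 + C + (b + b)) (Eq.trans (cong (λ P → suc i′ + suc P) (sym P≡)) b≡))))) (+-monoˡ-≤ (b + b) C+2≤T)
            where
            r : ∀ C i P → C + 4 + suc (suc i + suc i) + (2 * P + 1) ≡ 2 + C + (suc i + suc (suc P) + (suc i + suc (suc P)))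
            r = solve-∀
          reduce zero P≡ = ≤-trans (≤-reflexive (Eq.trans (r C i′) (cong (λ b → 3 + C + (b + b)) (Eq.trans (cong (λ P → suc i′ + suc P) (sym P≡)) b≡)))) (+-monoˡ-≤ (b + b) C₃)
            where
            r : ∀ C i → C + 4 + suc (suc i + suc i) ≡ 3 + C + (suc i + 1 + (suc i + 1))
            r = solve-∀
            r≤4 : suc (j + suc i′) ≤ 4
            r≤4 = twice-≤ (≤-trans (≤-reflexive (s (suc (j + suc i′)))) (subst (λ P → 2 * (suc (j + suc i′) * (1 + P)) ≤ P * P + 7 * P + 8) P≡ mid))
              where
              s : ∀ x → x + x ≡ 2 * (x * 1)
              s = solve-∀
            b₂ : suc i′ + 1 ≡ b
            b₂ = Eq.trans (cong (λ P → suc i′ + suc P) (sym P≡)) b≡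
            -- For j ≥ 1 the bound `r≤4` leaves only b = 2 and b = 3, where the join supplies the
            -- third colour.
            C₃ : 3 + C ≤ T
            C₃ = check i′ j refl refl
              where
              check : ∀ i₁ j₁ → i′ ≡ i₁ → j ≡ j₁ → 3 + C ≤ T
              check _ zero _ j≡ = C+3≤T j≡
              check 0 (suc j₁) i≡ j≡ = ≤-trans (≤-reflexive (cong (λ b → 3 + tri (suc (b + b))) bv)) (≤-trans (m≤m+n 13 (4 + 2 * j₁)) (≤-trans (≤-reflexive (s j₁)) (subst₂ (λ b j → 2 + (tri b + b * (b + 4 + j)) ≤ T) bv j≡ g+2≤T)))
                where
                bv : b ≡ 2
                bv = Eq.trans (sym b₂) (cong (λ i → suc i + 1) i≡)
                s : ∀ j → 13 + (4 + 2 * j) ≡ 2 + (1 + 2 * (6 + suc j))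
                s = solve-∀
              check 1 (suc j₁) i≡ j≡ = ≤-trans (≤-reflexive (cong (λ b → 3 + tri (suc (b + b))) bv)) (≤-trans (m≤m+n 24 (5 + 3 * j₁)) (≤-trans (≤-reflexive (s j₁)) (subst₂ (λ b j → 2 + (tri b + b * (b + 4 + j)) ≤ T) bv j≡ g+2≤T)))
                where
                bv : b ≡ 3
                bv = Eq.trans (sym b₂) (cong (λ i → suc i + 1) i≡)
                s : ∀ j → 24 + (5 + 3 * j) ≡ 2 + (3 + 3 * (7 + suc j))
                s = solve-∀
              check (suc (suc i₁)) (suc j₁) i≡ j≡ = ⊥-elim (absurd≤ (j₁ + i₁) (≤-trans (≤-reflexive (cong₂ (λ j i → suc (j + suc i)) (sym j≡) (sym i≡))) r≤4) (s j₁ i₁))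
                where
                s : ∀ j i → 1 + ((1 + j) + (3 + i)) ≡ 1 + (4 + (j + i))
                s = solve-∀

  contradiction : ⊥
  contradiction with PM⊎Barrier _≟⊎_ (ext {j = j} G) m (extW-unique V-unique) (extLen G V-unique {2 + b} {j} lenV)
  ... | inj₁ pm = noG-PM pm
  ... | inj₂ bar = WithBarrier.contradiction bar

-- The extremal number of (k-1)K₂ on n = 2k + j vertices, k = b + 2

-- The Erdős-Gallai formula: a complete graph on 2k - 3 vertices against k - 2 vertices joined to
-- everything, each of these having n - (k - 2) = b + 4 + j neighbours outside the set.
cliqueEdges joinEdges extremalEdges : ℕ → ℕ → ℕ
cliqueEdges b j = tri (suc (b + b))
joinEdges b j = tri b + b * (b + 4 + j)
extremalEdges b j = cliqueEdges b j ⊔ joinEdges b j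

ext-identity₁ : ∀ i p j → let b = i + p ; n = 2 + b + (2 + b) + j in
  n * n + p * (5 + 2 * b + 2 * j) + b ≡ (suc b + suc b + (2 + j) + suc (2 + j + i) * (suc b + (2 + j) + 1 + 3 * p)) + (b * b + 2 * (b * (b + 4 + j))) + 3 * p * p
ext-identity₁ = solve-∀

ext-identity₂ : ∀ i j ρ → let p = 6 + 2 * i + 2 * j + ρ ; b = i + p ; n = 2 + b + (2 + b) + j in
  n * n + i * (19 + 9 * i + 6 * j + 4 * ρ) ≡ (suc b + suc b + (2 + j) + suc (2 + j + i) * (suc b + (2 + j) + 1 + 3 * p)) + (b * suc (b + b) + b * suc (b + b))
ext-identity₂ = solve-∀

-- The upper bound on the edges is convex in i and attained at both ends: p = 0 is the join, i = 0
-- the clique. The threshold 5 + 2i + 2j is where the comparison with the join changes sign; beyond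
-- it the clique is large enough.
ext-numeric : ∀ b j i p x → i + p ≡ b → let n = 2 + b + (2 + b) + j in
  x + x + (suc b + suc b + (2 + j) + suc (2 + j + i) * (suc b + (2 + j) + 1 + 3 * p)) ≤ n * n → x ≤ extremalEdges b j
ext-numeric b j i p x ip h with p ≤? 5 + 2 * i + 2 * j
... | yes small = ≤-trans (twice-≤ (+-cancelʳ-≤ (L + (p * q + b)) _ _ (≤-trans (≤-reflexive (r₁ x L (p * q + b))) (≤-trans (+-monoˡ-≤ (p * q + b) h) (≤-trans (≤-reflexive identity) (≤-trans (+-monoʳ-≤ (L + Γ) pp) (≤-reflexive r₂))))))) (m≤n⊔m (cliqueEdges b j) (joinEdges b j))
  where
  n = 2 + b + (2 + b) + j
  q = 5 + 2 * b + 2 * j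
  L = suc b + suc b + (2 + j) + suc (2 + j + i) * (suc b + (2 + j) + 1 + 3 * p)
  Γ = b * b + 2 * (b * (b + 4 + j))
  identity : n * n + (p * q + b) ≡ L + Γ + 3 * p * p
  identity = Eq.trans (sym (+-assoc (n * n) (p * q) b)) (subst (λ b → let n = 2 + b + (2 + b) + j in n * n + p * (5 + 2 * b + 2 * j) + b ≡ (suc b + suc b + (2 + j) + suc (2 + j + i) * (suc b + (2 + j) + 1 + 3 * p)) + (b * b + 2 * (b * (b + 4 + j))) + 3 * p * p) ip (ext-identity₁ i p j))
  pp : 3 * p * p ≤ p * q
  pp = ≤-trans (≤-reflexive (*-comm (3 * p) p)) (*-monoʳ-≤ p (≤-trans (≤-reflexive (s₁ p)) (≤-trans (+-monoʳ-≤ (2 * p) small) (≤-reflexive (Eq.trans (s₂ p i j) (cong (λ b → 5 + 2 * b + 2 * j) ip))))))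
    where
    s₁ : ∀ p → 3 * p ≡ 2 * p + p
    s₁ = solve-∀
    s₂ : ∀ p i j → 2 * p + (5 + 2 * i + 2 * j) ≡ 5 + 2 * (i + p) + 2 * j
    s₂ = solve-∀
  r₁ : ∀ x L y → x + x + (L + y) ≡ x + x + L + y
  r₁ = solve-∀
  r₂ : L + Γ + p * q ≡ joinEdges b j + joinEdges b j + (L + (p * q + b))
  r₂ = Eq.trans (cong (λ s → L + (s + 2 * (b * (b + 4 + j))) + p * q) (sym (tri-eq b))) (s (tri b) b (b * (b + 4 + j)) L (p * q))
    where
    s : ∀ t b X L y → L + (t + t + b + 2 * X) + y ≡ t + X + (t + X) + (L + (y + b))
    s = solve-∀
... | no big = ≤-trans (twice-≤ (+-cancelʳ-≤ L _ _ (≤-trans h (≤-trans (m≤m+n _ (i * (19 + 9 * i + 6 * j + 4 * ρ))) (≤-reflexive (Eq.trans identity (Eq.trans (+-comm L _) (cong (λ C → C + C + L) (sym (tri-odd b))))))))) ) (m≤m⊔n (cliqueEdges b j) (joinEdges b j))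
  where
  n = 2 + b + (2 + b) + j
  L = suc b + suc b + (2 + j) + suc (2 + j + i) * (suc b + (2 + j) + 1 + 3 * p)
  ρ = p ∸ (6 + 2 * i + 2 * j)
  p-eq : 6 + 2 * i + 2 * j + ρ ≡ p
  p-eq = m+[n∸m]≡n (≰⇒> big)
  identity : n * n + i * (19 + 9 * i + 6 * j + 4 * ρ) ≡ L + (b * suc (b + b) + b * suc (b + b))
  identity = subst (λ b → let n = 2 + b + (2 + b) + j in n * n + i * (19 + 9 * i + 6 * j + 4 * ρ) ≡ (suc b + suc b + (2 + j) + suc (2 + j + i) * (suc b + (2 + j) + 1 + 3 * p)) + (b * suc (b + b) + b * suc (b + b))) ip
    (subst (λ p → let b = i + p ; n = 2 + b + (2 + b) + j in n * n + i * (19 + 9 * i + 6 * j + 4 * ρ) ≡ (suc b + suc b + (2 + j) + suc (2 + j + i) * (suc b + (2 + j) + 1 + 3 * p)) + (b * suc (b + b) + b * suc (b + b))) p-eq (ext-identity₂ i j ρ))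

allFin-length : ∀ n → length (allFin n) ≡ n
allFin-length n = length-tabulate {n = n} id

fromSimple : ∀ {n} → SimpleGraph n → Graph (Fin n)
fromSimple S = record { E = adj S ; E-sym = adj-sym S ; E-irr = adj-irrefl S }

filterᵇ-filter : ∀ (p : A → Bool) xs → filterᵇ p xs ≡ filter (λ x → p x BP.≟ true) xs
filterᵇ-filter p [] = refl
filterᵇ-filter p (x ∷ xs) with p x
... | true = cong (x ∷_) (filterᵇ-filter p xs)
... | false = filterᵇ-filter p xs

module _ {n : ℕ} (S : SimpleGraph n) where

  edgeList : List (Fin n × Fin n)
  edgeList = filter (λ p → adj S (proj₁ p) (proj₂ p) BP.≟ true) (edgesK n)

  edgeList-length : length edgeList ≡ numEdges S
  edgeList-length = cong length (sym (filterᵇ-filter (λ p → adj S (proj₁ p) (proj₂ p)) (edgesK n)))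

  edgeList-unique : Unique edgeList
  edgeList-unique = UP.filter⁺ _ (UP.filter⁺ _ (UP.cartesianProduct⁺ (UP.allFin⁺ n) (UP.allFin⁺ n)))

  ∈-edgeList⁻ : ∀ {x y} → (x , y) ∈ edgeList → x F.< y × adj S x y ≡ true
  ∈-edgeList⁻ p with ∈-filter⁻ (λ p → adj S (proj₁ p) (proj₂ p) BP.≟ true) {xs = edgesK n} p
  ... | q , h = ∈-edgesK⁻ q , h

  ∈-edgeList⁺ : ∀ {x y} → adj S x y ≡ true → (x , y) ∈ edgeList ⊎ (y , x) ∈ edgeList
  ∈-edgeList⁺ {x} {y} h with FP.<-cmp x y
  ... | tri< lt _ _ = inj₁ (∈-filter⁺ _ (∈-edgesK⁺ lt) h)
  ... | tri≈ _ refl _ = ⊥-elim (true≢false h (adj-irrefl S x))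
  ... | tri> _ _ gt = inj₂ (∈-filter⁺ _ (∈-edgesK⁺ gt) (Eq.trans (adj-sym S y x) h))

  numEdges-Deg : numEdges S + numEdges S ≤ Deg (fromSimple S) (allFin n)
  numEdges-Deg = ≤-trans (≤-reflexive (cong₂ _+_ (sym edgeList-length) (sym edgeList-length))) (handshake (adj S) (adj-sym S) edgeList edgeList-unique ∈-edgeList⁻)

  Deg-numEdges : Deg (fromSimple S) (allFin n) ≤ numEdges S + numEdges S
  Deg-numEdges = ≤-trans (handshake⁻ (adj S) edgeList ∈-edgeList⁺) (≤-reflexive (cong₂ _+_ edgeList-length edgeList-length))

  ordered-adj : ∀ p → adj S (proj₁ p) (proj₂ p) ≡ true → adj S (proj₁ (ordered p)) (proj₂ (ordered p)) ≡ true
  ordered-adj (x , y) h with x FP.<? y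
  ... | yes _ = h
  ... | no _ = Eq.trans (adj-sym S y x) h

  containsMatching : ∀ {k} ms → Edges (adj S) ms → Unique (flat ms) → k ≤ length ms → ContainsMatching S k
  containsMatching ms es u le = listMatching ms le u , λ t → ordered-adj _ (All.lookup es (∈-lookup {xs = ms} (F.inject≤ t le)))

  numEdges-≤ : ∀ b j → n ≡ 2 + b + (2 + b) + j → ¬ ContainsMatching S (suc b) → numEdges S ≤ extremalEdges b j
  numEdges-≤ b j n≡ no-match with match⊎deficient (fromSimple S) (UP.allFin⁺ n) {suc b} {2 + j} (Eq.trans (allFin-length n) (Eq.trans n≡ (r b j)))
    where
    r : ∀ b j → 2 + b + (2 + b) + j ≡ suc b + suc b + (2 + j)
    r = solve-∀
  ... | inj₁ (ms , es , (rest , p) , le) = ⊥-elim (no-match (containsMatching ms es (Unique-++ˡ (flat ms) (Unique-↭ (↭-sym p) (UP.allFin⁺ n))) le))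
  ... | inj₂ d = ext-numeric b j (Deficient.i d) (Deficient.p d) (numEdges S) (suc-injective (Deficient.eq d))
      (≤-trans (+-mono-≤ numEdges-Deg (Deficient.many d)) (≤-reflexive (Eq.trans (Deg+Mis (fromSimple S) (allFin n)) (cong (λ l → l * l) (Eq.trans (allFin-length n) n≡)))))

flat-member : ∀ {n k} (edge : Fin k → Fin n × Fin n) {x} → x ∈ flat (tabulate edge) → ∃[ t ] (x ≡ proj₁ (edge t) ⊎ x ≡ proj₂ (edge t))
flat-member {k = suc k} edge (here eq) = zero , inj₁ eq
flat-member {k = suc k} edge (there (here eq)) = zero , inj₂ eq
flat-member {k = suc k} edge (there (there x∈)) with flat-member (edge ∘ suc) x∈
... | t , h = suc t , h

matchingList : ∀ {n} k (edge : Fin k → Fin n × Fin n) → (∀ t → proj₁ (edge t) F.< proj₂ (edge t)) → (∀ s t → s ≢ t → D.Disjoint (edge s) (edge t)) →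
  Unique (flat (tabulate edge))
matchingList zero edge ok dis = []
matchingList {n} (suc k) edge ok dis = All.tabulate first ∷ All.tabulate second ∷ matchingList k (edge ∘ suc) (ok ∘ suc) (λ s t s≢t → dis (suc s) (suc t) (s≢t ∘ FP.suc-injective))
  where
  second : ∀ {x} → x ∈ flat (tabulate (edge ∘ suc)) → proj₂ (edge zero) ≢ x
  second x∈ with flat-member (edge ∘ suc) x∈
  ... | t , inj₁ refl = proj₁ (proj₂ (proj₂ (dis zero (suc t) λ ())))
  ... | t , inj₂ refl = proj₂ (proj₂ (proj₂ (dis zero (suc t) λ ())))
  first : ∀ {x} → x ∈ proj₂ (edge zero) ∷ flat (tabulate (edge ∘ suc)) → proj₁ (edge zero) ≢ x
  first (here refl) eq = FP.<-irrefl eq (ok zero)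
  first (there x∈) with flat-member (edge ∘ suc) x∈
  ... | t , inj₁ refl = proj₁ (dis zero (suc t) λ ())
  ... | t , inj₂ refl = proj₁ (proj₂ (dis zero (suc t) λ ()))

-- Extremal graphs

below : ∀ {n} → ℕ → Fin n → Bool
below q x = F.toℕ x <ᵇ q

below⁻ : ∀ {n} q (x : Fin n) → below q x ≡ true → F.toℕ x < q
below⁻ q x h = <ᵇ⇒< (F.toℕ x) q (subst IsTrue (sym h) tt)

count-below : ∀ n q → q ≤ n → ∑ (allFin n) (ind ∘ below q) ≡ q
count-below n zero _ = ∑-zero (allFin n) λ _ → refl
count-below (suc n) (suc q) (s≤s le) = cong suc (Eq.trans (cong (λ (xs : List (Fin (suc n))) → ∑ xs (ind ∘ below (suc q))) (sym (LP.map-tabulate {n = n} id F.suc))) (Eq.trans (∑-map F.suc (allFin n) (ind ∘ below (suc q))) (count-below n q le)))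

same : ∀ {n} → Fin n → Fin n → Bool
same x y = does (x FP.≟ y)

same-sym : ∀ {n} (x y : Fin n) → same x y ≡ same y x
same-sym x y with x FP.≟ y
... | yes refl = sym (dec-true (x FP.≟ x) refl)
... | no x≢y = sym (dec-false (y FP.≟ x) (x≢y ∘ sym))

same-refl : ∀ {n} (x : Fin n) → same x x ≡ true
same-refl x = dec-true (x FP.≟ x) refl

module _ (n q : ℕ) where

  complete : SimpleGraph n
  complete = record
    { adj = λ x y → (below q x ∧ below q y) ∧ not (same x y)
    ; adj-sym = λ x y → cong₂ (λ p s → p ∧ not s) (BP.∧-comm (below q x) (below q y)) (same-sym x y)
    ; adj-irrefl = λ x → Eq.trans (cong (λ s → (below q x ∧ below q x) ∧ not s) (same-refl x)) (BP.∧-zeroʳ _) }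

  joined : SimpleGraph n
  joined = record
    { adj = λ x y → (below q x ∨ below q y) ∧ not (same x y)
    ; adj-sym = λ x y → cong₂ (λ p s → p ∧ not s) (BP.∨-comm (below q x) (below q y)) (same-sym x y)
    ; adj-irrefl = λ x → Eq.trans (cong (λ s → (below q x ∨ below q x) ∧ not s) (same-refl x)) (BP.∧-zeroʳ _) }

  one-self : ∀ x → ∑ (allFin n) (λ y → ind (same x y)) ≤ 1
  one-self x = ∑-ind-unique (allFin n) (same x) (UP.allFin⁺ n) λ _ _ p p′ → Eq.trans (sym (does-true (x FP.≟ _) p)) (does-true (x FP.≟ _) p′)

  module _ (q≤n : q ≤ n) where

    others : ℕ
    others = n ∸ q

    q+r : q + others ≡ n
    q+r = m+[n∸m]≡n q≤n

    count-above : ∑ (allFin n) (ind ∘ not ∘ below q) ≡ others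
    count-above = +-cancelˡ-≡ q _ _ (Eq.trans (cong (_+ ∑ (allFin n) (ind ∘ not ∘ below q)) (sym (count-below n q q≤n)))
      (Eq.trans (sym (∑-+ (allFin n) _ _)) (Eq.trans (∑-cong (allFin n) λ {x} _ → ind-not (below q x)) (Eq.trans (∑-const (allFin n) 1) (Eq.trans (*-identityʳ _) (Eq.trans (allFin-length n) (sym q+r)))))))

    rows : ∀ (S : SimpleGraph n) lo hi → (∀ x → below q x ≡ true → mis (fromSimple S) (allFin n) x ≤ lo) → (∀ x → below q x ≡ false → mis (fromSimple S) (allFin n) x ≤ hi) →
      Mis (fromSimple S) (allFin n) ≤ q * lo + others * hi
    rows S lo hi h₁ h₂ = ≤-trans (∑-mono (allFin n) λ {x} _ → row x) (≤-reflexive (Eq.trans (∑-+ (allFin n) _ _) (cong₂ _+_ (Eq.trans (∑-* (allFin n) (ind ∘ below q) lo) (cong (_* lo) (count-below n q q≤n))) (Eq.trans (∑-* (allFin n) (ind ∘ not ∘ below q) hi) (cong (_* hi) count-above)))))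
      where
      row : ∀ x → mis (fromSimple S) (allFin n) x ≤ ind (below q x) * lo + ind (not (below q x)) * hi
      row x with below q x in eq
      ... | true = ≤-trans (h₁ x eq) (≤-reflexive (s lo))
        where
        s : ∀ l → l ≡ 1 * l + 0
        s = solve-∀
      ... | false = ≤-trans (h₂ x eq) (≤-reflexive (sym (*-identityˡ hi)))

    complete-edges : tri q ≤ numEdges complete
    complete-edges = twice-≤ (≤-trans deg≥ (Deg-numEdges complete))
      where
      lo : ∀ x → below q x ≡ true → mis (fromSimple complete) (allFin n) x ≤ 1 + others
      lo x bx = ≤-trans (∑-mono (allFin n) λ {y} _ → bit y) (≤-trans (≤-reflexive (∑-+ (allFin n) _ _)) (+-mono-≤ (one-self x) (≤-reflexive count-above)))
        where
        bit : ∀ y → ind (not ((below q x ∧ below q y) ∧ not (same x y))) ≤ ind (same x y) + ind (not (below q y))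
        bit y rewrite bx with below q y | same x y
        ... | true | true = s≤s z≤n
        ... | true | false = z≤n
        ... | false | true = s≤s z≤n
        ... | false | false = s≤s z≤n
      hi : ∀ x → below q x ≡ false → mis (fromSimple complete) (allFin n) x ≤ n
      hi x _ = ≤-trans (∑-mono (allFin n) λ {y} _ → ind≤1 _) (≤-reflexive (Eq.trans (∑-const (allFin n) 1) (Eq.trans (*-identityʳ _) (allFin-length n))))
      deg≥ : tri q + tri q ≤ Deg (fromSimple complete) (allFin n)
      deg≥ = +-cancelʳ-≤ (Mis (fromSimple complete) (allFin n)) _ _ (≤-trans (+-monoʳ-≤ (tri q + tri q) (rows complete (1 + others) n lo hi))
        (≤-reflexive (Eq.trans (cong (λ n → tri q + tri q + (q * (1 + others) + others * n)) (sym q+r)) (Eq.trans (s (tri q) q others) (Eq.trans (cong (λ t → t + q * others + others * (q + others)) (tri-eq q)) (Eq.trans (s′ q others) (Eq.trans (cong (λ n → n * n) q+r) (sym (Eq.trans (Deg+Mis (fromSimple complete) (allFin n)) (cong (λ l → l * l) (allFin-length n)))))))))))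
        where
        s : ∀ t q r → t + t + (q * (1 + r) + r * (q + r)) ≡ t + t + q + q * r + r * (q + r)
        s = solve-∀
        s′ : ∀ q r → q * q + q * r + r * (q + r) ≡ (q + r) * (q + r)
        s′ = solve-∀

    joined-edges : tri q + q * others ≤ numEdges joined
    joined-edges = twice-≤ (≤-trans deg≥ (Deg-numEdges joined))
      where
      lo : ∀ x → below q x ≡ true → mis (fromSimple joined) (allFin n) x ≤ 1
      lo x bx = ≤-trans (∑-mono (allFin n) λ {y} _ → bit y) (one-self x)
        where
        bit : ∀ y → ind (not ((below q x ∨ below q y) ∧ not (same x y))) ≤ ind (same x y)
        bit y rewrite bx with same x y
        ... | true = s≤s z≤n
        ... | false = z≤n
      hi : ∀ x → below q x ≡ false → mis (fromSimple joined) (allFin n) x ≤ others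
      hi x bx = ≤-trans (∑-mono (allFin n) λ {y} _ → bit y) (≤-reflexive count-above)
        where
        bit : ∀ y → ind (not ((below q x ∨ below q y) ∧ not (same x y))) ≤ ind (not (below q y))
        bit y with x FP.≟ y
        ... | yes refl rewrite bx = s≤s z≤n
        ... | no _ rewrite bx with below q y
        ...   | true = z≤n
        ...   | false = s≤s z≤n
      deg≥ : tri q + q * others + (tri q + q * others) ≤ Deg (fromSimple joined) (allFin n)
      deg≥ = +-cancelʳ-≤ (Mis (fromSimple joined) (allFin n)) _ _ (≤-trans (+-monoʳ-≤ (tri q + q * others + (tri q + q * others)) (rows joined 1 others lo hi))
        (≤-reflexive (Eq.trans (s (tri q) q others) (Eq.trans (cong (λ t → t + 2 * (q * others) + others * others) (tri-eq q)) (Eq.trans (s′ q others) (Eq.trans (cong (λ n → n * n) q+r) (sym (Eq.trans (Deg+Mis (fromSimple joined) (allFin n)) (cong (λ l → l * l) (allFin-length n))))))))))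
        where
        s : ∀ t q r → t + q * r + (t + q * r) + (q * 1 + r * r) ≡ t + t + q + 2 * (q * r) + r * r
        s = solve-∀
        s′ : ∀ q r → q * q + 2 * (q * r) + r * r ≡ (q + r) * (q + r)
        s′ = solve-∀

  private
    dist : ∀ {k} (M : MatchingIn n k) → Unique (flat (tabulate (edge M)))
    dist {k} M = matchingList k (edge M) (edge-ok M) (disjoint M)

  bounded : ∀ (xs : List (Fin n)) → Unique xs → (∀ {x} → x ∈ xs → F.toℕ x < q) → length xs ≤ q
  bounded xs u h = ≤-trans (≤-reflexive (sym (length-map F.toℕ xs))) (≤-trans (Unique-⊆-length (UP.map⁺ FP.toℕ-injective u) λ y∈ → small (∈-map⁻ F.toℕ y∈)) (≤-reflexive (length-upTo q)))
    where
    small : ∀ {y} → ∃[ x ] x ∈ xs × y ≡ F.toℕ x → y ∈ upTo q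
    small (x , x∈ , refl) = ∈-upTo⁺ (h x∈)

  flat-all : ∀ {k} (edge : Fin k → Fin n × Fin n) {P : Fin n → Set} → (∀ t → P (proj₁ (edge t)) × P (proj₂ (edge t))) → ∀ {x} → x ∈ flat (tabulate edge) → P x
  flat-all {suc k} edge h (here refl) = proj₁ (h zero)
  flat-all {suc k} edge h (there (here refl)) = proj₂ (h zero)
  flat-all {suc k} edge h (there (there x∈)) = flat-all (edge ∘ suc) (h ∘ suc) x∈

  complete-free : ∀ {k} → q < k + k → ¬ ContainsMatching complete k
  complete-free {k} lt (M , h) = <⇒≱ lt (≤-trans (≤-reflexive (sym (Eq.trans (length-flat (tabulate (edge M))) (cong₂ _+_ (length-tabulate (edge M)) (length-tabulate (edge M))))))
    (bounded (flat (tabulate (edge M))) (dist M) (flat-all (edge M) λ t → ends _ _ (h t))))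
    where
    ends : ∀ x y → (below q x ∧ below q y) ∧ not (same x y) ≡ true → F.toℕ x < q × F.toℕ y < q
    ends x y e with below q x in ex | below q y in ey
    ... | true | true = below⁻ q x ex , below⁻ q y ey

  -- Disjoint edges have distinct ends among the first q vertices, and every edge has such an end.
  joined-free : ∀ {k} → q < k → ¬ ContainsMatching joined k
  joined-free {k} lt (M , h) = <⇒≱ lt (≤-trans (≤-reflexive (sym (Eq.trans (length-map end (tabulate (edge M))) (length-tabulate (edge M))))) (bounded (map end (tabulate (edge M))) (ends-unique (tabulate (edge M)) (dist M)) small))
    where
    end : Fin n × Fin n → Fin n
    end (x , y) with below q x
    ... | true = x
    ... | false = y
    end-∈ : ∀ p ms → end p ∈ proj₁ p ∷ proj₂ p ∷ ms
    end-∈ (x , y) ms with below q x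
    ... | true = here refl
    ... | false = there (here refl)
    end-flat : ∀ ms {x} → x ∈ map end ms → x ∈ flat ms
    end-flat (p ∷ ms) (here refl) = end-∈ p (flat ms)
    end-flat (p ∷ ms) (there x∈) = there (there (end-flat ms x∈))
    ends-unique : ∀ ms → Unique (flat ms) → Unique (map end ms)
    ends-unique [] _ = []
    ends-unique (p ∷ ms) u@(_ ∷ _ ∷ u″) = All.tabulate (λ { x∈ refl → ∉-++ (proj₁ p ∷ proj₂ p ∷ []) u (end-∈ p []) (end-flat ms x∈) }) ∷ ends-unique ms u″
    end-small : ∀ p → (below q (proj₁ p) ∨ below q (proj₂ p)) ∧ not (same (proj₁ p) (proj₂ p)) ≡ true → F.toℕ (end p) < q
    end-small (x , y) e with below q x in ex
    ... | true = below⁻ q x ex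
    ... | false with below q y in ey
    ...   | true = below⁻ q y ey
    small : ∀ {x} → x ∈ map end (tabulate (edge M)) → F.toℕ x < q
    small x∈ with ∈-map⁻ end x∈
    ... | p , p∈ , refl with ∈-tabulate⁻ p∈
    ...   | t , refl = end-small (edge M t) (h t)

-- Colourings without rainbow matchings

module _ {n : ℕ} where

  ordered-id : ∀ {x y : Fin n} → x F.< y → ordered (x , y) ≡ (x , y)
  ordered-id {x} {y} lt with x FP.<? y
  ... | yes _ = refl
  ... | no ≮ = ⊥-elim (≮ lt)

  ordered-swap : ∀ (x y : Fin n) → ordered (x , y) ≡ ordered (y , x)
  ordered-swap x y with x FP.<? y | y FP.<? x
  ... | yes p | yes q = ⊥-elim (FP.<-asym p q)
  ... | yes _ | no _ = refl
  ... | no _ | yes _ = refl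
  ... | no p | no q with FP.≤-antisym (≮⇒≥ q) (≮⇒≥ p)
  ...   | refl = refl

  code : Fin n × Fin n → ℕ
  code p = F.toℕ (F.combine (proj₁ (ordered p)) (proj₂ (ordered p)))

  code-injective : ∀ {x y x′ y′ : Fin n} → x F.< y → x′ F.< y′ → code (x , y) ≡ code (x′ , y′) → (x , y) ≡ (x′ , y′)
  code-injective {x} {y} {x′} {y′} lt lt′ eq with FP.combine-injective x y x′ y′ (FP.toℕ-injective
      (Eq.trans (cong (λ p → F.toℕ (F.combine (proj₁ p) (proj₂ p))) (sym (ordered-id lt))) (Eq.trans eq (cong (λ p → F.toℕ (F.combine (proj₁ p) (proj₂ p))) (ordered-id lt′)))))
  ... | refl , refl = refl

  -- The colours 0, 1, 2 are reserved for h.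
  module Colouring (S : SimpleGraph n) (h : Fin n → Fin n → ℕ) (h-sym : ∀ x y → h x y ≡ h y x) where

    pickColour : Bool → ℕ → ℕ → ℕ
    pickColour true x _ = 3 + x
    pickColour false _ y = y

    colouring : EdgeColoring n
    colouring = record
      { col = λ x y → pickColour (adj S x y) (code (x , y)) (h x y)
      ; col-sym = λ x y → Eq.trans (cong₂ (λ a k → pickColour a k (h x y)) (adj-sym S x y) (cong (λ p → F.toℕ (F.combine (proj₁ p) (proj₂ p))) (ordered-swap x y))) (cong (pickColour (adj S y x) (code (y , x))) (h-sym x y)) }

    manyColours : ∀ hs → Unique hs → (∀ {γ} → γ ∈ hs → γ < 3 × (∃[ x ] ∃[ y ] x F.< y × adj S x y ≡ false × h x y ≡ γ)) → length hs + numEdges S ≤ numColors colouring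
    manyColours hs u occ = ≤-trans (≤-reflexive (sym (Eq.trans (length-++ hs) (cong (length hs +_) (Eq.trans (length-map (λ p → 3 + code p) (edgeList S)) (edgeList-length S))))))
        (numColors-≥ colouring (hs ++ map (λ p → 3 + code p) (edgeList S)) (UP.++⁺ u codes disj) occurs)
      where
      codes-unique : ∀ L → Unique L → (∀ {x y} → (x , y) ∈ L → x F.< y) → Unique (map (λ p → 3 + code p) L)
      codes-unique [] _ _ = []
      codes-unique ((x , y) ∷ L) u@(_ ∷ u′) lt = All.tabulate new ∷ codes-unique L u′ (lt ∘ there)
        where
        new : ∀ {γ} → γ ∈ map (λ p → 3 + code p) L → 3 + code (x , y) ≢ γ
        new γ∈ eq with ∈-map⁻ (λ p → 3 + code p) γ∈
        ... | (x′ , y′) , p , refl with code-injective (lt (here refl)) (lt (there p)) (+-cancelˡ-≡ 3 _ _ eq)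
        ...   | refl = ∉-head u p
      codes : Unique (map (λ p → 3 + code p) (edgeList S))
      codes = codes-unique (edgeList S) (edgeList-unique S) (proj₁ ∘ ∈-edgeList⁻ S)
      disj : ∀ {γ} → ¬ (γ ∈ hs × γ ∈ map (λ p → 3 + code p) (edgeList S))
      disj (p , q) with ∈-map⁻ (λ p → 3 + code p) q
      ... | e , _ , refl = <⇒≱ (proj₁ (occ p)) (m≤m+n 3 (code e))
      occurs : ∀ {γ} → γ ∈ hs ++ map (λ p → 3 + code p) (edgeList S) → ∃[ x ] ∃[ y ] x F.< y × col colouring x y ≡ γ
      occurs γ∈ with ∈-++⁻ hs γ∈
      ... | inj₁ p with proj₂ (occ p)
      ...   | x , y , lt , nadj , eq = x , y , lt , Eq.trans (cong (λ a → pickColour a (code (x , y)) (h x y)) nadj) eq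
      occurs γ∈ | inj₂ q with ∈-map⁻ (λ p → 3 + code p) q
      ...   | (x , y) , p , refl = x , y , proj₁ (∈-edgeList⁻ S p) , cong (λ a → pickColour a (code (x , y)) (h x y)) (proj₂ (∈-edgeList⁻ S p))

  module _ (S : SimpleGraph n) where
    open Colouring S (λ _ _ → 0) (λ _ _ → refl)

    plainColours : (∃[ x ] ∃[ y ] x F.< y × adj S x y ≡ false) → suc (numEdges S) ≤ numColors colouring
    plainColours (x , y , lt , nadj) = manyColours (0 ∷ []) ([] ∷ []) λ { (here refl) → s≤s z≤n , x , y , lt , nadj , refl }

    -- All edges outside S share the colour 0, so a rainbow matching contains at most one of them;
    -- dropping it, or any edge if there is none, leaves a matching in S.
    plainRainbow : ∀ {k} → HasRainbowMatching colouring (suc k) → ContainsMatching S k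
    plainRainbow {k} (M , rb) with FP.any? (λ t → adj S (proj₁ (edge M t)) (proj₂ (edge M t)) BP.≟ false)
    ... | yes (t₀ , n₀) = sub (F.punchIn t₀) (λ s t eq → FP.punchIn-injective t₀ s t eq) , λ t → other (F.punchIn t₀ t) (FP.punchInᵢ≢i t₀ t)
      where
      sub : (f : Fin k → Fin (suc k)) → (∀ s t → f s ≡ f t → s ≡ t) → MatchingIn n k
      sub f inj = record { edge = edge M ∘ f ; edge-ok = edge-ok M ∘ f ; disjoint = λ s t s≢t → disjoint M (f s) (f t) (s≢t ∘ inj s t) }
      other : ∀ t → t ≢ t₀ → adj S (proj₁ (edge M t)) (proj₂ (edge M t)) ≡ true
      other t t≢ with adj S (proj₁ (edge M t)) (proj₂ (edge M t)) in eq
      ... | true = refl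
      ... | false = ⊥-elim (rb t t₀ t≢ (Eq.trans (zero-col eq) (sym (zero-col n₀))))
        where
        zero-col : ∀ {x y} → adj S x y ≡ false → col colouring x y ≡ 0
        zero-col {x} {y} e = cong (λ a → pickColour a (code (x , y)) 0) e
    ... | no all = record { edge = edge M ∘ suc ; edge-ok = edge-ok M ∘ suc ; disjoint = λ s t s≢t → disjoint M (suc s) (suc t) (s≢t ∘ FP.suc-injective) } ,
      λ t → ≢false⇒true λ e → all (suc t , e)
      where
      ≢false⇒true : ∀ {p} → p ≢ false → p ≡ true
      ≢false⇒true {true} _ = refl
      ≢false⇒true {false} h = ⊥-elim (h refl)

-- For n = 2k the three vertices a, a′, z outside a rainbow complete graph on q = 2k - 3 vertices can see two further
-- colours: 2 on aa′ and on the edges from z to the complete graph, 1 on all the rest.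

module Three {n : ℕ} (q : ℕ) (n≡ : n ≡ 3 + q) where

  isZ : Fin n → Bool
  isZ x = does (F.toℕ x ≟ 2 + q)

  value : Bool → Bool → ℕ
  value true true = 2
  value true false = 1
  value false true = 1
  value false false = 2

  h : Fin n → Fin n → ℕ
  h x y = value (isZ x ∨ isZ y) (below q x ∨ below q y)

  h-sym : ∀ x y → h x y ≡ h y x
  h-sym x y = cong₂ value (BP.∨-comm (isZ x) (isZ y)) (BP.∨-comm (below q x) (below q y))

  open Colouring (complete n q) h h-sym public

  vertex : ∀ i → i < 3 + q → Fin n
  vertex i lt = F.fromℕ< (≤-trans lt (≤-reflexive (sym n≡)))

  toℕ-vertex : ∀ i lt → F.toℕ (vertex i lt) ≡ i
  toℕ-vertex i lt = FP.toℕ-fromℕ< _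

  a a′ z : Fin n
  a = vertex q (m≤n+m (suc q) 2)
  a′ = vertex (suc q) (n≤1+n (2 + q))
  z = vertex (2 + q) ≤-refl

  toℕ-a : F.toℕ a ≡ q
  toℕ-a = toℕ-vertex q (m≤n+m (suc q) 2)
  toℕ-a′ : F.toℕ a′ ≡ suc q
  toℕ-a′ = toℕ-vertex (suc q) (n≤1+n (2 + q))
  toℕ-z : F.toℕ z ≡ 2 + q
  toℕ-z = toℕ-vertex (2 + q) ≤-refl

  below-false : ∀ (x : Fin n) → q ≤ F.toℕ x → below q x ≡ false
  below-false x le = ≢true⇒false λ e → <⇒≱ (below⁻ q x e) le

  below-true : ∀ (x : Fin n) → F.toℕ x < q → below q x ≡ true
  below-true x lt with below q x | <⇒<ᵇ lt
  ... | true | _ = refl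

  isZ-true : ∀ x → F.toℕ x ≡ 2 + q → isZ x ≡ true
  isZ-true x eq = dec-true (F.toℕ x ≟ 2 + q) eq

  isZ-false : ∀ x → F.toℕ x < 2 + q → isZ x ≡ false
  isZ-false x lt = dec-false (F.toℕ x ≟ 2 + q) λ eq → <-irrefl eq lt

  a∉ : below q a ≡ false
  a∉ = below-false a (≤-reflexive (sym (toℕ-a)))
  a′∉ : below q a′ ≡ false
  a′∉ = below-false a′ (≤-trans (n≤1+n q) (≤-reflexive (sym (toℕ-a′))))
  z∉ : below q z ≡ false
  z∉ = below-false z (≤-trans (≤-trans (n≤1+n q) (n≤1+n (suc q))) (≤-reflexive (sym (toℕ-z))))
  aZ : isZ a ≡ false
  aZ = isZ-false a (≤-trans (s≤s (≤-reflexive (toℕ-a))) (n≤1+n (suc q)))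
  a′Z : isZ a′ ≡ false
  a′Z = isZ-false a′ (s≤s (≤-reflexive (toℕ-a′)))
  zZ : isZ z ≡ true
  zZ = isZ-true z (toℕ-z)

  a≢a′ : a ≢ a′
  a≢a′ eq = 1+n≢n (sym (Eq.trans (sym (toℕ-a)) (Eq.trans (cong F.toℕ eq) (toℕ-a′))))
  a≢z : a ≢ z
  a≢z eq = true≢false (Eq.trans (cong isZ eq) zZ) aZ
  a′≢z : a′ ≢ z
  a′≢z eq = true≢false (Eq.trans (cong isZ eq) zZ) a′Z

  data Kind (y : Fin n) : Set where
    inner : below q y ≡ true → isZ y ≡ false → Kind y
    isa : y ≡ a → Kind y
    isa′ : y ≡ a′ → Kind y
    isz : y ≡ z → Kind y

  kind : ∀ y → Kind y
  kind y with F.toℕ y <? q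
  ... | yes lt = inner (below-true y lt) (isZ-false y (≤-trans lt (≤-trans (n≤1+n q) (n≤1+n (suc q)))))
  ... | no ≮ with F.toℕ y ≟ q | F.toℕ y ≟ suc q
  ...   | yes eq | _ = isa (FP.toℕ-injective (Eq.trans eq (sym (toℕ-a))))
  ...   | no _ | yes eq = isa′ (FP.toℕ-injective (Eq.trans eq (sym (toℕ-a′))))
  ...   | no ≢q | no ≢q+1 = isz (FP.toℕ-injective (Eq.trans (≤-antisym (s≤s⁻¹ (≤-trans (FP.toℕ<n y) (≤-reflexive n≡))) (≤∧≢⇒< (≤∧≢⇒< (≮⇒≥ ≮) (≢q ∘ sym)) (≢q+1 ∘ sym))) (sym (toℕ-z))))

  outer : ∀ v y → below q v ≡ false → col colouring v y ≡ h v y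
  outer v y bv = cong (λ p → pickColour ((p ∧ below q y) ∧ not (same v y)) (code (v , y)) (h v y)) bv

  colour : ∀ v y {p r s t} → below q v ≡ false → isZ v ≡ p → isZ y ≡ r → below q y ≡ s → value (p ∨ r) s ≡ t → col colouring v y ≡ t
  colour v y bv zv zy by val = Eq.trans (outer v y bv) (Eq.trans (cong₂ value (cong₂ _∨_ zv zy) (cong₂ _∨_ bv by)) val)

  module _ {k} (k≡ : n ≡ k + k) (rainbow : HasRainbowMatching colouring k) where
    M = proj₁ rainbow
    rb = proj₂ rainbow

    ec : Fin k → ℕ
    ec t = col colouring (proj₁ (edge M t)) (proj₂ (edge M t))

    record Cover (v : Fin n) : Set where
      field
        t : Fin k
        y : Fin n
        y≢v : y ≢ v
        at : (v ≡ proj₁ (edge M t) × y ≡ proj₂ (edge M t)) ⊎ (v ≡ proj₂ (edge M t) × y ≡ proj₁ (edge M t))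
    open Cover

    -- A k-matching on n = 2k vertices is perfect, so every vertex has a partner; this is where the
    -- extra colour depends on n = 2k.
    cover : ∀ v → Cover v
    cover v with any? (v FP.≟_) (flat (tabulate (edge M)))
    ... | no v∉ = ⊥-elim (1+n≰n (≤-trans (≤-reflexive (cong suc (Eq.trans k≡ (sym (Eq.trans (length-flat (tabulate (edge M))) (cong₂ _+_ (length-tabulate (edge M)) (length-tabulate (edge M)))))))) (≤-trans (Unique-⊆-length (All.tabulate (λ { x∈ refl → v∉ x∈ }) ∷ matchingList k (edge M) (edge-ok M) (disjoint M)) λ {x} _ → ∈-allFin x) (≤-reflexive (allFin-length n)))))
    ... | yes v∈ with flat-member (edge M) v∈
    ...   | t , inj₁ refl = record { t = t ; y = proj₂ (edge M t) ; y≢v = λ eq → FP.<-irrefl (sym eq) (edge-ok M t) ; at = inj₁ (refl , refl) }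
    ...   | t , inj₂ refl = record { t = t ; y = proj₁ (edge M t) ; y≢v = λ eq → FP.<-irrefl eq (edge-ok M t) ; at = inj₂ (refl , refl) }

    cover-colour : ∀ {v} (C : Cover v) → ec (t C) ≡ col colouring v (y C)
    cover-colour record { at = inj₁ (refl , refl) } = refl
    cover-colour record { at = inj₂ (refl , refl) } = col-sym colouring _ _

    together : ∀ {v w} (C : Cover v) (D : Cover w) → v ≢ w → t C ≡ t D → y C ≡ w
    together record { at = inj₁ (refl , refl) } record { at = inj₁ (refl , refl) } v≢w refl = ⊥-elim (v≢w refl)
    together record { at = inj₁ (refl , refl) } record { at = inj₂ (refl , refl) } v≢w refl = refl
    together record { at = inj₂ (refl , refl) } record { at = inj₁ (refl , refl) } v≢w refl = refl
    together record { at = inj₂ (refl , refl) } record { at = inj₂ (refl , refl) } v≢w refl = ⊥-elim (v≢w refl)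

    partner : ∀ {v w} (C : Cover v) (D : Cover w) → y C ≡ w → t C ≡ t D
    partner C D eq with t C FP.≟ t D
    ... | yes p = p
    ... | no t≢ = ⊥-elim (clash (at C) (at D) (disjoint M (t C) (t D) t≢))
      where
      clash : (_ ≡ proj₁ (edge M (t C)) × y C ≡ proj₂ (edge M (t C))) ⊎ (_ ≡ proj₂ (edge M (t C)) × y C ≡ proj₁ (edge M (t C))) →
        (_ ≡ proj₁ (edge M (t D)) × y D ≡ proj₂ (edge M (t D))) ⊎ (_ ≡ proj₂ (edge M (t D)) × y D ≡ proj₁ (edge M (t D))) → D.Disjoint (edge M (t C)) (edge M (t D)) → ⊥
      clash (inj₁ (_ , e)) (inj₁ (e′ , _)) (_ , _ , d , _) = d (Eq.trans (sym e) (Eq.trans eq e′))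
      clash (inj₁ (_ , e)) (inj₂ (e′ , _)) (_ , _ , _ , d) = d (Eq.trans (sym e) (Eq.trans eq e′))
      clash (inj₂ (_ , e)) (inj₁ (e′ , _)) (d , _) = d (Eq.trans (sym e) (Eq.trans eq e′))
      clash (inj₂ (_ , e)) (inj₂ (e′ , _)) (_ , d , _) = d (Eq.trans (sym e) (Eq.trans eq e′))

    equalColours : ∀ {v w γ} (C : Cover v) (D : Cover w) → v ≢ w → y C ≢ w → col colouring v (y C) ≡ γ → col colouring w (y D) ≡ γ → ⊥
    equalColours C D v≢w y≢w e₁ e₂ = rb (t C) (t D) (λ eq → y≢w (together C D v≢w eq)) (Eq.trans (cover-colour C) (Eq.trans e₁ (Eq.trans (sym e₂) (sym (cover-colour D)))))

    ca = cover a
    ca′ = cover a′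
    cz = cover z

    -- The partner of a decides. If it is inner, a and a′ both lie on edges of colour 1; if it is
    -- a′, then z is matched into the complete graph and colour 2 repeats; if it is z, then a′ is
    -- matched into the complete graph and colour 1 repeats.
    contradiction : ⊥
    contradiction with kind (y ca)
    ... | isa e = y≢v ca e
    ... | inner b₁ z₁ = second (kind (y ca′))
      where
      ya≢ : y ca ≢ a′
      ya≢ e = true≢false (Eq.trans (cong (below q) (sym e)) b₁) a′∉
      one = colour a (y ca) a∉ aZ z₁ b₁ refl
      second : Kind (y ca′) → ⊥
      second (inner b₂ z₂) = equalColours ca ca′ a≢a′ ya≢ one (colour a′ (y ca′) a′∉ a′Z z₂ b₂ refl)
      second (isa e) = ya≢ (together ca ca′ a≢a′ (sym (partner ca′ ca e)))
      second (isa′ e) = y≢v ca′ e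
      second (isz e) = equalColours ca ca′ a≢a′ ya≢ one (colour a′ (y ca′) a′∉ a′Z (Eq.trans (cong isZ e) zZ) (Eq.trans (cong (below q) e) z∉) refl)
    ... | isa′ e₁ = second (kind (y cz))
      where
      ya≢ : y ca ≢ z
      ya≢ e = a′≢z (Eq.trans (sym e₁) e)
      two = colour a (y ca) a∉ aZ (Eq.trans (cong isZ e₁) a′Z) (Eq.trans (cong (below q) e₁) a′∉) refl
      second : Kind (y cz) → ⊥
      second (inner b₂ z₂) = equalColours ca cz a≢z ya≢ two (colour z (y cz) z∉ zZ z₂ b₂ refl)
      second (isa e) = ya≢ (together ca cz a≢z (sym (partner cz ca e)))
      second (isa′ e) = ya≢ (together ca cz a≢z (Eq.trans (partner ca ca′ e₁) (sym (partner cz ca′ e))))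
      second (isz e) = y≢v cz e
    ... | isz e₁ = second (kind (y ca′))
      where
      ya≢ : y ca ≢ a′
      ya≢ e = a′≢z (Eq.trans (sym e) e₁)
      one = colour a (y ca) a∉ aZ (Eq.trans (cong isZ e₁) zZ) (Eq.trans (cong (below q) e₁) z∉) refl
      second : Kind (y ca′) → ⊥
      second (inner b₂ z₂) = equalColours ca ca′ a≢a′ ya≢ one (colour a′ (y ca′) a′∉ a′Z z₂ b₂ refl)
      second (isa e) = ya≢ (together ca ca′ a≢a′ (sym (partner ca′ ca e)))
      second (isa′ e) = y≢v ca′ e
      second (isz e) = ya≢ (together ca ca′ a≢a′ (Eq.trans (partner ca cz e₁) (sym (partner ca′ cz e))))

  threeColours : 1 ≤ q → 2 + numEdges (complete n q) ≤ numColors colouring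
  threeColours q≥1 = manyColours (1 ∷ 2 ∷ []) (((λ ()) ∷ []) ∷ [] ∷ []) λ
    { (here refl) → s≤s (s≤s z≤n) , v₀ , a , ≤-trans (s≤s (≤-reflexive (toℕ-v₀))) (≤-trans q≥1 (≤-reflexive (sym (toℕ-a)))) , nonadj v₀ a a∉ ,
        cong₂ value (cong₂ _∨_ (isZ-false v₀ (≤-trans (s≤s (≤-reflexive (toℕ-v₀))) (s≤s z≤n))) aZ) (cong (_∨ below q a) (below-true v₀ (≤-trans (s≤s (≤-reflexive (toℕ-v₀))) q≥1)))
    ; (there (here refl)) → s≤s (s≤s (s≤s z≤n)) , a , a′ , ≤-trans (s≤s (≤-reflexive (toℕ-a))) (≤-reflexive (sym (toℕ-a′))) , nonadj a a′ a′∉ ,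
        cong₂ value (cong₂ _∨_ aZ a′Z) (cong₂ _∨_ a∉ a′∉) }
    where
    v₀ = vertex 0 (s≤s z≤n)
    toℕ-v₀ : F.toℕ v₀ ≡ 0
    toℕ-v₀ = toℕ-vertex 0 (s≤s z≤n)
    nonadj : ∀ x y → below q y ≡ false → adj (complete n q) x y ≡ false
    nonadj x y e = Eq.trans (cong (λ p → (below q x ∧ p) ∧ not (same x y)) e) (cong (_∧ not (same x y)) (BP.∧-zeroʳ (below q x)))

-- The rainbow number

module Numbers {n : ℕ} (b j : ℕ) (n≡ : n ≡ 2 + b + (2 + b) + j) where

  e : ℕ
  e = extremalEdges b j

  record Extremal : Set where
    field
      S : SimpleGraph n
      free : ¬ ContainsMatching S (suc b)
      size : numEdges S ≡ e
      nonedge : ∃[ x ] ∃[ y ] x F.< y × adj S x y ≡ false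

  -- The last two vertices; they supply the non-edge that shows the extra colour in use.
  outside : ∀ q → q ≤ 2 + (b + b) + j → ∃[ x ] ∃[ y ] x F.< y × below {n} q x ≡ false × below {n} q y ≡ false
  outside q le = x , y , ≤-trans (s≤s (≤-reflexive tx)) (≤-reflexive (sym ty)) , out x (≤-trans le (≤-reflexive (sym tx))) , out y (≤-trans le (≤-trans (n≤1+n _) (≤-reflexive (sym ty))))
    where
    N = 2 + (b + b) + j
    N≡ : 2 + N ≡ n
    N≡ = Eq.trans (r b j) (sym n≡)
      where
      r : ∀ b j → 2 + (2 + (b + b) + j) ≡ 2 + b + (2 + b) + j
      r = solve-∀
    lx : N < n
    lx = ≤-trans (n≤1+n _) (≤-reflexive N≡)
    ly : suc N < n
    ly = ≤-reflexive N≡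
    x = F.fromℕ< lx
    y = F.fromℕ< ly
    tx : F.toℕ x ≡ N
    tx = FP.toℕ-fromℕ< lx
    ty : F.toℕ y ≡ suc N
    ty = FP.toℕ-fromℕ< ly
    out : ∀ (v : Fin n) → q ≤ F.toℕ v → below q v ≡ false
    out v le = ≢true⇒false λ h → <⇒≱ (below⁻ q v h) le

  extremal : Extremal
  extremal with ≤-total (cliqueEdges b j) (joinEdges b j)
  ... | inj₁ C≤g = record
    { S = joined n b ; free = joined-free n b ≤-refl
    ; size = ≤-antisym (numEdges-≤ (joined n b) b j n≡ (joined-free n b ≤-refl)) (≤-trans (≤-reflexive (Eq.trans (m≤n⇒m⊔n≡n C≤g) (cong (λ r → tri b + b * r) (sym rest)))) (joined-edges n b b≤n))
    ; nonedge = proj₁ o , proj₁ (proj₂ o) , proj₁ (proj₂ (proj₂ o)) , cong₂ (λ p q → (p ∨ q) ∧ not (same (proj₁ o) (proj₁ (proj₂ o)))) (proj₁ (proj₂ (proj₂ (proj₂ o)))) (proj₂ (proj₂ (proj₂ (proj₂ o)))) }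
    where
    r : ∀ b j → 2 + b + (2 + b) + j ≡ b + (b + 4 + j)
    r = solve-∀
    b≤n : b ≤ n
    b≤n = ≤-trans (m≤m+n b (b + 4 + j)) (≤-reflexive (sym (Eq.trans n≡ (r b j))))
    rest : n ∸ b ≡ b + 4 + j
    rest = Eq.trans (cong (_∸ b) (Eq.trans n≡ (r b j))) (m+n∸m≡n b (b + 4 + j))
    o = outside b (≤-trans (m≤m+n b (2 + b + j)) (≤-reflexive (r′ b j)))
      where
      r′ : ∀ b j → b + (2 + b + j) ≡ 2 + (b + b) + j
      r′ = solve-∀
  ... | inj₂ g≤C = record
    { S = complete n q ; free = free′
    ; size = ≤-antisym (numEdges-≤ (complete n q) b j n≡ free′) (≤-trans (≤-reflexive (m≥n⇒m⊔n≡m g≤C)) (complete-edges n q (≤-trans (m≤m+n q (3 + j)) (≤-reflexive (sym (Eq.trans n≡ (r b j)))))))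
    ; nonedge = proj₁ o , proj₁ (proj₂ o) , proj₁ (proj₂ (proj₂ o)) , cong (λ p → (p ∧ below q (proj₁ (proj₂ o))) ∧ not (same (proj₁ o) (proj₁ (proj₂ o)))) (proj₁ (proj₂ (proj₂ (proj₂ o)))) }
    where
    q = suc (b + b)
    r : ∀ b j → 2 + b + (2 + b) + j ≡ suc (b + b) + (3 + j)
    r = solve-∀
    free′ : ¬ ContainsMatching (complete n q) (suc b)
    free′ = complete-free n q (≤-reflexive (cong suc (sym (+-suc b b))))
    o = outside q (≤-trans (n≤1+n q) (m≤m+n (suc q) j))

  open Extremal extremal

  isExt : IsExtMatching n (suc b) e
  isExt = (S , free , size) , λ G → numEdges-≤ G b j n≡

  atLeast : ∀ r′ → ForcesRainbow n (2 + b) r′ → e + 2 ≤ r′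
  atLeast r′ forces with r′ ≤? suc e
  ... | yes le = ⊥-elim (free (plainRainbow S (forces (Colouring.colouring S (λ _ _ → 0) (λ _ _ → refl)) (≤-trans le (≤-trans (s≤s (≤-reflexive (sym size))) (plainColours S nonedge))))))
  ... | no ≰ = ≤-trans (≤-reflexive (+-comm e 2)) (≰⇒> ≰)

  C≤e : tri (suc (b + b)) ≤ e
  C≤e = m≤m⊔n (cliqueEdges b j) (joinEdges b j)

  g≤e : tri b + b * (b + 4 + j) ≤ e
  g≤e = m≤n⊔m (cliqueEdges b j) (joinEdges b j)

  forces : ∀ r → 1 ≤ b + j → e + 2 ≤ r → (j ≡ 0 → 3 + tri (suc (b + b)) ≤ r) → ForcesRainbow n (2 + b) r
  forces r b+j≥1 e+2≤r C+3≤r c r≤T with rainbowList? c (2 + b)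
  ... | inj₁ (ms , rl) = fromList c ms rl
  ... | inj₂ nr = ⊥-elim (Forcing.contradiction c b j n≡ b+j≥1 nr (up C≤e) (λ j≡0 → ≤-trans (C+3≤r j≡0) r≤T) (up g≤e))
    where
    up : ∀ {x} → x ≤ e → 2 + x ≤ numColors c
    up le = ≤-trans (s≤s (s≤s le)) (≤-trans (≤-reflexive (+-comm 2 e)) (≤-trans e+2≤r r≤T))

  module Even (j≡0 : j ≡ 0) (b≥5 : 5 ≤ b) where

    -- Twice the difference is b² - 5b, so for n = 2k the clique catches up with the join at b = 5.
    -- This is the source of the condition k ≥ 7.
    g≤C : joinEdges b j ≤ cliqueEdges b j
    g≤C = subst (λ j → joinEdges b j ≤ cliqueEdges b j) (sym j≡0) (twice-≤ (+-cancelʳ-≤ b _ _ (≤-trans (≤-reflexive lhs) (≤-trans (+-monoʳ-≤ (3 * (b * b) + 3 * b) (*-monoˡ-≤ b b≥5)) (≤-reflexive rhs)))))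
      where
      lhs : joinEdges b 0 + joinEdges b 0 + b ≡ 3 * (b * b) + 3 * b + 5 * b
      lhs = Eq.trans (s₁ (tri b) b (b * (b + 4 + 0))) (Eq.trans (cong (_+ 2 * (b * (b + 4 + 0))) (tri-eq b)) (s₂ b))
        where
        s₁ : ∀ t b X → t + X + (t + X) + b ≡ t + t + b + 2 * X
        s₁ = solve-∀
        s₂ : ∀ b → b * b + 2 * (b * (b + 4 + 0)) ≡ 3 * (b * b) + 3 * b + 5 * b
        s₂ = solve-∀
      rhs : 3 * (b * b) + 3 * b + b * b ≡ cliqueEdges b 0 + cliqueEdges b 0 + b
      rhs = Eq.trans (s b) (cong (λ C → C + C + b) (sym (tri-odd b)))
        where
        s : ∀ b → 3 * (b * b) + 3 * b + b * b ≡ b * suc (b + b) + b * suc (b + b) + b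
        s = solve-∀

    e≡C : e ≡ tri (suc (b + b))
    e≡C = m≥n⇒m⊔n≡m g≤C

    q : ℕ
    q = suc (b + b)

    n≡3+q : n ≡ 3 + q
    n≡3+q = Eq.trans n≡ (Eq.trans (cong (2 + b + (2 + b) +_) j≡0) (r b))
      where
      r : ∀ b → 2 + b + (2 + b) + 0 ≡ 3 + suc (b + b)
      r = solve-∀

    n≡2k : n ≡ (2 + b) + (2 + b)
    n≡2k = Eq.trans n≡ (Eq.trans (cong (2 + b + (2 + b) +_) j≡0) (+-identityʳ _))

    atLeast₃ : ∀ r′ → ForcesRainbow n (2 + b) r′ → e + 3 ≤ r′
    atLeast₃ r′ forces with r′ ≤? 2 + e
    ... | yes le = ⊥-elim (Three.contradiction q n≡3+q n≡2k (forces (Three.colouring q n≡3+q) (≤-trans le (≤-trans (≤-trans (s≤s (s≤s (≤-reflexive e≡C))) (s≤s (s≤s (complete-edges n q (≤-trans (m≤n+m q 3) (≤-reflexive (sym n≡3+q))))))) (Three.threeColours q n≡3+q (s≤s z≤n))))))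
    ... | no ≰ = ≤-trans (≤-reflexive (+-comm e 3)) (≰⇒> ≰)

  -- For 3 ≤ k ≤ 6 and n = 2k the join has more edges than the clique, so two colours beyond the
  -- extremal number are already three beyond the clique.
  smallEven : j ≡ 0 → 1 ≤ b → b ≤ 4 → 3 + tri (suc (b + b)) ≤ e + 2
  smallEven j≡0 b≥1 b≤4 = ≤-trans (check b b≥1 b≤4) (≤-trans (≤-reflexive (cong (λ j → 2 + (tri b + b * (b + 4 + j))) (sym j≡0))) (≤-trans (+-monoʳ-≤ 2 g≤e) (≤-reflexive (+-comm 2 e))))
    where
    check : ∀ b → 1 ≤ b → b ≤ 4 → 3 + tri (suc (b + b)) ≤ 2 + (tri b + b * (b + 4 + 0))
    check 1 _ _ = numeral≤ 6 7
    check 2 _ _ = numeral≤ 13 15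
    check 3 _ _ = numeral≤ 24 26
    check 4 _ _ = numeral≤ 39 40
    check (suc (suc (suc (suc (suc _))))) _ (s≤s (s≤s (s≤s (s≤s ()))))

-- The exceptional case of two edges in four vertices

module Four where

  0₄ 1₄ 2₄ 3₄ : Fin 4
  0₄ = zero
  1₄ = suc zero
  2₄ = suc (suc zero)
  3₄ = suc (suc (suc zero))

  -- Without a rainbow pair complementary edges have equal colours, so the three edges at one vertex
  -- show every colour.
  forcesFour : ForcesRainbow 4 2 4
  forcesFour c 4≤T = decide (rainbowList? c 2)
    where
    γ₁ = col c 0₄ 1₄
    γ₂ = col c 0₄ 2₄
    γ₃ = col c 0₄ 3₄
    module _ (nr : ∀ ms → ¬ RainbowList c 2 ms) where
      match : ∀ x y z w → Unique (x ∷ y ∷ z ∷ w ∷ []) → col c z w ≡ col c x y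
      match x y z w u with col c x y ≟ col c z w
      ... | yes eq = sym eq
      ... | no ≢ = ⊥-elim (nr ((x , y) ∷ (z , w) ∷ []) (≤-refl , u , (≢ ∷ []) ∷ [] ∷ []))
      cover : ∀ {x y} → x F.< y → col c x y ∈ γ₁ ∷ γ₂ ∷ γ₃ ∷ []
      cover {zero} {suc zero} _ = here refl
      cover {zero} {suc (suc zero)} _ = there (here refl)
      cover {zero} {suc (suc (suc zero))} _ = there (there (here refl))
      cover {suc zero} {suc (suc zero)} _ = there (there (here (match 0₄ 3₄ 1₄ 2₄ (from-yes (unique? FP._≟_ (0₄ ∷ 3₄ ∷ 1₄ ∷ 2₄ ∷ []))))))
      cover {suc zero} {suc (suc (suc zero))} _ = there (here (match 0₄ 2₄ 1₄ 3₄ (from-yes (unique? FP._≟_ (0₄ ∷ 2₄ ∷ 1₄ ∷ 3₄ ∷ [])))))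
      cover {suc (suc zero)} {suc (suc (suc zero))} _ = here (match 0₄ 1₄ 2₄ 3₄ (from-yes (unique? FP._≟_ (0₄ ∷ 1₄ ∷ 2₄ ∷ 3₄ ∷ []))))
      cover {suc zero} {suc zero} (s≤s ())
      cover {suc (suc zero)} {suc zero} (s≤s ())
      cover {suc (suc zero)} {suc (suc zero)} (s≤s (s≤s ()))
      cover {suc (suc (suc zero))} {suc zero} (s≤s ())
      cover {suc (suc (suc zero))} {suc (suc zero)} (s≤s (s≤s ()))
      cover {suc (suc (suc zero))} {suc (suc (suc zero))} (s≤s (s≤s (s≤s ())))
    decide : (∃[ ms ] RainbowList c 2 ms) ⊎ (∀ ms → ¬ RainbowList c 2 ms) → HasRainbowMatching c 2
    decide (inj₁ (ms , rl)) = fromList c ms rl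
    decide (inj₂ nr) = ⊥-elim (<⇒≱ 4≤T (numColors-≤ c (γ₁ ∷ γ₂ ∷ γ₃ ∷ []) (cover nr)))

  -- xy and its complement zw have sums s and 6 - s.
  fold : ℕ → ℕ
  fold s = s ⊓ (6 ∸ s)

  three : EdgeColoring 4
  three = record { col = λ x y → fold (F.toℕ x + F.toℕ y) ; col-sym = λ x y → cong fold (+-comm (F.toℕ x) (F.toℕ y)) }

  complement : ∀ x y z w → Unique (x ∷ y ∷ z ∷ w ∷ []) → col three x y ≡ col three z w
  complement = from-yes (FP.all? λ x → FP.all? λ y → FP.all? λ z → FP.all? λ w → unique? FP._≟_ (x ∷ y ∷ z ∷ w ∷ []) →-dec (col three x y ≟ col three z w))

  noRainbow : ¬ HasRainbowMatching three 2
  noRainbow (M , rb) = rb zero (suc zero) (λ ()) (complement _ _ _ _ (matchingList 2 (edge M) (edge-ok M) (disjoint M)))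

  isFour : IsRainbowNumber 4 2 4
  isFour = forcesFour , λ r′ forces → ≰⇒> λ le → noRainbow (forces three le)

theorem1p3 : ∀ (k n : ℕ) → 2 ≤ k → 2 * k ≤ n →
    ∃[ e ] (IsExtMatching n (k ∸ 1) e
    × ((n ≡ 4 × k ≡ 2) → IsRainbowNumber n k 4)
    × ((n ≡ 2 * k × 7 ≤ k) → IsRainbowNumber n k (e + 3))
    × (¬ (n ≡ 4 × k ≡ 2) → ¬ (n ≡ 2 * k × 7 ≤ k) → IsRainbowNumber n k (e + 2)))
theorem1p3 (suc zero) n (s≤s ()) _
theorem1p3 (suc (suc b)) n _ 2k≤n = e , isExt , four , even , other
  where
  k = suc (suc b)
  j = n ∸ 2 * k
  n≡ : n ≡ 2 + b + (2 + b) + j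
  n≡ = Eq.trans (sym (m+[n∸m]≡n 2k≤n)) (cong (_+ j) (r k))
    where
    r : ∀ k → 2 * k ≡ k + k
    r = solve-∀
  open Numbers b j n≡

  j≡0 : n ≡ 2 * k → j ≡ 0
  j≡0 eq = Eq.trans (cong (_∸ 2 * k) eq) (n∸n≡0 (2 * k))

  four : (n ≡ 4 × k ≡ 2) → IsRainbowNumber n k 4
  four (n≡4 , k≡2) = subst₂ (λ n k → IsRainbowNumber n k 4) (sym n≡4) (sym k≡2) Four.isFour

  even : (n ≡ 2 * k × 7 ≤ k) → IsRainbowNumber n k (e + 3)
  even (n≡2k , 7≤k) = forces (e + 3) (≤-trans (s≤s z≤n) (≤-trans b≥5 (m≤m+n b j))) (+-monoʳ-≤ e (n≤1+n 2)) (λ _ → ≤-trans (+-monoʳ-≤ 3 C≤e) (≤-reflexive (+-comm 3 e))) , Even.atLeast₃ (j≡0 n≡2k) b≥5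
    where
    b≥5 : 5 ≤ b
    b≥5 = s≤s⁻¹ (s≤s⁻¹ 7≤k)

  other : ¬ (n ≡ 4 × k ≡ 2) → ¬ (n ≡ 2 * k × 7 ≤ k) → IsRainbowNumber n k (e + 2)
  other ¬four ¬even = forces (e + 2) b+j≥1 ≤-refl odd , atLeast
    where
    b+j≥1 : 1 ≤ b + j
    -- The excluded case n = 4, k = 2 is exactly b = j = 0; otherwise m = b + 2 + j is at least 3,
    -- as the extreme cases require.
    b+j≥1 = n≢0⇒n>0 λ eq → ¬four (Eq.trans n≡ (cong₂ (λ b j → 2 + b + (2 + b) + j) (m+n≡0⇒m≡0 b eq) (m+n≡0⇒n≡0 b eq)) , cong (2 +_) (m+n≡0⇒m≡0 b eq))
    odd : j ≡ 0 → 3 + tri (suc (b + b)) ≤ e + 2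
    odd j≡ = smallEven j≡ (≤-trans b+j≥1 (≤-reflexive (Eq.trans (cong (b +_) j≡) (+-identityʳ b)))) (s≤s⁻¹ (≰⇒> λ b≥5 → ¬even (n≡2k , s≤s (s≤s b≥5))))
      where
      n≡2k : n ≡ 2 * k
      n≡2k = Eq.trans (sym (m+[n∸m]≡n 2k≤n)) (Eq.trans (cong (2 * k +_) j≡) (+-identityʳ (2 * k)))
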